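{- Let $q$ be a prime power and $\ell,m$ positive integers with $2\le 2\ell\le m$. Let $\mathcal C$ be a nondegenerate $[2\ell,2]_{q^m/q}$ code having at least three codewords of rank weight $\ell$, no two of which are $\mathbb{F}_{q^m}$-proportional. Then $\mathcal C$ is $L_{\mathrm{rk}}$-optimal if and only if $\mathcal C$ is equivalent to a code with one of the following generator matrices: (1) $\begin{bmatrix}1&\lambda&\cdots&\lambda^{\ell-1}&0&0&\cdots&0\\0&0&\cdots&0&1&\lambda&\cdots&\lambda^{\ell-1}\end{bmatrix}$ for some $\lambda\in\mathbb{F}_{q^m}\setminus\mathbb{F}_q$ with $\ell\le\frac{[\mathbb{F}_q(\lambda):\mathbb{F}_q]+1}{2}$ if $\mathbb{F}_q(\lambda)\ne\mathbb{F}_{q^m}$, and $\ell\le\frac m2$ if $\mathbb{F}_q(\lambda)=\mathbb{F}_{q^m}$; (2) $m$ even, $\ell=2l+1$, $\mathbb{F}_{q^2}=\langle1,\xi\rangle_{\mathbb{F}_q}\subseteq\mathbb{F}_{q^m}$, $\lambda\in\mathbb{F}_{q^m}\setminus\mathbb{F}_{q^2}$ with $l<\frac{[\mathbb{F}_{q^2}(\lambda):\mathbb{F}_{q^2}]}{2}$, and the generator matrix $\begin{bmatrix}\mathbf r&\mathbf 0\\\mathbf 0&\mathbf r\end{bmatrix}$ where $\mathbf r=(1,\xi,\lambda,\xi\lambda,\dots,\lambda^{l-1},\xi\lambda^{l-1},\lambda^l)\in\mathbb{F}_{q^m}^{\ell}$ and $\mathbf 0\in\mathbb{F}_{q^m}^\ell$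 is the zero vector.
   Context: $\mathbb{F}_{q^m}$ is the degree-$m$ extension of $\mathbb{F}_q$. Rank weight of $\mathbf v=(v_1,\dots,v_n)\in\mathbb{F}_{q^m}^n$: $\mathrm{w}(\mathbf v)=\dim_{\mathbb{F}_q}\langle v_1,\dots,v_n\rangle_{\mathbb{F}_q}$. An $[n,k]_{q^m/q}$ code is a $k$-dimensional $\mathbb{F}_{q^m}$-subspace $\mathcal C\subseteq\mathbb{F}_{q^m}^n$; a generator matrix is a $k\times n$ matrix over $\mathbb{F}_{q^m}$ whose rows span $\mathcal C$; nondegenerate means the $\mathbb{F}_q$-span of the columns of a generator matrix has $\mathbb{F}_q$-dimension $n$. Two codes $\mathcal C,\mathcal C'$ are equivalent if $\mathcal C'=\mathcal CA=\{\mathbf vA:\mathbf v\in\mathcal C\}$ for some $A\in\mathrm{GL}(n,q)$. $\mathrm{WS}(\mathcal C)=\{\mathrm{w}(\mathbf c):\mathbf c\in\mathcal C\setminus\{\mathbf 0\}\}$. $L_{\mathrm{rk}}(n,m,k,q)$ is the maximum of $|\mathrm{WS}(\mathcal C)|$ over nondegenerate $[n,k]_{q^m/q}$ codes, and a nondegenerate code is $L_{\mathrm{rk}}$-optimal if $|\mathrm{WS}(\mathcal C)|=L_{\mathrm{rk}}(n,m,k,q)$. -}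

module Defs where

open import Level using (0ℓ)
open import Data.Nat as ℕ using (ℕ; zero; suc; _≤_; _^_; _≡ᵇ_; _%_; _/_)
open import Data.Nat.Primality using (Prime)
open import Data.Fin as Fin using (Fin; toℕ; splitAt)
open import Data.Bool using (Bool; T; if_then_else_)
open import Data.Sum using (_⊎_; inj₁; inj₂)
open import Data.Product using (Σ; ∃; ∃-syntax; _×_; _,_)
open import Relation.Binary.PropositionalEquality using (_≡_; _≢_)
open import Relation.Nullary using (¬_; does)
open import Function using (_∘_)
open import Function.Bundles using (_↔_)
open import Algebra.Structures using (IsCommutativeRing)

IsPrimePower : ℕ → Set
IsPrimePower q = ∃[ p ] ∃[ e ] (Prime p × 1 ≤ e × q ≡ p ^ e)

-- A finite field K with q^m elements together with a subfield F (given by a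
-- Boolean membership predicate) with q elements.  Up to isomorphism this is
-- exactly the extension F_{q^m} / F_q.
record FieldExt (q m : ℕ) : Set₁ where
  infixl 6 _+_
  infixl 7 _*_
  field
    K     : Set
    _+_   : K → K → K
    _*_   : K → K → K
    -_    : K → K
    0# 1# : K
    isCommutativeRing : IsCommutativeRing _≡_ _+_ _*_ -_ 0# 1#
    0≢1   : 0# ≢ 1#
    inverse : ∀ x → x ≢ 0# → ∃[ y ] (x * y ≡ 1#)
    enumK : Fin (q ^ m) ↔ K
    isF   : K → Bool
    F-0   : T (isF 0#)
    F-1   : T (isF 1#)
    F-+   : ∀ x y → T (isF x) → T (isF y) → T (isF (x + y))
    F-*   : ∀ x y → T (isF x) → T (isF y) → T (isF (x * y))
    F--   : ∀ x → T (isF x) → T (isF (- x))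
    F-inv : ∀ x y → T (isF x) → x * y ≡ 1# → T (isF y)
    enumF : Fin q ↔ Σ K (λ x → T (isF x))

module _ {q m : ℕ} (E : FieldExt q m) where
  open FieldExt E

  InF : K → Set
  InF x = T (isF x)

  sumK : ∀ {d} → (Fin d → K) → K
  sumK {zero}  _ = 0#
  sumK {suc d} f = f Fin.zero + sumK (f ∘ Fin.suc)

  pow : K → ℕ → K
  pow x zero    = 1#
  pow x (suc n) = x * pow x n

  linComb : ∀ {d} → (Fin d → K) → (Fin d → K) → K
  linComb a v = sumK (λ i → a i * v i)

  LinIndepOver : (K → Set) → ∀ {d} → (Fin d → K) → Set
  LinIndepOver S {d} v = (a : Fin d → K) → (∀ i → S (a i)) → linComb a v ≡ 0# → ∀ i → a i ≡ 0#

  InSpanOver : (K → Set) → ∀ {d} → (Fin d → K) → K → Set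
  InSpanOver S {d} v x = ∃[ a ] ((∀ i → S (a i)) × linComb a v ≡ x)

  -- rank weight:  RankWeight v d  means  dim_{F_q} <v_1,...,v_n>_{F_q} = d
  -- (there is an F_q-basis b_1..b_d of the F_q-span of the entries of v)
  RankWeight : ∀ {n} → (Fin n → K) → ℕ → Set
  RankWeight v d = ∃[ b ] (LinIndepOver InF {d} b × (∀ i → InSpanOver InF b (v i))
                                                  × (∀ j → InSpanOver InF v (b j)))

  Matrix : ℕ → ℕ → Set
  Matrix k n = Fin k → Fin n → K

  rowComb : ∀ {k n} → (Fin k → K) → Matrix k n → Fin n → K
  rowComb u G j = sumK (λ i → u i * G i j)

  InCode : ∀ {k n} → Matrix k n → (Fin n → K) → Set
  InCode {k} G c = ∃[ u ] (∀ j → c j ≡ rowComb {k} u G j)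

  -- G has K-linearly independent rows (so its row space is an [n,k] code)
  FullRank : ∀ {k n} → Matrix k n → Set
  FullRank {k} G = (u : Fin k → K) → (∀ j → rowComb u G j ≡ 0#) → ∀ i → u i ≡ 0#

  Nondegenerate : ∀ {k n} → Matrix k n → Set
  Nondegenerate {k} {n} G =
    (a : Fin n → K) → (∀ j → InF (a j)) → (∀ i → sumK (λ j → a j * G i j) ≡ 0#) → ∀ j → a j ≡ 0#

  HasWeight : ∀ {k n} → Matrix k n → ℕ → Set
  HasWeight {k} {n} G d = Σ (Fin n → K) λ c → (InCode {k} {n} G c × ¬ (∀ j → c j ≡ 0#) × RankWeight {n} c d)

  AtLeastWeights : ∀ {k n} → Matrix k n → ℕ → Set
  AtLeastWeights G s =
    Σ (Fin s → ℕ) λ w → ((∀ i j → w i ≡ w j → i ≡ j) × (∀ (i : Fin s) → HasWeight G (w i)))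

  -- L_rk-optimal: nondegenerate and |WS(C)| ≥ |WS(C')| for every nondegenerate [n,k] code C'
  LrkOptimal : ∀ {k n} → Matrix k n → Set
  LrkOptimal {k} {n} G = Nondegenerate G ×
    ((G' : Matrix k n) → FullRank G' → Nondegenerate G' →
       ∀ s → AtLeastWeights G' s → AtLeastWeights G s)

  idMat : ∀ {n} → Matrix n n
  idMat i j = if does (i Fin.≟ j) then 1# else 0#

  mulMM : ∀ {a b c} → Matrix a b → Matrix b c → Matrix a c
  mulMM A B i j = sumK (λ t → A i t * B t j)

  mulVM : ∀ {a b} → (Fin a → K) → Matrix a b → Fin b → K
  mulVM v A j = sumK (λ t → v t * A t j)

  InGL : ∀ {n} → Matrix n n → Set
  InGL {n} A = (∀ i j → InF (A i j)) ×
    ∃[ B ] ((∀ i j → InF (B i j)) × (∀ i j → mulMM A B i j ≡ idMat i j)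
                                   × (∀ i j → mulMM B A i j ≡ idMat i j))

  EquivalentTo : ∀ {k n} → Matrix k n → Matrix k n → Set
  EquivalentTo {k} {n} G G' = ∃[ A ] (InGL A ×
    (∀ c → InCode G' c → ∃[ c₀ ] (InCode G c₀ × (∀ j → c j ≡ mulVM c₀ A j))) ×
    (∀ c₀ → InCode G c₀ → InCode G' (mulVM c₀ A)))

  ThreeNonProportional : ∀ {k n} → Matrix k n → ℕ → Set
  ThreeNonProportional {k} {n} G ℓ = Σ (Fin 3 → Fin n → K) λ c → (
    (∀ (i : Fin 3) → InCode {k} {n} G (c i) × RankWeight {n} (c i) ℓ) ×
    (∀ i j → i ≢ j → ¬ (∃[ a ] (∀ t → c i t ≡ a * c j t))))

  powers : K → (d : ℕ) → Fin d → K
  powers λ' d i = pow λ' (toℕ i)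

  DegreeOver : (K → Set) → K → ℕ → Set
  DegreeOver S λ' d = LinIndepOver S (powers λ' d) × ¬ LinIndepOver S (powers λ' (suc d))

  GeneratesWhole : K → Set
  GeneratesWhole λ' = ∀ x → ∃[ j ] InSpanOver InF (powers λ' j) x

  Span1ξ : K → K → Set
  Span1ξ ξ x = ∃[ a ] ∃[ b ] (InF a × InF b × x ≡ a + b * ξ)

  -- ⟨1,ξ⟩_{F_q} is a subfield of F_{q^m} of F_q-dimension 2, i.e. it is F_{q^2}
  IsFq2Basis : K → Set
  IsFq2Basis ξ = ¬ InF ξ ×
    (∀ x y → Span1ξ ξ x → Span1ξ ξ y → Span1ξ ξ (x * y)) ×
    (∀ x y → Span1ξ ξ x → x * y ≡ 1# → Span1ξ ξ y)

  blockDiag : ∀ {ℓ} → (Fin ℓ → K) → Matrix 2 (ℓ ℕ.+ ℓ)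
  blockDiag {ℓ} r Fin.zero j with splitAt ℓ j
  ... | inj₁ a = r a
  ... | inj₂ _ = 0#
  blockDiag {ℓ} r (Fin.suc _) j with splitAt ℓ j
  ... | inj₁ _ = 0#
  ... | inj₂ b = r b

  -- r = (1, ξ, λ, ξλ, ..., λ^{l-1}, ξλ^{l-1}, λ^l): entry i is λ^{⌊i/2⌋} (i even), ξ λ^{⌊i/2⌋} (i odd)
  rvec : K → K → (ℓ : ℕ) → Fin ℓ → K
  rvec ξ λ' ℓ i = if (toℕ i % 2) ≡ᵇ 0 then pow λ' (toℕ i / 2) else ξ * pow λ' (toℕ i / 2)

  Case1 : (ℓ : ℕ) → Matrix 2 (ℓ ℕ.+ ℓ) → Set
  Case1 ℓ G = ∃[ λ' ] (¬ InF λ' × ∃[ d ] (DegreeOver InF λ' d ×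
    (¬ GeneratesWhole λ' → ℓ ℕ.+ ℓ ≤ suc d) ×
    (GeneratesWhole λ' → ℓ ℕ.+ ℓ ≤ m) ×
    EquivalentTo G (blockDiag (powers λ' ℓ))))

  Case2 : (ℓ : ℕ) → Matrix 2 (ℓ ℕ.+ ℓ) → Set
  Case2 ℓ G = ∃[ h ] (m ≡ 2 ℕ.* h) × ∃[ l ] (ℓ ≡ suc (2 ℕ.* l) ×
    ∃[ ξ ] (IsFq2Basis ξ × ∃[ λ' ] (¬ Span1ξ ξ λ' × ∃[ d ] (DegreeOver (Span1ξ ξ) λ' d ×
      2 ℕ.* l ℕ.< d × EquivalentTo G (blockDiag (rvec ξ λ' ℓ))))))

{-# OPTIONS --safe #-}
-- A weight-ℓ codeword and the span A of its entries determine everything: scaling the three given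
-- codewords to p, r, p + r shows that the columns of the generator matrix span A × A over F_q, so the
-- weights are the numbers dim (xA + yA), and they lie between ℓ and 2ℓ.  Two codewords that are not
-- proportional have weights summing to at least 2ℓ, so no code has more than ℓ + 1 weights, and a
-- primitive element λ attains this bound with A = ⟨1, λ, …, λ^(ℓ-1)⟩.  Hence C is optimal if and only
-- if dim (A ∩ sA) takes every value in 0, …, ℓ as s varies.
--
-- The value ℓ - 1, at s = t, forces A = B ⊕ b⟨1, t, …, t^(k-1)⟩ with tB = B.  If B = 0 this is
-- case (1), and the value 1 gives the bound on the degree.  If B ≠ 0, let L = {x : xB ⊆ B}, a field
-- of degree D over F_q.  Comparing A with the L-spaces B and B + bL, the values below D exclude
-- D ≥ 4 and the values ℓ - 2, ℓ - 3 exclude D = 3.  For D = 2 the value ℓ - 2 provides λ such that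
-- B + λB is one L-dimension larger than B and contains b; applying the structure result to B over L
-- (with no λ-stable part, by the first exclusion again) yields case (2).
module Submission where

open import Defs
open import Algebra.Bundles using (CommutativeRing)
import Algebra.Properties.AbelianGroup
import Algebra.Properties.CommutativeMonoid.Sum
import Algebra.Properties.Ring
import Algebra.Properties.Semiring.Mult
import Algebra.Solver.Ring
import Algebra.Solver.Ring.AlmostCommutativeRing as ACR
open import Data.Bool using (true; false; if_then_else_)
open import Data.Bool.Properties using (T?; T-irrelevant)
open import Data.Empty using (⊥; ⊥-elim)
open import Data.Fin as Fin using (Fin; zero; suc; combine; remQuot; toℕ; finToFun; funToFin; _↑ˡ_; _↑ʳ_; splitAt; punchOut; fromℕ<)
open import Data.Fin.Permutation using (permutation)
import Data.Fin.Properties as Finₚ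
open import Data.Integer as ℤ using (ℤ)
import Data.Integer.Properties as ℤₚ
open import Data.List using (List; []; _∷_; tabulate; length; filter)
open import Data.List.Membership.Propositional using () renaming (_∈_ to _∈ˡ_)
open import Data.List.Membership.Propositional.Properties using (∈-tabulate⁺)
open import Data.List.Properties using (length-tabulate)
open import Data.List.Relation.Unary.All as All using (All; []; _∷_)
import Data.List.Relation.Unary.All.Properties as Allₚ
open import Data.List.Relation.Unary.AllPairs using ([]; _∷_)
open import Data.List.Relation.Unary.Any using (here; there)
open import Data.List.Relation.Unary.Unique.Propositional using (Unique)
import Data.List.Relation.Unary.Unique.Propositional.Properties as Uniqueₚ
open import Data.Maybe using (Maybe; just; nothing)
open import Data.Nat as ℕ using (ℕ; zero; suc; _≤_; _<_; _^_; z≤n; s≤s; _≡ᵇ_; _%_; _/_)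
open import Data.Nat.DivMod using (m/n≡1+[m∸n]/n)
open import Data.Nat.Properties as ℕₚ using (≤-trans; ≤-refl; ≤-reflexive; ≤-antisym; ≤-pred; <⇒≱; <⇒≤)
open import Data.Nat.Tactic.RingSolver using (solve-∀)
open import Data.Product using (Σ; ∃; ∃-syntax; _×_; _,_; proj₁; proj₂)
open import Data.Sum using (_⊎_; inj₁; inj₂; [_,_]′)
open import Data.Unit using (⊤; tt)
open import Data.Vec using (Vec; []; _∷_; replicate)
open import Data.Vec.Functional using () renaming (_∷_ to _∷ᶠ_)
open import Function using (_∘_)
open import Function.Bundles using (Inverse; _⇔_; mk⇔)
open import Level using (0ℓ)
open import Relation.Binary.Definitions using (DecidableEquality)
open import Relation.Binary.PropositionalEquality using (_≡_; _≢_; refl; sym; trans; cong; cong₂; subst; module ≡-Reasoning; subst₂)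
open import Relation.Nullary using (¬_; Dec; yes; no; contradiction)
open import Relation.Nullary.Decidable using (map′; _×-dec_; ¬?; decidable-stable; _→-dec_)

-- A codeword with coefficients x, y ≠ 0 has weight 2ℓ - dim (A ∩ sA), where s = y/x, so the weights
-- depend only on how A meets its multiples. The obstacle is that the value ℓ - 1 controls a single
-- multiplier t. It says nothing about the inside of the t-stable part B, which may be any space
-- over L. What limits B is divisibility. For every s, the spaces B ∩ sB and (B + bL) ∩ s(B + bL)
-- are vector spaces over L, so their F-dimensions differ by 0, D or 2D. Each of the three cases
-- confines dim (A ∩ sA) to a short range governed by k = dim A - dim B, where 1 ≤ k < D. If D ≥ 4,
-- some value below D is missed. D = 3 passes this test, for both k = 1 and k = 2, and only values
-- close to ℓ exclude it. D = 2 leaves k = 1 and survives; since B then has even dimension, ℓ is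
-- odd. Divisibility also bounds the degrees: the value 1 can be attained only by a multiplier
-- inside the field generated by t, and this field must then have room for A + sA. Dimensions are
-- obtained by counting elements, which turns inclusions and direct sums into comparisons of finite
-- sets.

-- Arithmetic of intersection dimensions

module ℕ-Lemmas where
  open import Data.Nat using (_+_; _*_)

  swap-+ : ∀ a b c → a + (b + c) ≡ b + (a + c)
  swap-+ = solve-∀

  shift-+ : ∀ a b c → a + c + b ≡ a + (b + c)
  shift-+ = solve-∀

  regroup₁ : ∀ e κ k → e + (κ + κ) + k ≡ e + (k + κ) + κ
  regroup₁ = solve-∀

  regroup₂ : ∀ r k κ → r + (k + k) + κ ≡ r + (k + κ) + k
  regroup₂ = solve-∀

  regroup₃ : ∀ e κ k → e + (κ + κ) + (k + k) ≡ e + (k + κ + (k + κ))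
  regroup₃ = solve-∀

  *-suc-suc : ∀ D i → D * i + (D + D) ≡ D * suc (suc i)
  *-suc-suc = solve-∀

  *-suc′ : ∀ D i → D * i + D ≡ D * suc i
  *-suc′ = solve-∀

  -- The case r = 1 gives 2κ ≤ D + 1. Then r = D - 1 cannot be at most κ, since 2(D - 1) ≤ D + 1
  -- fails for D ≥ 4; so D - 1 = 2κ, and now r = D - 2 fits no alternative. For D = 3 both values of
  -- κ pass, hence the bound 4.
  no-large-stabilizer-arith : ∀ D κ → 4 ≤ D → 1 ≤ κ → κ < D →
    (∀ r → r < D → r ≡ 0 ⊎ (r ≤ κ × κ + κ ≤ r + D) ⊎ r ≡ κ + κ) → ⊥
  no-large-stabilizer-arith (suc (suc (suc (suc D)))) κ (s≤s (s≤s (s≤s (s≤s _)))) 1≤κ κ<D h = top (h (3 + D) ≤-refl)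
    where
    κ+κ≤ : 1 ≡ 0 ⊎ (1 ≤ κ × κ + κ ≤ 5 + D) ⊎ 1 ≡ κ + κ → κ + κ ≤ 5 + D
    κ+κ≤ (inj₂ (inj₁ (_ , le))) = le
    κ+κ≤ (inj₂ (inj₂ eq)) = contradiction (ℕₚ.+-mono-≤ 1≤κ 1≤κ) (<⇒≱ (subst (_< 2) eq ≤-refl))
    next : κ + κ ≡ 3 + D → 2 + D ≡ 0 ⊎ (2 + D ≤ κ × κ + κ ≤ (2 + D) + (4 + D)) ⊎ 2 + D ≡ κ + κ → ⊥
    next eq (inj₂ (inj₁ (le , _))) = <⇒≱ (subst (4 + D ≤_) (shuffle D) (ℕₚ.m≤m+n (4 + D) D))
      (≤-trans (ℕₚ.+-mono-≤ le le) (≤-reflexive eq))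
      where
      shuffle : ∀ D → (4 + D) + D ≡ (2 + D) + (2 + D)
      shuffle = solve-∀
    next eq (inj₂ (inj₂ eq′)) = ℕₚ.1+n≢n (trans (sym eq) (sym eq′))
    top : 3 + D ≡ 0 ⊎ (3 + D ≤ κ × κ + κ ≤ (3 + D) + (4 + D)) ⊎ 3 + D ≡ κ + κ → ⊥
    top (inj₂ (inj₁ (le , _))) = <⇒≱ (subst (6 + D ≤_) (shuffle D) (ℕₚ.m≤m+n (6 + D) D))
      (≤-trans (ℕₚ.+-mono-≤ le le) (κ+κ≤ (h 1 (s≤s (s≤s z≤n)))))
      where
      shuffle : ∀ D → (6 + D) + D ≡ (3 + D) + (3 + D)
      shuffle = solve-∀
    top (inj₂ (inj₂ eq)) = next (sym eq) (h (2 + D) (ℕₚ.n≤1+n _))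

  double-≤⇒< : ∀ l d → (l * 2 + 1) + (l * 2 + 1) ≤ d * 2 + 1 → l * 2 + 1 ≤ d
  double-≤⇒< l d le = ℕₚ.≮⇒≥ λ d< → <⇒≱ (ℕₚ.<-≤-trans (strict d) (ℕₚ.+-mono-≤ d< d<)) le
    where
    strict : ∀ d → d * 2 + 1 < suc d + suc d
    strict d = ≤-reflexive (eq d)
      where
      eq : ∀ d → suc (d * 2 + 1) ≡ suc d + suc d
      eq = solve-∀

  odd≢even : ∀ l x → l * 2 + 1 ≢ 2 * x
  odd≢even zero    zero    ()
  odd≢even zero    (suc x) eq with trans eq (ℕₚ.*-suc 2 x)
  ... | ()
  odd≢even (suc l) zero    ()
  odd≢even (suc l) (suc x) eq = odd≢even l x (ℕₚ.suc-injective (ℕₚ.suc-injective (trans eq (ℕₚ.*-suc 2 x))))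

  -- For spaces `C ⊆ A ⊆ A″` whose ends are M-stable and differ by one M-dimension, the letters
  -- stand for e = dim (C ∩ sC), N = dim (A″ ∩ sA″), r = dim (A ∩ sA), D = dim M and κ = dim A - dim
  -- C, all dimensions over F.
  Trichotomy : (e N r D κ : ℕ) → Set
  Trichotomy e N r D κ = (N ≡ e × r ≡ e) ⊎ (N ≡ e + D × e ≤ r × r ≤ e + κ × e + (κ + κ) ≤ r + D)
                       ⊎ (N ≡ e + (D + D) × r ≡ e + (κ + κ))

  private
    too-small : ∀ {a c} b → c < b → ¬ a + b ≤ a + c
    too-small {a} {c} b c<b le = <⇒≱ c<b (ℕₚ.+-cancelˡ-≤ a b c le)

  -- Here and in the next three lemmas `B` is the dimension of the core, and the implications
  -- between `e` and `B` express, as far as needed, that B - e is a multiple of D. The distance of r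
  -- from B is such that this divisibility leaves a single branch of the trichotomy.
  arith-3-2 : ∀ {e N r B D κ} → D ≡ 3 → κ ≡ 2 → r ≡ B → (e < B → e + D ≤ B) → (e + D < B → e + (D + D) ≤ B) →
              Trichotomy e N r D κ → N ≡ e × e ≡ B
  arith-3-2 refl refl refl g g₂ (inj₁ (N≡e , r≡e)) = N≡e , sym r≡e
  arith-3-2 {e} {r = r} refl refl refl g g₂ (inj₂ (inj₁ (_ , _ , le , le′))) =
    contradiction (≤-trans (g (ℕₚ.+-cancelʳ-≤ 3 _ _ (subst (_≤ r + 3) (e+4 e) le′))) le) (too-small {e} 3 ≤-refl)
    where
    e+4 : ∀ e → e + 4 ≡ suc e + 3
    e+4 = solve-∀
  arith-3-2 {e} refl refl refl g g₂ (inj₂ (inj₂ (_ , refl))) =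
    contradiction (g₂ (ℕₚ.+-monoʳ-< e {3} {4} ≤-refl)) (too-small {e} 6 (s≤s (s≤s (s≤s (s≤s (s≤s z≤n))))))

  arith-3-1 : ∀ {e N r B D κ} → D ≡ 3 → κ ≡ 1 → suc r ≡ B → (e < B → e + D ≤ B) →
              Trichotomy e N r D κ → N ≡ B + D × e < B
  arith-3-1 {e} refl refl refl g (inj₁ (_ , refl)) =
    contradiction (subst (e + 3 ≤_) (ℕₚ.+-comm 1 e) (g ≤-refl)) (too-small {e} 3 (s≤s (s≤s z≤n)))
  arith-3-1 {e} {r = r} refl refl refl g (inj₂ (inj₁ (_ , le , le′ , _))) =
    contradiction (≤-trans (g (s≤s le)) (subst (suc r ≤_) (sym (ℕₚ.+-suc e 1)) (s≤s le′))) (too-small {e} 3 ≤-refl)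
  arith-3-1 {e} refl refl refl g (inj₂ (inj₂ (N≡ , refl))) = trans N≡ (e+6 e) , s≤s (ℕₚ.m≤m+n e 2)
    where
    e+6 : ∀ e → e + 6 ≡ suc (e + 2) + 3
    e+6 = solve-∀

  arith-3-1′ : ∀ {e N r B D κ} → D ≡ 3 → κ ≡ 1 → suc (suc r) ≡ B → (e < B → e + D ≤ B) → (e + D < B → e + (D + D) ≤ B) →
               Trichotomy e N r D κ → N ≡ B
  arith-3-1′ {e} refl refl refl g g₂ (inj₁ (_ , refl)) =
    contradiction (subst (e + 3 ≤_) (ℕₚ.+-comm 2 e) (g (ℕₚ.n≤1+n _))) (too-small {e} 3 ≤-refl)
  arith-3-1′ {e} {r = r} refl refl refl g g₂ (inj₂ (inj₁ (N≡ , le , le′ , _))) =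
    trans N≡ (≤-antisym (g (s≤s (≤-trans le (ℕₚ.n≤1+n _)))) (subst (suc (suc r) ≤_) (e+3 e) (s≤s (s≤s le′))))
    where
    e+3 : ∀ e → suc (suc (e + 1)) ≡ e + 3
    e+3 = solve-∀
  arith-3-1′ {e} refl refl refl g g₂ (inj₂ (inj₂ (_ , refl))) =
    contradiction (subst (e + 6 ≤_) (e+4 e) (g₂ (subst (suc (e + 3) ≤_) (sym (e+4 e)) (≤-reflexive (sym (ℕₚ.+-suc e 3))))))
      (too-small {e} 6 (s≤s (s≤s (s≤s (s≤s (s≤s z≤n))))))
    where
    e+4 : ∀ e → suc (suc (e + 2)) ≡ e + 4
    e+4 = solve-∀

  arith-2-1 : ∀ {e N r B D κ} → D ≡ 2 → κ ≡ 1 → suc r ≡ B → (e < B → e + D ≤ B) → (e + D < B → e + (D + D) ≤ B) →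
              Trichotomy e N r D κ → e + 2 ≡ B × r ≡ suc e
  arith-2-1 {e} refl refl refl g g₂ (inj₁ (_ , refl)) =
    contradiction (subst (e + 2 ≤_) (ℕₚ.+-comm 1 e) (g ≤-refl)) (too-small {e} 2 ≤-refl)
  arith-2-1 {e} {r = r} refl refl refl g g₂ (inj₂ (inj₁ (_ , le , le′ , _))) = eq , ℕₚ.suc-injective (trans (sym eq) (ℕₚ.+-comm e 2))
    where
    eq : e + 2 ≡ suc r
    eq = ≤-antisym (g (s≤s le)) (subst (suc r ≤_) (sym (ℕₚ.+-suc e 1)) (s≤s le′))
  arith-2-1 {e} refl refl refl g g₂ (inj₂ (inj₂ (_ , refl))) =
    contradiction (subst (e + 4 ≤_) (e+3 e) (g₂ (≤-refl))) (too-small {e} 4 ≤-refl)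
    where
    e+3 : ∀ e → suc (e + 2) ≡ e + 3
    e+3 = solve-∀

  between-2-3 : ∀ {D} → 2 ≤ D → ¬ 4 ≤ D → D ≡ 2 ⊎ D ≡ 3
  between-2-3 {2} _ _ = inj₁ refl
  between-2-3 {3} _ _ = inj₂ refl
  between-2-3 {suc (suc (suc (suc D)))} _ ¬4≤ = contradiction (s≤s (s≤s (s≤s (s≤s z≤n)))) ¬4≤
  between-2-3 {1} (s≤s ()) _

  between-1-2 : ∀ {k D} → D ≡ 3 → suc k < D → suc k ≡ 2 ⊎ suc k ≡ 1
  between-1-2 {0} refl _ = inj₂ refl
  between-1-2 {1} refl _ = inj₁ refl
  between-1-2 {suc (suc k)} refl (s≤s (s≤s (s≤s ())))

  only-1 : ∀ {k D} → D ≡ 2 → suc k < D → k ≡ 0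
  only-1 {0} refl _ = refl
  only-1 {suc k} refl (s≤s (s≤s ()))

  pred-of : ∀ {n} → 1 ≤ n → ∃[ r ] suc r ≡ n
  pred-of {suc n} _ = n , refl

  -- Truncated subtraction merges everything up to ℓ, but two numbers that are at most ℓ and have
  -- sum at least 2ℓ are both equal to ℓ.
  collapse : ∀ {a b} ℓ → a ℕ.∸ ℓ ≡ b ℕ.∸ ℓ → ℓ + ℓ ≤ a + b → a ≡ b
  collapse {a} {b} ℓ eq le = go (ℕₚ.≤-total ℓ a) (ℕₚ.≤-total ℓ b)
    where
    small : ∀ {a b} → a ≤ ℓ → b ≤ ℓ → ℓ + ℓ ≤ a + b → a ≡ ℓ
    small {a} {b} a≤ b≤ le = ≤-antisym a≤ (ℕₚ.+-cancelʳ-≤ ℓ _ _ (≤-trans le (ℕₚ.+-monoʳ-≤ a b≤)))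
    both : a ≤ ℓ → b ≤ ℓ → a ≡ b
    both a≤ b≤ = trans (small a≤ b≤ le) (sym (small b≤ a≤ (subst (ℓ + ℓ ≤_) (ℕₚ.+-comm a b) le)))
    go : ℓ ≤ a ⊎ a ≤ ℓ → ℓ ≤ b ⊎ b ≤ ℓ → a ≡ b
    go (inj₁ ℓ≤a) (inj₁ ℓ≤b) = ℕₚ.∸-cancelʳ-≡ ℓ≤a ℓ≤b eq
    go (inj₂ a≤ℓ) (inj₂ b≤ℓ) = both a≤ℓ b≤ℓ
    go (inj₁ ℓ≤a) (inj₂ b≤ℓ) = both (ℕₚ.m∸n≡0⇒m≤n (trans eq (ℕₚ.m≤n⇒m∸n≡0 b≤ℓ))) b≤ℓ
    go (inj₂ a≤ℓ) (inj₁ ℓ≤b) = both a≤ℓ (ℕₚ.m∸n≡0⇒m≤n (trans (sym eq) (ℕₚ.m≤n⇒m∸n≡0 a≤ℓ)))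

  halve : ∀ j l → j ≤ suc (l * 2) → ∃[ i ] (i ≤ l × (j ≡ i * 2 ⊎ j ≡ suc (i * 2)))
  halve 0 l _ = 0 , z≤n , inj₁ refl
  halve 1 l _ = 0 , z≤n , inj₂ refl
  halve (suc (suc j)) zero (s≤s ())
  halve (suc (suc j)) (suc l) (s≤s (s≤s le)) = step (halve j l le)
    where
    step : ∃[ i ] (i ≤ l × (j ≡ i * 2 ⊎ j ≡ suc (i * 2))) → _
    step (i , i≤ , inj₁ refl) = suc i , s≤s i≤ , inj₁ refl
    step (i , i≤ , inj₂ refl) = suc i , s≤s i≤ , inj₂ refl

  1≤half : ∀ ℓ → 2 ≤ ℓ + ℓ → 1 ≤ ℓ
  1≤half (suc ℓ) _ = s≤s z≤n

  double : ∀ l → l + l ≡ l * 2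
  double l = trans (cong (l +_) (sym (ℕₚ.+-identityʳ l))) (ℕₚ.*-comm 2 l)

  odd-sum : ∀ l i → suc (l + i) * 2 ≡ suc (l * 2) + suc (i * 2)
  odd-sum l i = cong suc (trans (cong suc (ℕₚ.*-distribʳ-+ 2 l i)) (sym (ℕₚ.+-suc (l * 2) (i * 2))))

open ℕ-Lemmas

-- Finite sets

injective⇒surjective : ∀ {n} (f : Fin n → Fin n) → (∀ {i j} → f i ≡ f j → i ≡ j) → ∀ y → ∃[ x ] f x ≡ y
injective⇒surjective {suc n} f inj y with Finₚ.any? (λ x → f x Fin.≟ y)
... | yes p   = p
... | no none = contradiction (Finₚ.injective⇒≤ {f = λ x → punchOut (miss x)}
    (λ eq → inj (Finₚ.punchOut-injective (miss _) (miss _) eq))) ℕₚ.1+n≰n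
  where
  miss : ∀ x → y ≢ f x
  miss x eq = none (x , sym eq)

funToFin-cong : ∀ {m n} {f g : Fin m → Fin n} → (∀ i → f i ≡ g i) → funToFin f ≡ funToFin g
funToFin-cong {zero}  eq = refl
funToFin-cong {suc m} eq = cong₂ combine (eq zero) (funToFin-cong (eq ∘ suc))

finToFun-injective : ∀ {m n} {k k′ : Fin (n ^ m)} → (∀ i → finToFun {n} {m} k i ≡ finToFun k′ i) → k ≡ k′
finToFun-injective {m} {n} {k} {k′} eq = trans (sym (Finₚ.funToFin-finToFin {m} {n} k))
  (trans (funToFin-cong {m} {n} eq) (Finₚ.funToFin-finToFin {m} {n} k′))

-- Field operations and decidability

module _ {q m : ℕ} (E : FieldExt q m) where

  open FieldExt E

  commutativeRing : CommutativeRing 0ℓ 0ℓ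
  commutativeRing = record { isCommutativeRing = isCommutativeRing }

  open CommutativeRing commutativeRing using
    ( ring; semiring; +-abelianGroup; *-commutativeMonoid
    ; +-assoc; +-comm; +-identityˡ; +-identityʳ; -‿inverseʳ
    ; *-assoc; *-comm; *-identityˡ; *-identityʳ; distribˡ; distribʳ; zeroˡ; zeroʳ)
  open Algebra.Properties.Ring ring using (-0#≈0#; -‿involutive; -‿distribˡ-*; -‿distribʳ-*)

  infixl 6 _-_
  _-_ : K → K → K
  x - y = x + - y

  -- The ring solver with integer coefficients, so that it performs cancellations.
  module ℤ-Solver where
    open import Data.Integer using (+_; -[1+_])
    open Algebra.Properties.Semiring.Mult semiring using (×-homo-+; ×1-homo-*) renaming (_×_ to _·_)
    open Algebra.Properties.AbelianGroup +-abelianGroup using (⁻¹-∙-comm)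
    open ≡-Reasoning

    fromℤ : ℤ → K
    fromℤ (+ n)    = n · 1#
    fromℤ -[1+ n ] = - (suc n · 1#)

    fromℤ-neg : ∀ i → fromℤ (ℤ.- i) ≡ - fromℤ i
    fromℤ-neg (+ zero)  = sym -0#≈0#
    fromℤ-neg (+ suc n) = refl
    fromℤ-neg -[1+ n ]  = sym (-‿involutive _)

    cancel-1 : ∀ a b → (1# + a) - (1# + b) ≡ a - b
    cancel-1 a b = begin
      (1# + a) + - (1# + b)  ≡⟨ cong (_+_ _) (sym (⁻¹-∙-comm _ _)) ⟩
      (1# + a) + (- 1# + - b)  ≡⟨ cong (_+ (- 1# + - b)) (+-comm _ _) ⟩
      (a + 1#) + (- 1# + - b)  ≡⟨ +-assoc _ _ _ ⟩
      a + (1# + (- 1# + - b))  ≡⟨ cong (_+_ a) (sym (+-assoc _ _ _)) ⟩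
      a + ((1# - 1#) + - b)  ≡⟨ cong (λ z → a + (z + - b)) (-‿inverseʳ _) ⟩
      a + (0# + - b)  ≡⟨ cong (_+_ a) (+-identityˡ _) ⟩
      a - b  ∎

    fromℤ-⊖ : ∀ i j → fromℤ (i ℤ.⊖ j) ≡ i · 1# - j · 1#
    fromℤ-⊖ zero    zero    = sym (-‿inverseʳ _)
    fromℤ-⊖ zero    (suc j) = sym (+-identityˡ _)
    fromℤ-⊖ (suc i) zero    = sym (trans (cong (_+_ _) -0#≈0#) (+-identityʳ _))
    fromℤ-⊖ (suc i) (suc j) = begin
      fromℤ (suc i ℤ.⊖ suc j)  ≡⟨ cong fromℤ (ℤₚ.[1+m]⊖[1+n]≡m⊖n i j) ⟩
      fromℤ (i ℤ.⊖ j)  ≡⟨ fromℤ-⊖ i j ⟩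
      i · 1# - j · 1#  ≡⟨ sym (cancel-1 _ _) ⟩
      suc i · 1# - suc j · 1#  ∎

    fromℤ-+ : ∀ i j → fromℤ (i ℤ.+ j) ≡ fromℤ i + fromℤ j
    fromℤ-+ (+ i)    (+ j)    = ×-homo-+ 1# i j
    fromℤ-+ (+ i)    -[1+ j ] = fromℤ-⊖ i (suc j)
    fromℤ-+ -[1+ i ] (+ j)    = trans (fromℤ-⊖ j (suc i)) (+-comm _ _)
    fromℤ-+ -[1+ i ] -[1+ j ] = begin
      - (suc (suc (i ℕ.+ j)) · 1#)  ≡⟨ cong (λ k → - (k · 1#)) (sym (ℕₚ.+-suc (suc i) j)) ⟩
      - ((suc i ℕ.+ suc j) · 1#)  ≡⟨ cong -_ (×-homo-+ 1# (suc i) (suc j)) ⟩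
      - (suc i · 1# + suc j · 1#)  ≡⟨ sym (⁻¹-∙-comm _ _) ⟩
      - (suc i · 1#) + - (suc j · 1#)  ∎

    fromℤ-pos* : ∀ i j → fromℤ ((+ i) ℤ.* j) ≡ i · 1# * fromℤ j
    fromℤ-pos* i (+ j)    = trans (cong fromℤ (sym (ℤₚ.pos-* i j))) (×1-homo-* i j)
    fromℤ-pos* i -[1+ j ] = begin
      fromℤ ((+ i) ℤ.* -[1+ j ])  ≡⟨ cong fromℤ (sym (ℤₚ.neg-distribʳ-* (+ i) (+ suc j))) ⟩
      fromℤ (ℤ.- ((+ i) ℤ.* (+ suc j))) ≡⟨ fromℤ-neg ((+ i) ℤ.* (+ suc j)) ⟩
      - fromℤ ((+ i) ℤ.* (+ suc j))  ≡⟨ cong -_ (fromℤ-pos* i (+ suc j)) ⟩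
      - (i · 1# * (suc j · 1#))  ≡⟨ -‿distribʳ-* _ _ ⟩
      i · 1# * (- (suc j · 1#))  ∎

    fromℤ-* : ∀ i j → fromℤ (i ℤ.* j) ≡ fromℤ i * fromℤ j
    fromℤ-* (+ i)    j = fromℤ-pos* i j
    fromℤ-* -[1+ i ] j = begin
      fromℤ (-[1+ i ] ℤ.* j)  ≡⟨ cong fromℤ (sym (ℤₚ.neg-distribˡ-* (+ suc i) j)) ⟩
      fromℤ (ℤ.- ((+ suc i) ℤ.* j))  ≡⟨ fromℤ-neg ((+ suc i) ℤ.* j) ⟩
      - fromℤ ((+ suc i) ℤ.* j)  ≡⟨ cong -_ (fromℤ-pos* (suc i) j) ⟩
      - (suc i · 1# * fromℤ j)  ≡⟨ -‿distribˡ-* _ _ ⟩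
      - (suc i · 1#) * fromℤ j  ∎

    coeff≟ : ∀ i j → Maybe (fromℤ i ≡ fromℤ j)
    coeff≟ i j with i ℤ.≟ j
    ... | yes i≡j = just (cong fromℤ i≡j)
    ... | no  _   = nothing

    fromℤ-homomorphism : ℤ.+-*-rawRing ACR.-Raw-AlmostCommutative⟶ ACR.fromCommutativeRing commutativeRing
    fromℤ-homomorphism = record
      { ⟦_⟧ = fromℤ ; +-homo = fromℤ-+ ; *-homo = fromℤ-* ; -‿homo = fromℤ-neg
      ; 0-homo = refl ; 1-homo = +-identityʳ 1# }

    open Algebra.Solver.Ring ℤ.+-*-rawRing (ACR.fromCommutativeRing commutativeRing) fromℤ-homomorphism coeff≟
      public using (solve; _:+_; _:*_; _:-_; :-_; _:=_)

  open ℤ-Solver using (solve; _:+_; _:*_; _:-_; :-_; _:=_)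

  _≟K_ : DecidableEquality K
  x ≟K y = map′ (λ eq → trans (sym (strictlyInverseˡ x)) (trans (cong to eq) (strictlyInverseˡ y)))
                (cong from) (from x Fin.≟ from y)
    where open Inverse enumK

  any? : {P : K → Set} → (∀ x → Dec (P x)) → Dec (∃ P)
  any? {P} P? = map′ (λ (i , p) → to i , p) (λ (x , p) → from x , subst P (sym (strictlyInverseˡ x)) p)
                     (Finₚ.any? (λ i → P? (to i)))
    where open Inverse enumK

  all? : {P : K → Set} → (∀ x → Dec (P x)) → Dec (∀ x → P x)
  all? {P} P? = map′ (λ p x → subst P (strictlyInverseˡ x) (p (from x))) (λ p i → p (to i))
                     (Finₚ.all? (λ i → P? (to i)))
    where open Inverse enumK

  -- Junk value: inv 0# = 0#.
  inv : K → K
  inv x with x ≟K 0#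
  ... | yes _   = 0#
  ... | no  x≢0 = proj₁ (inverse x x≢0)

  *-inv : ∀ {x} → x ≢ 0# → x * inv x ≡ 1#
  *-inv {x} x≢0 with x ≟K 0#
  ... | yes x≡0  = contradiction x≡0 x≢0
  ... | no  x≢0′ = proj₂ (inverse x x≢0′)

  inv-* : ∀ {x} → x ≢ 0# → inv x * x ≡ 1#
  inv-* x≢0 = trans (*-comm _ _) (*-inv x≢0)

  inv-*-* : ∀ {x} → x ≢ 0# → ∀ y → inv x * (x * y) ≡ y
  inv-*-* {x} x≢0 y = trans (sym (*-assoc _ _ _)) (trans (cong (_* y) (inv-* x≢0)) (*-identityˡ y))

  *-inv-* : ∀ {x} → x ≢ 0# → ∀ y → x * (inv x * y) ≡ y
  *-inv-* {x} x≢0 y = trans (sym (*-assoc _ _ _)) (trans (cong (_* y) (*-inv x≢0)) (*-identityˡ y))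

  unit≢0 : ∀ {x y} → x * y ≡ 1# → x ≢ 0#
  unit≢0 {y = y} xy≡1 refl = 0≢1 (trans (sym (zeroˡ y)) xy≡1)

  inv≢0 : ∀ {x} → x ≢ 0# → inv x ≢ 0#
  inv≢0 x≢0 = unit≢0 (inv-* x≢0)

  *-cancelˡ : ∀ {x y z} → x ≢ 0# → x * y ≡ x * z → y ≡ z
  *-cancelˡ {x} {y} {z} x≢0 eq = trans (sym (inv-*-* x≢0 y)) (trans (cong (inv x *_) eq) (inv-*-* x≢0 z))

  integral : ∀ {x y} → x * y ≡ 0# → x ≢ 0# → y ≡ 0#
  integral {x} eq x≢0 = *-cancelˡ x≢0 (trans eq (sym (zeroʳ x)))

  *≢0 : ∀ {x y} → x ≢ 0# → y ≢ 0# → x * y ≢ 0#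
  *≢0 x≢0 y≢0 eq = y≢0 (integral eq x≢0)

  x-y≡0⇒x≡y : ∀ {x y} → x - y ≡ 0# → x ≡ y
  x-y≡0⇒x≡y {x} {y} eq = begin
    x  ≡⟨ solve 2 (λ x y → x := x :- y :+ y) refl x y ⟩
    x - y + y  ≡⟨ cong (_+ y) eq ⟩
    0# + y  ≡⟨ +-identityˡ y ⟩
    y  ∎
    where open ≡-Reasoning

  infix 4 _∈_ _⊆_

  -- Membership is decidable by definition. As K is finite, exhaustive search preserves this under
  -- sums, multiples and stabilizers, so case distinctions on membership stay constructive.
  record Subspace : Set₁ where
    field
      mem  : K → Set
      mem? : ∀ x → Dec (mem x)
      has0 : mem 0#
      has+ : ∀ {x y} → mem x → mem y → mem (x + y)
      has* : ∀ {f x} → InF E f → mem x → mem (f * x)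

    has- : ∀ {x} → mem x → mem (- x)
    has- {x} p = subst mem (trans (sym (-‿distribˡ-* 1# x)) (cong -_ (*-identityˡ x))) (has* (F-- _ F-1) p)

    has∸ : ∀ {x y} → mem x → mem y → mem (x - y)
    has∸ p p′ = has+ p (has- p′)

  open Subspace

  _∈_ : K → Subspace → Set
  x ∈ V = mem V x

  _⊆_ : Subspace → Subspace → Set
  V ⊆ W = ∀ {x} → x ∈ V → x ∈ W

  ∈-resp : ∀ V {x y} → x ≡ y → x ∈ V → y ∈ V
  ∈-resp V = subst (mem V)

  zeroₛ : Subspace
  zeroₛ = record
    { mem = _≡ 0# ; mem? = _≟K 0# ; has0 = refl
    ; has+ = λ { refl refl → +-identityˡ 0# } ; has* = λ { _ refl → zeroʳ _ } }

  whole : Subspace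
  whole = record { mem = λ _ → ⊤ ; mem? = λ _ → yes tt ; has0 = tt ; has+ = λ _ _ → tt ; has* = λ _ _ → tt }

  infixl 7 _∩_
  infixl 6 _⊞_
  infixr 8 _·_

  _∩_ : Subspace → Subspace → Subspace
  V ∩ W = record
    { mem = λ x → x ∈ V × x ∈ W ; mem? = λ x → mem? V x ×-dec mem? W x
    ; has0 = has0 V , has0 W
    ; has+ = λ (a , b) (c , d) → has+ V a c , has+ W b d
    ; has* = λ f (a , b) → has* V f a , has* W f b }

  _⊞_ : Subspace → Subspace → Subspace
  V ⊞ W = record
    { mem = λ x → ∃[ v ] ∃[ w ] (v ∈ V × w ∈ W × x ≡ v + w)
    ; mem? = λ x → any? λ v → any? λ w → mem? V v ×-dec mem? W w ×-dec (x ≟K (v + w))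
    ; has0 = 0# , 0# , has0 V , has0 W , sym (+-identityˡ 0#)
    ; has+ = λ { (v , w , p , r , refl) (v′ , w′ , p′ , r′ , refl) →
        v + v′ , w + w′ , has+ V p p′ , has+ W r r′ ,
        solve 4 (λ v w v′ w′ → v :+ w :+ (v′ :+ w′) := v :+ v′ :+ (w :+ w′)) refl v w v′ w′ }
    ; has* = λ { {f} if (v , w , p , r , refl) → f * v , f * w , has* V if p , has* W if r , distribˡ f v w } }

  _·_ : K → Subspace → Subspace
  t · V = record
    { mem = λ x → ∃[ v ] (v ∈ V × x ≡ t * v)
    ; mem? = λ x → any? λ v → mem? V v ×-dec (x ≟K (t * v))
    ; has0 = 0# , has0 V , sym (zeroʳ t)
    ; has+ = λ { (v , p , refl) (v′ , p′ , refl) → v + v′ , has+ V p p′ , sym (distribˡ t v v′) }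
    ; has* = λ { {f} if (v , p , refl) → f * v , has* V if p ,
        solve 3 (λ f t v → f :* (t :* v) := t :* (f :* v)) refl f t v } }

  ⊞-injˡ : ∀ V W → V ⊆ V ⊞ W
  ⊞-injˡ V W p = _ , 0# , p , has0 W , sym (+-identityʳ _)

  ⊞-injʳ : ∀ V W → W ⊆ V ⊞ W
  ⊞-injʳ V W p = 0# , _ , has0 V , p , sym (+-identityˡ _)

  ⊞-lub : ∀ {U V W} → U ⊆ W → V ⊆ W → U ⊞ V ⊆ W
  ⊞-lub {W = W} p p′ (_ , _ , u , v , refl) = has+ W (p u) (p′ v)

  ·-mono : ∀ {t V W} → V ⊆ W → t · V ⊆ t · W
  ·-mono p (v , v∈ , eq) = v , p v∈ , eq

  nonzero-member? : ∀ V → Dec (∃[ x ] (x ∈ V × x ≢ 0#))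
  nonzero-member? V = any? λ x → mem? V x ×-dec ¬? (x ≟K 0#)

  ⊆? : ∀ V W → (V ⊆ W) ⊎ (∃[ x ] (x ∈ V × ¬ x ∈ W))
  ⊆? V W with any? (λ x → mem? V x ×-dec ¬? (mem? W x))
  ... | yes p = inj₂ p
  ... | no ¬p = inj₁ λ {x} x∈V → decidable-stable (mem? W x) (λ x∉W → ¬p (x , x∈V , x∉W))

  record Subfield : Set₁ where
    field
      sub  : Subspace
      has1 : 1# ∈ sub
      mul  : ∀ {x y} → x ∈ sub → y ∈ sub → x * y ∈ sub
      invs : ∀ {x y} → x ∈ sub → x * y ≡ 1# → y ∈ sub

    F⊆ : ∀ {x} → InF E x → x ∈ sub
    F⊆ {x} p = ∈-resp sub (*-identityʳ x) (has* sub p has1)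

    inv∈ : ∀ {x} → x ∈ sub → inv x ∈ sub
    inv∈ {x} p with x ≟K 0#
    ... | yes _   = has0 sub
    ... | no  x≢0 = invs p (proj₂ (inverse x x≢0))

  open Subfield

  base : Subfield
  base = record
    { sub = record { mem = InF E ; mem? = λ x → T? (isF x) ; has0 = F-0 ; has+ = F-+ _ _ ; has* = F-* _ _ }
    ; has1 = F-1 ; mul = F-* _ _ ; invs = F-inv _ _ }

  Stable : Subfield → Subspace → Set
  Stable S V = ∀ {f x} → f ∈ sub S → x ∈ V → f * x ∈ V

  base-stable : ∀ V → Stable base V
  base-stable V = has* V

  ∩-stable : ∀ {S V W} → Stable S V → Stable S W → Stable S (V ∩ W)
  ∩-stable p r f (v , w) = p f v , r f w

  ⊞-stable : ∀ {S V W} → Stable S V → Stable S W → Stable S (V ⊞ W)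
  ⊞-stable p r {f} if (v , w , v∈ , w∈ , refl) = f * v , f * w , p if v∈ , r if w∈ , distribˡ f v w

  ·-stable : ∀ {S t V} → Stable S V → Stable S (t · V)
  ·-stable {t = t} p {f} if (v , v∈ , refl) = f * v , p if v∈ ,
    solve 3 (λ f t v → f :* (t :* v) := t :* (f :* v)) refl f t v

  self-stable : ∀ S → Stable S (sub S)
  self-stable S = mul S

  zero-stable : ∀ S → Stable S zeroₛ
  zero-stable S _ refl = zeroʳ _

  whole-stable : ∀ S → Stable S whole
  whole-stable S _ _ = tt

  -- Counting and dimension

  Disjoint : Subspace → Subspace → Set
  Disjoint V W = ∀ {x} → x ∈ V → x ∈ W → x ≡ 0#

  line-disjoint : ∀ {S V x} → Stable S V → ¬ x ∈ V → Disjoint V (x · sub S)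
  line-disjoint {S} {V} {x} st x∉ v∈ (f , f∈ , refl) with f ≟K 0#
  ... | yes refl = zeroʳ x
  ... | no  f≢0  = contradiction (∈-resp V (trans (cong (inv f *_) (*-comm x f)) (inv-*-* f≢0 x)) (st (inv∈ S f∈) v∈)) x∉

  -- Counting replaces bases: a space of dimension d has q^d elements, so monotonicity and
  -- additivity of the dimension need no exchange argument.
  record Card (V : Subspace) (N : ℕ) : Set where
    field
      elem     : Fin N → K
      elem-inj : ∀ {i j} → elem i ≡ elem j → i ≡ j
      elem∈    : ∀ i → elem i ∈ V
      index    : ∀ {x} → x ∈ V → ∃[ i ] elem i ≡ x

  open Card

  card-mono : ∀ {V W N M} → V ⊆ W → Card V N → Card W M → N ≤ M
  card-mono {V} {W} V⊆W v w = Finₚ.injective⇒≤ {f = f} λ {i} {j} eq → elem-inj v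
      (trans (sym (proj₂ (ix i))) (trans (cong (elem w) eq) (proj₂ (ix j))))
    where
    ix : ∀ i → ∃[ j ] elem w j ≡ elem v i
    ix i = index w (V⊆W (elem∈ v i))
    f : _
    f i = proj₁ (ix i)

  card-resp : ∀ {V W N} → V ⊆ W → W ⊆ V → Card V N → Card W N
  card-resp V⊆W W⊆V v = record
    { elem = elem v ; elem-inj = elem-inj v ; elem∈ = V⊆W ∘ elem∈ v ; index = index v ∘ W⊆V }

  card-⊞ : ∀ {V W N M} → Disjoint V W → Card V N → Card W M → Card (V ⊞ W) (N ℕ.* M)
  card-⊞ {V} {W} {N} {M} disj v w = record
    { elem = e ; elem-inj = inj
    ; elem∈ = λ i → _ , _ , elem∈ v _ , elem∈ w _ , refl
    ; index = λ { (x , y , x∈ , y∈ , refl) → ix (index v x∈) (index w y∈) } }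
    where
    e : Fin (N ℕ.* M) → K
    e i = elem v (proj₁ (remQuot M i)) + elem w (proj₂ (remQuot {N} M i))
    split : ∀ {a b c d} → a ∈ V → c ∈ V → b ∈ W → d ∈ W → a + b ≡ c + d → a ≡ c × b ≡ d
    split {a} {b} {c} {d} a∈ c∈ b∈ d∈ eq = x-y≡0⇒x≡y a-c≡0 , sym (x-y≡0⇒x≡y (trans (sym diff) a-c≡0))
      where
      diff : a - c ≡ d - b
      diff = begin
        a - c  ≡⟨ solve 3 (λ a b c → a :- c := a :+ b :- (c :+ b)) refl a b c ⟩
        a + b - (c + b)  ≡⟨ cong (_- (c + b)) eq ⟩
        c + d - (c + b)  ≡⟨ solve 3 (λ b c d → c :+ d :- (c :+ b) := d :- b) refl b c d ⟩
        d - b  ∎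
        where open ≡-Reasoning
      a-c≡0 : a - c ≡ 0#
      a-c≡0 = disj (has∸ V a∈ c∈) (∈-resp W (sym diff) (has∸ W d∈ b∈))
    inj : ∀ {i j} → e i ≡ e j → i ≡ j
    inj {i} {j} eq with split (elem∈ v _) (elem∈ v _) (elem∈ w _) (elem∈ w _) eq
    ... | p , r = trans (sym (Finₚ.combine-remQuot {N} M i))
                  (trans (cong₂ combine (elem-inj v p) (elem-inj w r)) (Finₚ.combine-remQuot {N} M j))
    ix : ∀ {x y} → ∃[ i ] elem v i ≡ x → ∃[ j ] elem w j ≡ y → ∃[ k ] e k ≡ x + y
    ix (i , refl) (j , refl) = combine i j ,
      cong (λ p → elem v (proj₁ p) + elem w (proj₂ p)) (Finₚ.remQuot-combine i j)

  card-· : ∀ {V N t} → t ≢ 0# → Card V N → Card (t · V) N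
  card-· {t = t} t≢0 v = record
    { elem = λ i → t * elem v i ; elem-inj = elem-inj v ∘ *-cancelˡ t≢0
    ; elem∈ = λ i → _ , elem∈ v i , refl
    ; index = λ { (x , x∈ , refl) → proj₁ (index v x∈) , cong (t *_) (proj₂ (index v x∈)) } }

  card-zero : Card zeroₛ 1
  card-zero = record
    { elem = λ _ → 0# ; elem-inj = λ { {zero} {zero} _ → refl } ; elem∈ = λ _ → refl ; index = λ { refl → zero , refl } }

  card-whole : Card whole (q ^ m)
  card-whole = record
    { elem = to
    ; elem-inj = λ {i} {j} eq → trans (sym (strictlyInverseʳ i)) (trans (cong from eq) (strictlyInverseʳ j))
    ; elem∈ = λ _ → tt ; index = λ {x} _ → from x , strictlyInverseˡ x }
    where open Inverse enumK

  card-base : Card (sub base) q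
  card-base = record
    { elem = proj₁ ∘ to
    ; elem-inj = λ {i} {j} eq → trans (sym (strictlyInverseʳ i)) (trans (cong from (Σ-≡ eq)) (strictlyInverseʳ j))
    ; elem∈ = proj₂ ∘ to ; index = λ {x} p → from (x , p) , cong proj₁ (strictlyInverseˡ (x , p)) }
    where
    open Inverse enumF
    Σ-≡ : {a b : Σ K (InF E)} → proj₁ a ≡ proj₁ b → a ≡ b
    Σ-≡ {a , p} {.a , p′} refl = cong (a ,_) (T-irrelevant p p′)

  1<q : 1 < q
  1<q = Finₚ.injective⇒≤ {f = f} inj
    where
    open Card card-base renaming (index to ix)
    i₀ i₁ : Fin q
    i₀ = proj₁ (ix F-0)
    i₁ = proj₁ (ix F-1)
    f : Fin 2 → Fin q
    f zero    = i₀
    f (suc _) = i₁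
    i₀≢i₁ : i₀ ≢ i₁
    i₀≢i₁ eq = 0≢1 (trans (sym (proj₂ (ix F-0))) (trans (cong (Card.elem card-base) eq) (proj₂ (ix F-1))))
    inj : ∀ {i j} → f i ≡ f j → i ≡ j
    inj {zero}     {zero}     _  = refl
    inj {suc zero} {suc zero} _  = refl
    inj {zero}     {suc zero} eq = contradiction eq i₀≢i₁
    inj {suc zero} {zero}     eq = contradiction (sym eq) i₀≢i₁

  instance
    q-nonZero : ℕ.NonZero q
    q-nonZero = ℕ.>-nonZero (ℕₚ.<-trans (s≤s z≤n) 1<q)

  ^-cancel-≤ : ∀ {a b} → q ^ a ≤ q ^ b → a ≤ b
  ^-cancel-≤ {a} {b} le with a ℕ.≤? b
  ... | yes p = p
  ... | no ¬p = contradiction le (<⇒≱ (ℕₚ.^-monoʳ-< q 1<q (ℕₚ.≰⇒> ¬p)))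

  record Complement (S : Subfield) (V W : Subspace) (s : ℕ) : Set₁ where
    field
      comp     : Subspace
      rank     : ℕ
      stable   : Stable S comp
      comp⊆    : comp ⊆ W
      disjoint : Disjoint V comp
      cover    : W ⊆ V ⊞ comp
      card     : Card comp (s ^ rank)

  allK : List K
  allK = tabulate (Inverse.to enumK)

  ∈-allK : ∀ x → x ∈ˡ allK
  ∈-allK x = subst (_∈ˡ allK) (Inverse.strictlyInverseˡ enumK x) (∈-tabulate⁺ (Inverse.from enumK x))

  -- Greedy construction along the list of all elements of K: each x in W outside V + C contributes
  -- its S-line to C. The last invariant of `go` says that every element of W is still on the list
  -- or already covered.
  complement : ∀ S {V W s} → Card (sub S) s → Stable S V → Stable S W → V ⊆ W → Complement S V W s
  complement S {V} {W} {s} cS stV stW V⊆W =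
    go allK zeroₛ 0 (zero-stable S) (λ { refl → has0 W }) (λ _ x≡0 → x≡0) card-zero (λ {x} _ → inj₁ (∈-allK x))
    where
    go : ∀ xs C n → Stable S C → C ⊆ W → Disjoint V C → Card C (s ^ n) →
         (∀ {x} → x ∈ W → x ∈ˡ xs ⊎ x ∈ V ⊞ C) → Complement S V W s
    go [] C n stC C⊆W disj cC cov = record
      { comp = C ; rank = n ; stable = λ {f} {x} → stC {f} {x} ; comp⊆ = C⊆W ; disjoint = disj
      ; cover = λ x∈ → [ (λ ()) , (λ p → p) ]′ (cov x∈) ; card = cC }
    go (x ∷ xs) C n stC C⊆W disj cC cov with mem? W x | mem? (V ⊞ C) x
    ... | no x∉W | _ = go xs C n stC C⊆W disj cC cov′
      where
      cov′ : ∀ {y} → y ∈ W → y ∈ˡ xs ⊎ y ∈ V ⊞ C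
      cov′ y∈ with cov y∈
      ... | inj₁ (here refl) = contradiction y∈ x∉W
      ... | inj₁ (there p)   = inj₁ p
      ... | inj₂ p           = inj₂ p
    ... | yes _ | yes x∈VC = go xs C n stC C⊆W disj cC cov′
      where
      cov′ : ∀ {y} → y ∈ W → y ∈ˡ xs ⊎ y ∈ V ⊞ C
      cov′ y∈ with cov y∈
      ... | inj₁ (here refl) = inj₂ x∈VC
      ... | inj₁ (there p)   = inj₁ p
      ... | inj₂ p           = inj₂ p
    ... | yes x∈W | no x∉VC = go xs C′ (suc n) stC′ C′⊆W disj′ cC′ cov′
      where
      C′ : Subspace
      C′ = C ⊞ x · sub S
      stL : Stable S (x · sub S)
      stL = ·-stable {S} {x} {sub S} (self-stable S)
      stC′ : Stable S C′
      stC′ = ⊞-stable {S} {C} {x · sub S} stC stL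
      x∉C : ¬ x ∈ C
      x∉C p = x∉VC (⊞-injʳ V C p)
      x≢0 : x ≢ 0#
      x≢0 refl = x∉C (has0 C)
      C′⊆W : C′ ⊆ W
      C′⊆W = ⊞-lub {C} {x · sub S} {W} C⊆W (λ { (f , f∈ , refl) → ∈-resp W (*-comm f x) (stW f∈ x∈W) })
      cC′ : Card C′ (s ^ suc n)
      cC′ = subst (Card C′) (ℕₚ.*-comm (s ^ n) s) (card-⊞ (line-disjoint {S} {C} stC x∉C) cC (card-· x≢0 cS))
      disj′ : Disjoint V C′
      disj′ {y} y∈V (c , l , c∈ , l∈ , refl) with
        line-disjoint {S} {V ⊞ C} {x} (⊞-stable {S} {V} {C} stV stC) x∉VC
          {l} (c + l , - c , y∈V , has- C c∈ , solve 2 (λ c l → l := c :+ l :+ :- c) refl c l) l∈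
      ... | refl = trans (+-identityʳ c) (disj (∈-resp V (+-identityʳ c) y∈V) c∈)
      cov′ : ∀ {y} → y ∈ W → y ∈ˡ xs ⊎ y ∈ V ⊞ C′
      cov′ y∈ with cov y∈
      ... | inj₁ (here refl) = inj₂ (⊞-injʳ V C′ (⊞-injʳ C (x · sub S) (1# , has1 S , sym (*-identityʳ x))))
      ... | inj₁ (there p)   = inj₁ p
      ... | inj₂ (v , c , v∈ , c∈ , refl) = inj₂ (v , c , v∈ , ⊞-injˡ C (x · sub S) c∈ , refl)

  private
    complement-zero : ∀ V → Complement base zeroₛ V q
    complement-zero V = complement base card-base (zero-stable base) (base-stable V) (λ { refl → has0 V })

    card-from-zero : ∀ {S V s} (c : Complement S zeroₛ V s) → Card V (s ^ Complement.rank c)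
    card-from-zero {V = V} c = card-resp comp⊆ (λ x∈ → lemma (cover x∈)) card
      where
      open Complement c
      lemma : ∀ {x} → x ∈ zeroₛ ⊞ comp → x ∈ comp
      lemma (_ , w , refl , w∈ , refl) = ∈-resp comp (sym (+-identityˡ w)) w∈

  abstract
    -- The rank of a complement of the zero space; the number q^dim of elements makes it independent
    -- of the choices in that complement.
    dim : Subspace → ℕ
    dim V = Complement.rank (complement-zero V)

    card-dim : ∀ V → Card V (q ^ dim V)
    card-dim V = card-from-zero (complement-zero V)

  dim-mono : ∀ {V W} → V ⊆ W → dim V ≤ dim W
  dim-mono {V} {W} p = ^-cancel-≤ (card-mono p (card-dim V) (card-dim W))

  dim-unique : ∀ {V n} → Card V (q ^ n) → dim V ≡ n
  dim-unique {V} c = ≤-antisym (^-cancel-≤ (card-mono (λ x → x) (card-dim V) c))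
                                  (^-cancel-≤ (card-mono (λ x → x) c (card-dim V)))

  dim-resp : ∀ {V W} → V ⊆ W → W ⊆ V → dim V ≡ dim W
  dim-resp {V} {W} p r = ≤-antisym (dim-mono {V} {W} p) (dim-mono {W} {V} r)

  dim-direct : ∀ {V W} → Disjoint V W → dim (V ⊞ W) ≡ dim V ℕ.+ dim W
  dim-direct {V} {W} disj = dim-unique {V ⊞ W} (subst (Card (V ⊞ W)) (sym (ℕₚ.^-distribˡ-+-* q (dim V) (dim W)))
    (card-⊞ disj (card-dim V) (card-dim W)))

  dim-· : ∀ {t} V → t ≢ 0# → dim (t · V) ≡ dim V
  dim-· {t} V t≢0 = dim-unique {t · V} (card-· t≢0 (card-dim V))

  dim-zero : dim zeroₛ ≡ 0
  dim-zero = dim-unique {zeroₛ} card-zero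

  dim-whole : dim whole ≡ m
  dim-whole = dim-unique {whole} card-whole

  dim-base : dim (sub base) ≡ 1
  dim-base = dim-unique {sub base} (subst (Card (sub base)) (sym (ℕₚ.*-identityʳ q)) card-base)

  -- A complement of V ∩ W in W is at the same time a complement of V in V + W.
  dim-mod : ∀ V W → dim (V ∩ W) ℕ.+ dim (V ⊞ W) ≡ dim V ℕ.+ dim W
  dim-mod V W = begin
      dim (V ∩ W) ℕ.+ dim (V ⊞ W)  ≡⟨ cong (dim (V ∩ W) ℕ.+_) (trans (dim-resp {V ⊞ W} {V ⊞ comp} to′ from′) (dim-direct disj)) ⟩
      dim (V ∩ W) ℕ.+ (dim V ℕ.+ dim comp)  ≡⟨ sym (ℕₚ.+-assoc (dim (V ∩ W)) (dim V) (dim comp)) ⟩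
      dim (V ∩ W) ℕ.+ dim V ℕ.+ dim comp  ≡⟨ cong (ℕ._+ dim comp) (ℕₚ.+-comm (dim (V ∩ W)) (dim V)) ⟩
      dim V ℕ.+ dim (V ∩ W) ℕ.+ dim comp  ≡⟨ ℕₚ.+-assoc (dim V) (dim (V ∩ W)) (dim comp) ⟩
      dim V ℕ.+ (dim (V ∩ W) ℕ.+ dim comp)  ≡⟨ cong (dim V ℕ.+_) (sym (trans (dim-resp {W} {V ∩ W ⊞ comp} cover back) (dim-direct disjoint))) ⟩
      dim V ℕ.+ dim W  ∎
    where
    open ≡-Reasoning
    open Complement (complement base {V ∩ W} {W} card-base (base-stable (V ∩ W)) (base-stable W) proj₂)
    disj : Disjoint V comp
    disj x∈V x∈C = disjoint (x∈V , comp⊆ x∈C) x∈C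
    back : V ∩ W ⊞ comp ⊆ W
    back = ⊞-lub {V ∩ W} {comp} {W} proj₂ comp⊆
    to′ : V ⊞ W ⊆ V ⊞ comp
    to′ (v , w , v∈ , w∈ , refl) with cover w∈
    ... | u , c , (u∈ , _) , c∈ , refl = v + u , c , has+ V v∈ u∈ , c∈ , sym (+-assoc v u c)
    from′ : V ⊞ comp ⊆ V ⊞ W
    from′ (v , c , v∈ , c∈ , refl) = v , c , v∈ , comp⊆ c∈ , refl

  -- Complementing the zero space over S instead of F exhibits the size of V as a power of the size
  -- of S. All divisibility arguments rest on this.
  dim-stable : ∀ S V → Stable S V → ∃[ j ] dim V ≡ dim (sub S) ℕ.* j
  dim-stable S V st = rank , dim-unique {V} (subst (Card V) (ℕₚ.^-*-assoc q (dim (sub S)) rank) (card-from-zero c))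
    where
    c : Complement S zeroₛ V (q ^ dim (sub S))
    c = complement S {zeroₛ} {V} (card-dim (sub S)) (zero-stable S) st (λ { refl → has0 V })
    open Complement c

  dim-equal : ∀ {V W} → V ⊆ W → dim W ≤ dim V → W ⊆ V
  dim-equal {V} {W} V⊆W le {x} x∈W with mem? V x
  ... | yes p = p
  ... | no ¬p = contradiction (≤-trans (dim-mono {V ⊞ x · sub base} {W} sum⊆) le) (<⇒≱ bigger)
    where
    x≢0 : x ≢ 0#
    x≢0 refl = ¬p (has0 V)
    sum⊆ : V ⊞ x · sub base ⊆ W
    sum⊆ = ⊞-lub {V} {x · sub base} {W} V⊆W (λ { (f , f∈ , refl) → ∈-resp W (*-comm f x) (has* W f∈ x∈W) })
    bigger : dim V < dim (V ⊞ x · sub base)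
    bigger = subst (dim V <_) (sym (trans (dim-direct (line-disjoint {base} {V} (base-stable V) ¬p))
      (cong (dim V ℕ.+_) (trans (dim-· (sub base) x≢0) dim-base)))) (ℕₚ.m<m+n (dim V) (s≤s z≤n))

  -- The largest field over which V is a vector space; for the zero space it is all of K.
  Stab : Subspace → Subfield
  Stab V = record
    { sub = record
      { mem = λ x → ∀ v → v ∈ V → x * v ∈ V
      ; mem? = λ x → all? λ v → mem? V v →-dec mem? V (x * v)
      ; has0 = λ v _ → ∈-resp V (sym (zeroˡ v)) (has0 V)
      ; has+ = λ {x} {y} p r v v∈ → ∈-resp V (sym (distribʳ v x y)) (has+ V (p v v∈) (r v v∈))
      ; has* = λ {f} {x} if p v v∈ → ∈-resp V (sym (*-assoc f x v)) (has* V if (p v v∈)) }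
    ; has1 = λ v → ∈-resp V (sym (*-identityˡ v))
    ; mul = λ {x} {y} p r v v∈ → ∈-resp V (sym (*-assoc x y v)) (p (y * v) (r v v∈))
    ; invs = λ {x} {y} p xy≡1 v v∈ → inverse-stable p xy≡1 v∈ }
    where
    inverse-stable : ∀ {x y} → (∀ v → v ∈ V → x * v ∈ V) → x * y ≡ 1# → ∀ {v} → v ∈ V → y * v ∈ V
    -- `x · V ⊆ V` with equal dimensions, so multiplication by x is onto V and its inverse preserves
    -- V as well.
    inverse-stable {x} {y} p xy≡1 {v} v∈ with
      dim-equal {x · V} {V} (λ { (w , w∈ , refl) → p w w∈ }) (≤-reflexive (sym (dim-· V (unit≢0 xy≡1)))) v∈
    ... | w , w∈ , refl = ∈-resp V (trans (sym (*-identityˡ w)) (trans (cong (_* w) (trans (sym xy≡1) (*-comm x y))) (*-assoc y x w))) w∈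

  Stab-stable : ∀ V → Stable (Stab V) V
  Stab-stable V p = p _

  -- Finite sums and linear combinations

  sumK-cong : ∀ {d} {f g : Fin d → K} → (∀ i → f i ≡ g i) → sumK E f ≡ sumK E g
  sumK-cong {zero}  eq = refl
  sumK-cong {suc d} eq = cong₂ _+_ (eq zero) (sumK-cong (eq ∘ suc))

  sumK-0 : ∀ {d} {f : Fin d → K} → (∀ i → f i ≡ 0#) → sumK E f ≡ 0#
  sumK-0 {zero}  eq = refl
  sumK-0 {suc d} eq = trans (cong₂ _+_ (eq zero) (sumK-0 (eq ∘ suc))) (+-identityˡ 0#)

  sumK-+ : ∀ {d} (f g : Fin d → K) → sumK E (λ i → f i + g i) ≡ sumK E f + sumK E g
  sumK-+ {zero}  f g = sym (+-identityˡ 0#)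
  sumK-+ {suc d} f g = trans (cong (_+_ _) (sumK-+ (f ∘ suc) (g ∘ suc)))
    (solve 4 (λ a b c d → a :+ b :+ (c :+ d) := a :+ c :+ (b :+ d)) refl (f zero) (g zero) _ _)

  sumK-* : ∀ {d} c (f : Fin d → K) → sumK E (λ i → c * f i) ≡ c * sumK E f
  sumK-* {zero}  c f = sym (zeroʳ c)
  sumK-* {suc d} c f = trans (cong (_+_ _) (sumK-* c (f ∘ suc))) (sym (distribˡ c _ _))

  sumK-swap : ∀ {d e} (f : Fin d → Fin e → K) →
              sumK E (λ i → sumK E (f i)) ≡ sumK E (λ j → sumK E (λ i → f i j))
  sumK-swap {zero} {e} f = sym (sumK-0 {e} (λ _ → refl))
  sumK-swap {suc d} f = trans (cong (_+_ _) (sumK-swap (f ∘ suc))) (sym (sumK-+ (f zero) _))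

  sumK∈ : ∀ V {d} {f : Fin d → K} → (∀ i → f i ∈ V) → sumK E f ∈ V
  sumK∈ V {zero}  p = has0 V
  sumK∈ V {suc d} p = has+ V (p zero) (sumK∈ V (p ∘ suc))

  linComb-+ : ∀ {d} (a b v : Fin d → K) → linComb E (λ i → a i + b i) v ≡ linComb E a v + linComb E b v
  linComb-+ {d} a b v = trans (sumK-cong (λ i → distribʳ (v i) (a i) (b i))) (sumK-+ {d} (λ i → a i * v i) (λ i → b i * v i))

  linComb-* : ∀ {d} c (a v : Fin d → K) → linComb E (λ i → c * a i) v ≡ c * linComb E a v
  linComb-* {d} c a v = trans (sumK-cong (λ i → *-assoc c (a i) (v i))) (sumK-* {d} c (λ i → a i * v i))

  linComb-*ʳ : ∀ {d} c (a v : Fin d → K) → linComb E a (λ i → c * v i) ≡ c * linComb E a v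
  linComb-*ʳ {d} c a v = trans (sumK-cong (λ i → solve 3 (λ a c v → a :* (c :* v) := c :* (a :* v)) refl (a i) c (v i))) (sumK-* {d} c (λ i → a i * v i))

  linComb-+ʳ : ∀ {d} (a v w : Fin d → K) → linComb E a (λ i → v i + w i) ≡ linComb E a v + linComb E a w
  linComb-+ʳ {d} a v w = trans (sumK-cong (λ i → distribˡ (a i) (v i) (w i))) (sumK-+ {d} (λ i → a i * v i) (λ i → a i * w i))

  -- Spans over a subfield

  module _ (S : Subfield) where
    private
      In : K → Set
      In = mem (sub S)
      Span : ∀ {d} → (Fin d → K) → K → Set
      Span = InSpanOver E In

    Span-∷⁺ : ∀ {d} (v : Fin (suc d) → K) {f y} → In f → Span (v ∘ suc) y → Span v (f * v zero + y)
    Span-∷⁺ v {f} f∈ (a , a∈ , refl) = f ∷ᶠ a , (λ { zero → f∈ ; (suc i) → a∈ i }) , refl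

    Span-∷⁻ : ∀ {d} (v : Fin (suc d) → K) {x} → Span v x → ∃[ f ] ∃[ y ] (In f × Span (v ∘ suc) y × x ≡ f * v zero + y)
    Span-∷⁻ v (a , a∈ , refl) = a zero , _ , a∈ zero , (a ∘ suc , a∈ ∘ suc , refl) , refl

    Span? : ∀ {d} (v : Fin d → K) x → Dec (Span v x)
    Span? {zero}  v x = map′ (λ { refl → (λ ()) , (λ ()) , refl }) (λ { (_ , _ , refl) → refl }) (x ≟K 0#)
    Span? {suc d} v x = map′ (λ { (f , f∈ , p) → subst (Span v) (solve 2 (λ a x → a :+ (x :- a) := x) refl (f * v zero) x) (Span-∷⁺ v f∈ p) })
      (λ p → let f , y , f∈ , y∈ , eq = Span-∷⁻ v p in
        f , f∈ , subst (Span (v ∘ suc)) (trans (solve 2 (λ a y → y := a :+ y :- a) refl (f * v zero) y) (cong (_- (f * v zero)) (sym eq))) y∈)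
      (any? λ f → mem? (sub S) f ×-dec Span? (v ∘ suc) (x - f * v zero))

    span : ∀ {d} → (Fin d → K) → Subspace
    span v = record
      { mem = Span v ; mem? = Span? v
      ; has0 = (λ _ → 0#) , (λ _ → has0 (sub S)) , sumK-0 (λ i → zeroˡ (v i))
      ; has+ = λ { (a , a∈ , refl) (b , b∈ , refl) → (λ i → a i + b i) , (λ i → has+ (sub S) (a∈ i) (b∈ i)) , linComb-+ a b v }
      ; has* = λ { {f} f∈ (a , a∈ , refl) → (λ i → f * a i) , (λ i → has* (sub S) f∈ (a∈ i)) , linComb-* f a v } }

    span-stable : ∀ {d} (v : Fin d → K) → Stable S (span v)
    span-stable v {f} f∈ (a , a∈ , refl) = (λ i → f * a i) , (λ i → mul S f∈ (a∈ i)) , linComb-* f a v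

    span-gen : ∀ {d} (v : Fin d → K) i → v i ∈ span v
    span-gen v zero    = subst (Span v) (trans (cong₂ _+_ (*-identityˡ (v zero)) refl) (+-identityʳ (v zero))) (Span-∷⁺ v (has1 S) (has0 (span (v ∘ suc))))
    span-gen v (suc i) = subst (Span v) (trans (cong₂ _+_ (zeroˡ (v zero)) refl) (+-identityˡ _)) (Span-∷⁺ v (has0 (sub S)) (span-gen (v ∘ suc) i))

    span-least : ∀ {d} (v : Fin d → K) W → Stable S W → (∀ i → v i ∈ W) → span v ⊆ W
    span-least v W st p (a , a∈ , refl) = sumK∈ W (λ i → st (a∈ i) (p i))

    span-· : ∀ {d} t (v : Fin d → K) → span (λ i → t * v i) ⊆ t · span v
    span-· t v (a , a∈ , refl) = linComb E a v , (a , a∈ , refl) , linComb-*ʳ t a v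

    span-·⁻ : ∀ {d} t (v : Fin d → K) → t · span v ⊆ span (λ i → t * v i)
    span-·⁻ t v (_ , (a , a∈ , refl) , refl) = a , a∈ , linComb-*ʳ t a v

    span-cong : ∀ {d} {v w : Fin d → K} → (∀ i → v i ≡ w i) → span v ⊆ span w
    span-cong eq (a , a∈ , refl) = a , a∈ , sumK-cong (λ i → cong (a i *_) (sym (eq i)))

    Indep : ∀ {d} → (Fin d → K) → Set
    Indep = LinIndepOver E In

    indep-tail : ∀ {d} (v : Fin (suc d) → K) → Indep v → Indep (v ∘ suc)
    indep-tail v p a a∈ z i = p (0# ∷ᶠ a) (λ { zero → has0 (sub S) ; (suc i) → a∈ i })
      (trans (cong₂ _+_ (zeroˡ (v zero)) z) (+-identityˡ 0#)) (suc i)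

    indep-head : ∀ {d} (v : Fin (suc d) → K) → Indep v → ¬ v zero ∈ span (v ∘ suc)
    indep-head v p (a , a∈ , eq) = contradiction (p ((- 1#) ∷ᶠ a) (λ { zero → has- (sub S) (has1 S) ; (suc i) → a∈ i }) z zero) -1≢0
      where
      z : - 1# * v zero + linComb E a (v ∘ suc) ≡ 0#
      z = trans (cong (_+_ _) eq) (trans (cong (_+_ (- 1# * v zero)) (sym (*-identityˡ (v zero))))
        (solve 2 (λ o x → (:- o) :* x :+ o :* x := (o :- o) :* x) refl 1# (v zero) ∙ trans (cong (_* v zero) (-‿inverseʳ 1#)) (zeroˡ _)))
        where _∙_ = trans
      -1≢0 : - 1# ≢ 0#
      -1≢0 eq′ = 0≢1 (trans (sym (-‿inverseʳ 1#)) (trans (cong (1# +_) eq′) (+-identityʳ 1#)))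

    indep-∷ : ∀ {d} (v : Fin (suc d) → K) → Indep (v ∘ suc) → ¬ v zero ∈ span (v ∘ suc) → Indep v
    indep-∷ v p v₀∉ a a∈ z = λ { zero → a₀≡0 ; (suc i) → p (a ∘ suc) (a∈ ∘ suc) rest i }
      where
      a₀≡0 : a zero ≡ 0#
      a₀≡0 with a zero ≟K 0#
      ... | yes eq = eq
      ... | no a₀≢0 = contradiction (subst (Span (v ∘ suc)) eq (span-stable (v ∘ suc) (has- (sub S) (inv∈ S (a∈ zero))) (a ∘ suc , a∈ ∘ suc , refl))) v₀∉
        where
        y : K
        y = linComb E (a ∘ suc) (v ∘ suc)
        eq : - inv (a zero) * y ≡ v zero
        eq = begin
          - inv (a zero) * y  ≡⟨ solve 4 (λ i a x y → (:- i) :* y := i :* (a :* x) :- i :* (a :* x :+ y)) refl (inv (a zero)) (a zero) (v zero) y ⟩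
          inv (a zero) * (a zero * v zero) - inv (a zero) * (a zero * v zero + y)  ≡⟨ cong₂ _-_ (inv-*-* a₀≢0 (v zero)) (trans (cong (inv (a zero) *_) z) (zeroʳ _)) ⟩
          v zero - 0#  ≡⟨ trans (cong (v zero +_) -0≡0) (+-identityʳ _) ⟩
          v zero ∎
          where
          open ≡-Reasoning
          -0≡0 : - 0# ≡ 0#
          -0≡0 = trans (sym (+-identityˡ _)) (-‿inverseʳ 0#)
      rest : linComb E (a ∘ suc) (v ∘ suc) ≡ 0#
      rest = trans (sym (trans (cong (_+ linComb E (a ∘ suc) (v ∘ suc)) (trans (cong (_* v zero) a₀≡0) (zeroˡ _))) (+-identityˡ _))) z

    indep? : ∀ {d} (v : Fin d → K) → Dec (Indep v)
    indep? {zero}  v = yes λ _ _ _ ()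
    indep? {suc d} v with indep? (v ∘ suc) | Span? (v ∘ suc) (v zero)
    ... | no ¬p | _     = no (¬p ∘ indep-tail v)
    ... | yes p | yes s = no λ p′ → indep-head v p′ s
    ... | yes p | no ¬s = yes (indep-∷ v p ¬s)

    indep-· : ∀ {d} {t} (v : Fin d → K) → t ≢ 0# → Indep v → Indep (λ i → t * v i)
    indep-· {t = t} v t≢0 p a a∈ z = p a a∈ (integral (trans (sym (linComb-*ʳ t a v)) z) t≢0)

    indep-·⁻ : ∀ {d} t (v : Fin d → K) → Indep (λ i → t * v i) → Indep v
    indep-·⁻ t v p a a∈ z = p a a∈ (trans (linComb-*ʳ t a v) (trans (cong (t *_) z) (zeroʳ t)))

    span-∷⊆ : ∀ {d} (v : Fin (suc d) → K) → span v ⊆ span (v ∘ suc) ⊞ v zero · sub S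
    span-∷⊆ v p with Span-∷⁻ v p
    ... | f , y , f∈ , y∈ , refl = y , v zero * f , y∈ , (f , f∈ , refl) ,
      solve 3 (λ f x y → f :* x :+ y := y :+ x :* f) refl f (v zero) y

    span-∷⊇ : ∀ {d} (v : Fin (suc d) → K) → span (v ∘ suc) ⊞ v zero · sub S ⊆ span v
    span-∷⊇ v (y , _ , y∈ , (f , f∈ , refl) , refl) = subst (Span v)
      (solve 3 (λ f x y → f :* x :+ y := y :+ x :* f) refl f (v zero) y) (Span-∷⁺ v f∈ y∈)

    span-tail⊆ : ∀ {d} (v : Fin (suc d) → K) → span (v ∘ suc) ⊆ span v
    span-tail⊆ v p = span-∷⊇ v (⊞-injˡ (span (v ∘ suc)) (v zero · sub S) p)

    dim-span-fresh : ∀ {d} (v : Fin (suc d) → K) → ¬ v zero ∈ span (v ∘ suc) →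
                     dim (span v) ≡ dim (sub S) ℕ.+ dim (span (v ∘ suc))
    dim-span-fresh v v₀∉ = begin
      dim (span v)  ≡⟨ dim-resp {span v} {span (v ∘ suc) ⊞ v zero · sub S} (span-∷⊆ v) (span-∷⊇ v) ⟩
      dim (span (v ∘ suc) ⊞ v zero · sub S)  ≡⟨ dim-direct (line-disjoint {S} {span (v ∘ suc)} (span-stable (v ∘ suc)) v₀∉) ⟩
      dim (span (v ∘ suc)) ℕ.+ dim (v zero · sub S)  ≡⟨ cong (dim (span (v ∘ suc)) ℕ.+_) (dim-· (sub S) v₀≢0) ⟩
      dim (span (v ∘ suc)) ℕ.+ dim (sub S)  ≡⟨ ℕₚ.+-comm (dim (span (v ∘ suc))) (dim (sub S)) ⟩
      dim (sub S) ℕ.+ dim (span (v ∘ suc))  ∎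
      where
      open ≡-Reasoning
      v₀≢0 : v zero ≢ 0#
      v₀≢0 eq = v₀∉ (∈-resp (span (v ∘ suc)) (sym eq) (has0 (span (v ∘ suc))))

    dim-indep : ∀ {d} (v : Fin d → K) → Indep v → dim (span v) ≡ d ℕ.* dim (sub S)
    dim-indep {zero}  v p = trans (dim-resp {span v} {zeroₛ} (λ { (_ , _ , refl) → refl }) (λ { refl → has0 (span v) })) dim-zero
    dim-indep {suc d} v p = trans (dim-span-fresh v (indep-head v p))
      (cong (dim (sub S) ℕ.+_) (dim-indep (v ∘ suc) (indep-tail v p)))

    dim-span≤ : ∀ {d} (v : Fin d → K) → dim (span v) ≤ d ℕ.* dim (sub S)
    span-redundant : ∀ {d} (v : Fin (suc d) → K) → v zero ∈ span (v ∘ suc) → span v ⊆ span (v ∘ suc)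

    span-redundant v v₀∈ p with Span-∷⁻ v p
    ... | f , y , f∈ , y∈ , refl = has+ (span (v ∘ suc)) (span-stable (v ∘ suc) f∈ v₀∈) y∈

    dim-span≤ {zero}  v = ≤-reflexive (dim-indep v (λ _ _ _ ()))
    dim-span≤ {suc d} v with Span? (v ∘ suc) (v zero)
    ... | yes v₀∈ = ≤-trans (dim-mono {span v} {span (v ∘ suc)} (span-redundant v v₀∈))
                    (≤-trans (dim-span≤ (v ∘ suc)) (ℕₚ.m≤n+m _ (dim (sub S))))
    ... | no v₀∉ = ≤-trans (≤-reflexive (dim-span-fresh v v₀∉)) (ℕₚ.+-monoʳ-≤ (dim (sub S)) (dim-span≤ (v ∘ suc)))

    dim-sub>0 : 0 < dim (sub S)
    dim-sub>0 = subst (_≤ dim (sub S)) dim-base (dim-mono {sub base} {sub S} (F⊆ S))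

    -- Each vector raises the dimension by at most `dim (sub S)`, so the maximal dimension leaves no
    -- room for a redundant vector.
    indep-dim : ∀ {d} (v : Fin d → K) → d ℕ.* dim (sub S) ≤ dim (span v) → Indep v
    indep-dim {zero}  v _ = λ _ _ _ ()
    indep-dim {suc d} v le with Span? (v ∘ suc) (v zero)
    ... | yes v₀∈ = contradiction (≤-trans le (≤-trans (dim-mono {span v} {span (v ∘ suc)} (span-redundant v v₀∈)) (dim-span≤ (v ∘ suc))))
                    (<⇒≱ (ℕₚ.m<n+m (d ℕ.* dim (sub S)) dim-sub>0))
    ... | no v₀∉ = indep-∷ v (indep-dim (v ∘ suc) (ℕₚ.+-cancelˡ-≤ (dim (sub S)) _ _ (≤-trans le (≤-reflexive (dim-span-fresh v v₀∉))))) v₀∉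

    -- The space of polynomials in t of degree below k with coefficients in S.

    poly : K → ℕ → Subspace
    poly t k = span (powers E t k)

    poly-suc⁻ : ∀ t k {x} → x ∈ poly t (suc k) → ∃[ f ] ∃[ y ] (In f × y ∈ poly t k × x ≡ f + t * y)
    poly-suc⁻ t k p with Span-∷⁻ (powers E t (suc k)) p
    ... | f , y , f∈ , y∈ , refl with span-· t (powers E t k) y∈
    ... | z , z∈ , refl = f , z , f∈ , z∈ , cong (_+ t * z) (*-identityʳ f)

    poly-suc⁺ : ∀ t k {f y} → In f → y ∈ poly t k → f + t * y ∈ poly t (suc k)
    poly-suc⁺ t k {f} {y} f∈ y∈ = subst (Span (powers E t (suc k))) (cong (_+ t * y) (*-identityʳ f))
      (Span-∷⁺ (powers E t (suc k)) f∈ (span-·⁻ t (powers E t k) (y , y∈ , refl)))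

    poly-0 : ∀ t {x} → x ∈ poly t 0 → x ≡ 0#
    poly-0 t (_ , _ , refl) = refl

    poly-⊆suc : ∀ t k → poly t k ⊆ poly t (suc k)
    poly-⊆suc t zero    p = ∈-resp (poly t 1) (sym (poly-0 t p)) (has0 (poly t 1))
    poly-⊆suc t (suc k) p with poly-suc⁻ t k p
    ... | f , y , f∈ , y∈ , refl = poly-suc⁺ t (suc k) f∈ (poly-⊆suc t k y∈)

    poly-≤ : ∀ t {k d} → k ≤ d → poly t k ⊆ poly t d
    poly-≤ t {k} {d} k≤d p with ℕₚ.m≤n⇒m<n∨m≡n k≤d
    ... | inj₂ refl = p
    poly-≤ t {k} {suc d} k≤d p | inj₁ (s≤s k≤d′) = poly-⊆suc t d (poly-≤ t k≤d′ p)

    poly-t· : ∀ t k {y} → y ∈ poly t k → t * y ∈ poly t (suc k)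
    poly-t· t k p = ∈-resp (poly t (suc k)) (+-identityˡ _) (poly-suc⁺ t k (has0 (sub S)) p)

    poly-const : ∀ t k {f} → In f → f ∈ poly t (suc k)
    poly-const t k {f} f∈ = ∈-resp (poly t (suc k)) (trans (cong (f +_) (zeroʳ t)) (+-identityʳ f)) (poly-suc⁺ t k f∈ (has0 (poly t k)))

    poly-1 : ∀ t {x} → x ∈ poly t 1 → In x
    poly-1 t p with poly-suc⁻ t 0 p
    ... | f , y , f∈ , y∈ , refl with poly-0 t y∈
    ... | refl = ∈-resp (sub S) (sym (trans (cong (f +_) (zeroʳ t)) (+-identityʳ f))) f∈

    poly-last⁻ : ∀ t k {x} → x ∈ poly t (suc k) → ∃[ y ] ∃[ f ] (y ∈ poly t k × In f × x ≡ y + f * pow E t k)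
    poly-last⁻ t zero    {x} p = 0# , x , has0 (poly t 0) , poly-1 t p , sym (trans (+-identityˡ _) (*-identityʳ x))
    poly-last⁻ t (suc k) p with poly-suc⁻ t (suc k) p
    ... | g , z , g∈ , z∈ , refl with poly-last⁻ t k z∈
    ... | y , f , y∈ , f∈ , refl = g + t * y , f , poly-suc⁺ t k g∈ y∈ , f∈ ,
      solve 5 (λ g t y f p → g :+ t :* (y :+ f :* p) := g :+ t :* y :+ f :* (t :* p)) refl g t y f (pow E t k)

    pow∈poly : ∀ t k → pow E t k ∈ poly t (suc k)
    pow∈poly t zero    = poly-const t 0 (has1 S)
    pow∈poly t (suc k) = poly-t· t (suc k) (pow∈poly t k)

    poly⊆ : ∀ t k W → Stable S W → (∀ {x} → x ∈ W → t * x ∈ W) → 1# ∈ W → poly t k ⊆ W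
    poly⊆ t zero    W st tW 1∈ p = ∈-resp W (sym (poly-0 t p)) (has0 W)
    poly⊆ t (suc k) W st tW 1∈ p with poly-suc⁻ t k p
    ... | f , y , f∈ , y∈ , refl = has+ W (∈-resp W (*-identityʳ f) (st f∈ 1∈)) (tW (poly⊆ t k W st tW 1∈ y∈))

    indep-powers-≤ : ∀ t {k d} → k ≤ d → Indep (powers E t d) → Indep (powers E t k)
    indep-powers-≤ t {k} {d} k≤d p with ℕₚ.m≤n⇒m<n∨m≡n k≤d
    ... | inj₂ refl = p
    indep-powers-≤ t {k} {suc d} k≤d p | inj₁ (s≤s k≤d′) =
      indep-powers-≤ t k≤d′ (indep-·⁻ t (powers E t d) (indep-tail (powers E t (suc d)) p))

    degree : ∀ t → ∃[ d ] DegreeOver E In t d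
    degree t = go (suc m) 0 (λ _ _ _ ()) (≤-reflexive (sym (ℕₚ.+-identityʳ (suc m))))
      where
      -- Independent powers span a subspace of K, so there are at most m of them; the invariant
      -- makes d exceed m once the fuel is spent.
      go : ∀ fuel d → Indep (powers E t d) → suc m ≤ fuel ℕ.+ d → ∃[ d ] DegreeOver E In t d
      go zero d p le = contradiction (≤-trans le d≤m) ℕₚ.1+n≰n
        where
        d≤m : d ≤ m
        d≤m = begin
          d  ≡⟨ sym (ℕₚ.*-identityʳ d) ⟩
          d ℕ.* 1  ≤⟨ ℕₚ.*-monoʳ-≤ d dim-sub>0 ⟩
          d ℕ.* dim (sub S)  ≡⟨ sym (dim-indep _ p) ⟩
          dim (poly t d)  ≤⟨ dim-mono {poly t d} {whole} (λ _ → tt) ⟩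
          dim whole  ≡⟨ dim-whole ⟩
          m  ∎
          where open ℕₚ.≤-Reasoning
      go (suc fuel) d p le with indep? (powers E t (suc d))
      ... | yes p′ = go fuel (suc d) p′ (≤-trans le (≤-reflexive (sym (ℕₚ.+-suc fuel d))))
      ... | no ¬p′ = d , p , ¬p′

    -- The dependence enters at the power 1, because t, ..., t^d are still independent. Hence 1 lies
    -- in `t · poly t d`, and the inverse y of t lies in `poly t d`. It preserves this space, as y
    -- (f + t z) = f y + z, and stabilizers are closed under inverses.
    degree-stable : ∀ {t d} → t ≢ 0# → DegreeOver E In t d → t ∈ sub (Stab (poly t d))
    degree-stable {t} {d} t≢0 (p , ¬p) = invs (Stab (poly t d)) inv-stab (trans (*-comm _ _) ty≡1)
      where
      1∈t· : 1# ∈ t · poly t d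
      1∈t· = span-· t (powers E t d) (decidable-stable (Span? (powers E t (suc d) ∘ suc) 1#)
        (λ 1∉ → ¬p (indep-∷ (powers E t (suc d)) (indep-· (powers E t d) t≢0 p) 1∉)))
      y : K
      y = proj₁ 1∈t·
      y∈ : y ∈ poly t d
      y∈ = proj₁ (proj₂ 1∈t·)
      ty≡1 : t * y ≡ 1#
      ty≡1 = sym (proj₂ (proj₂ 1∈t·))
      step : ∀ k → k ≤ d → ∀ x → x ∈ poly t k → y * x ∈ poly t d
      step zero    _  x p = ∈-resp (poly t d) (sym (trans (cong (y *_) (poly-0 t p)) (zeroʳ y))) (has0 (poly t d))
      step (suc k) le x p with poly-suc⁻ t k p
      ... | f , z , f∈ , z∈ , refl = ∈-resp (poly t d) eq (has+ (poly t d) (span-stable (powers E t d) f∈ y∈) (poly-≤ t (<⇒≤ le) z∈))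
        where
        eq : f * y + z ≡ y * (f + t * z)
        eq = trans (cong (f * y +_) (trans (sym (*-identityˡ z)) (cong (_* z) (sym ty≡1))))
          (solve 4 (λ f y t z → f :* y :+ t :* y :* z := y :* (f :+ t :* z)) refl f y t z)
      inv-stab : y ∈ sub (Stab (poly t d))
      inv-stab x x∈ = step d ≤-refl x x∈

  -- Codimension, divisibility and progressions

  codim-bound : ∀ {Z V k} W → Z ⊆ V → W ⊆ V → dim V ≡ dim W ℕ.+ k → dim Z ≤ dim (Z ∩ W) ℕ.+ k
  codim-bound {Z} {V} {k} W Z⊆V W⊆V eq = ℕₚ.+-cancelʳ-≤ (dim W) _ _ (begin
    dim Z ℕ.+ dim W  ≡⟨ sym (dim-mod Z W) ⟩
    dim (Z ∩ W) ℕ.+ dim (Z ⊞ W)  ≤⟨ ℕₚ.+-monoʳ-≤ (dim (Z ∩ W)) (dim-mono {Z ⊞ W} {V} (⊞-lub {Z} {W} {V} Z⊆V W⊆V)) ⟩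
    dim (Z ∩ W) ℕ.+ dim V  ≡⟨ cong (dim (Z ∩ W) ℕ.+_) (trans eq (ℕₚ.+-comm (dim W) k)) ⟩
    dim (Z ∩ W) ℕ.+ (k ℕ.+ dim W)  ≡⟨ sym (ℕₚ.+-assoc (dim (Z ∩ W)) k (dim W)) ⟩
    dim (Z ∩ W) ℕ.+ k ℕ.+ dim W  ∎)
    where open ℕₚ.≤-Reasoning

  dim-line : ∀ S {V x} → Stable S V → ¬ x ∈ V → dim (V ⊞ x · sub S) ≡ dim V ℕ.+ dim (sub S)
  dim-line S {V} {x} st x∉ = trans (dim-direct (line-disjoint {S} {V} st x∉))
    (cong (dim V ℕ.+_) (dim-· (sub S) λ { refl → x∉ (has0 V) }))

  -- Both dimensions are multiples of `dim (sub M)`.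
  gap : ∀ M {V W} → Stable M V → Stable M W → dim V < dim W → dim V ℕ.+ dim (sub M) ≤ dim W
  gap M {V} {W} stV stW lt = go (dim-stable M V stV) (dim-stable M W stW)
    where
    D : ℕ
    D = dim (sub M)
    go : ∃[ i ] dim V ≡ D ℕ.* i → ∃[ j ] dim W ≡ D ℕ.* j → dim V ℕ.+ D ≤ dim W
    go (i , eqi) (j , eqj) = begin
      dim V ℕ.+ D  ≡⟨ cong (ℕ._+ D) eqi ⟩
      D ℕ.* i ℕ.+ D  ≡⟨ *-suc′ D i ⟩
      D ℕ.* suc i  ≤⟨ ℕₚ.*-monoʳ-≤ D (ℕₚ.*-cancelˡ-< D i j (subst₂ _<_ eqi eqj lt)) ⟩
      D ℕ.* j  ≡⟨ sym eqj ⟩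
      dim W  ∎
      where open ℕₚ.≤-Reasoning

  gap₂ : ∀ M {V W} → Stable M V → Stable M W → dim V ℕ.+ dim (sub M) < dim W →
         dim V ℕ.+ (dim (sub M) ℕ.+ dim (sub M)) ≤ dim W
  gap₂ M {V} {W} stV stW lt = go (dim-stable M V stV) (dim-stable M W stW)
    where
    D : ℕ
    D = dim (sub M)
    go : ∃[ i ] dim V ≡ D ℕ.* i → ∃[ j ] dim W ≡ D ℕ.* j → dim V ℕ.+ (D ℕ.+ D) ≤ dim W
    go (i , eqi) (j , eqj) = begin
      dim V ℕ.+ (D ℕ.+ D)  ≡⟨ cong (ℕ._+ (D ℕ.+ D)) eqi ⟩
      D ℕ.* i ℕ.+ (D ℕ.+ D)  ≡⟨ *-suc-suc D i ⟩
      D ℕ.* suc (suc i)  ≤⟨ ℕₚ.*-monoʳ-≤ D (ℕₚ.*-cancelˡ-< D (suc i) j (subst₂ _<_ (trans (cong (ℕ._+ D) eqi) (*-suc′ D i)) eqj lt)) ⟩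
      D ℕ.* j  ≡⟨ sym eqj ⟩
      dim W  ∎
      where open ℕₚ.≤-Reasoning

  -- The field `dim-A` records that the sum of the core and the progression is direct and that its
  -- terms are independent. Storing `len-1` keeps the progression nonempty.
  record Progression (S : Subfield) (t : K) (A : Subspace) : Set₁ where
    field
      core   : Subspace
      start  : K
      len-1  : ℕ
    len : ℕ
    len = suc len-1
    field
      stable   : Stable S core
      t-stable : t ∈ sub (Stab core)
      A⊆       : A ⊆ core ⊞ start · poly S t len
      ⊆A       : core ⊞ start · poly S t len ⊆ A
      dim-A    : dim A ≡ dim core ℕ.+ len ℕ.* dim (sub S)

    start∈A : start ∈ A
    start∈A = ⊆A (⊞-injʳ core (start · poly S t len) (1# , poly-const S t len-1 (has1 S) , sym (*-identityʳ start)))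

    core⊆A : core ⊆ A
    core⊆A p = ⊆A (⊞-injˡ core (start · poly S t len) p)

  private
    -- Dividing t a = u + t v by t gives a = t⁻¹u + v. The core absorbs t⁻¹, and for b′ = t⁻¹b the
    -- two progressions combine to b′ (poly + t poly), which gains one term at its beginning.
    combine-⊆ : ∀ S {t} → t ≢ 0# → ∀ k {B : Subspace} (b : K) → t ∈ sub (Stab B) → ∀ {a u v} →
                u ∈ B ⊞ b · poly S t k → v ∈ B ⊞ b · poly S t k → t * a ≡ u + t * v →
                a ∈ B ⊞ (inv t * b) · poly S t (suc k)
    combine-⊆ S {t} t≢0 k {B} b tB {a} (β′ , _ , β′∈ , (y′ , y′∈ , refl) , refl) (β , _ , β∈ , (y , y∈ , refl) , refl) eq =
      inv t * β′ + β , b′ * (y′ + t * y) ,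
      has+ B (inv∈ (Stab B) tB β′ β′∈) β∈ ,
      (y′ + t * y , has+ (poly S t (suc k)) (poly-⊆suc S t k y′∈) (poly-t· S t k y∈) , refl) ,
      *-cancelˡ t≢0 (begin
        t * a  ≡⟨ eq ⟩
        β′ + b * y′ + t * (β + b * y)  ≡⟨ cong (λ z → z + b * y′ + t * (β + b * y)) (sym (*-inv-* t≢0 β′)) ⟩
        t * (inv t * β′) + b * y′ + t * (β + b * y)  ≡⟨ cong (λ z → t * (inv t * β′) + z * y′ + t * (β + z * y)) (sym (*-inv-* t≢0 b)) ⟩
        t * (inv t * β′) + t * b′ * y′ + t * (β + t * b′ * y)  ≡⟨ solve 6 (λ t i β b y′ y → t :* i :+ t :* b :* y′ :+ t :* (β :+ t :* b :* y) := t :* (i :+ β :+ b :* (y′ :+ t :* y))) refl t (inv t * β′) β b′ y′ y ⟩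
        t * (inv t * β′ + β + b′ * (y′ + t * y))  ∎)
      where
      open ≡-Reasoning
      b′ : K
      b′ = inv t * b

    combine-⊇ : ∀ S {t} → t ≢ 0# → ∀ k {A : Subspace} (b : K) → (∀ {f} → f ∈ sub S → f * b ∈ t · A) →
                b · poly S t k ⊆ A → (inv t * b) · poly S t (suc k) ⊆ A
    combine-⊇ S {t} t≢0 k {A} b fb∈ ⊆A (z , z∈ , refl) = step (poly-suc⁻ S t k z∈)
      where
      lift : ∀ {f y} → f * b ∈ t · A → y ∈ poly S t k → inv t * b * (f + t * y) ∈ A
      lift {f} {y} (a , a∈ , eq) y∈ = ∈-resp A (begin
        a + b * y  ≡⟨ cong₂ _+_ (trans (sym (inv-*-* t≢0 a)) (cong (inv t *_) (sym eq))) (cong (_* y) (sym (*-inv-* t≢0 b))) ⟩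
        inv t * (f * b) + t * (inv t * b) * y  ≡⟨ solve 5 (λ i f s t y → i :* (f :* s) :+ t :* (i :* s) :* y := i :* s :* (f :+ t :* y)) refl (inv t) f b t y ⟩
        inv t * b * (f + t * y)  ∎) (has+ A a∈ (⊆A (y , y∈ , refl)))
        where open ≡-Reasoning
      step : ∃[ f ] ∃[ y ] (f ∈ sub S × y ∈ poly S t k × z ≡ f + t * y) → inv t * b * z ∈ A
      step (f , y , f∈ , y∈ , refl) = lift (fb∈ f∈) y∈

    extend : ∀ S {t A} → t ≢ 0# → Stable S (A ∩ t · A) → dim A ≡ dim (A ∩ t · A) ℕ.+ dim (sub S) →
             t · A ⊆ (A ∩ t · A) ⊞ t · (A ∩ t · A) → Progression S t (A ∩ t · A) → Progression S t A
    extend S {t} {A} t≢0 stA₁ dimA₁ tA⊆U P = record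
      { core = core ; start = inv t * start ; len-1 = suc len-1 ; stable = λ {f} {x} → stable {f} {x} ; t-stable = t-stable
      ; A⊆ = λ {a} a∈ → step (tA⊆U (a , a∈ , refl))
      ; ⊆A = ⊞-lub {core} {(inv t * start) · poly S t (suc len)} {A} (proj₁ ∘ core⊆A)
          (combine-⊇ S t≢0 len {A} start (λ f∈ → proj₂ (stA₁ f∈ start∈A))
            (λ p → proj₁ (⊆A₁ (⊞-injʳ core (start · poly S t len) p))))
      ; dim-A = trans dimA₁ (trans (cong (ℕ._+ dim (sub S)) dim-A) (shift-+ (dim core) (dim (sub S)) (len ℕ.* dim (sub S)))) }
      where
      open Progression P renaming (A⊆ to A₁⊆; ⊆A to ⊆A₁)
      step : ∀ {a} → t * a ∈ (A ∩ t · A) ⊞ t · (A ∩ t · A) → a ∈ core ⊞ (inv t * start) · poly S t (suc len)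
      step (u , _ , u∈ , (v , v∈ , refl) , eq) = combine-⊆ S t≢0 len {core} start t-stable (A₁⊆ u∈) (A₁⊆ v∈) eq

    single : ∀ S {t A A₁} → Stable S A → Stable S A₁ → A₁ ⊆ A → t ∈ sub (Stab A₁) →
             dim A ≡ dim A₁ ℕ.+ dim (sub S) → ∃[ a ] (a ∈ A × ¬ a ∈ A₁) → Progression S t A
    single S {t} {A} {A₁} stA stA₁ A₁⊆A tA₁ dimA₁ (a , a∈ , a∉) = record
      { core = A₁ ; start = a ; len-1 = 0 ; stable = λ {f} {x} → stA₁ {f} {x} ; t-stable = tA₁
      ; A⊆ = λ x∈ → W⊆ (A⊆W x∈) ; ⊆A = λ x∈ → W⊆A (⊆W x∈)
      ; dim-A = trans dimA₁ (cong (dim A₁ ℕ.+_) (sym (ℕₚ.+-identityʳ (dim (sub S))))) }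
      where
      W : Subspace
      W = A₁ ⊞ a · sub S
      W⊆A : W ⊆ A
      W⊆A = ⊞-lub {A₁} {a · sub S} {A} A₁⊆A (λ { (f , f∈ , refl) → ∈-resp A (*-comm f a) (stA f∈ a∈) })
      A⊆W : A ⊆ W
      A⊆W = dim-equal {W} {A} W⊆A (≤-reflexive (trans dimA₁ (sym (dim-line S {A₁} stA₁ a∉))))
      W⊆ : W ⊆ A₁ ⊞ a · poly S t 1
      W⊆ (u , w , u∈ , (f , f∈ , eq) , eq′) = u , w , u∈ , (f , poly-const S t 0 f∈ , eq) , eq′
      ⊆W : A₁ ⊞ a · poly S t 1 ⊆ W
      ⊆W (u , w , u∈ , (f , f∈ , eq) , eq′) = u , w , u∈ , (f , poly-1 S t f∈ , eq) , eq′

  abstract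
    -- A ∩ tA is again of this shape unless it is t-stable, and A = t⁻¹(A ∩ tA) + (A ∩ tA).
    progression : ∀ S {t} → t ≢ 0# → ∀ n A → dim A ≤ n → Stable S A →
                  dim (A ⊞ t · A) ≡ dim A ℕ.+ dim (sub S) → Progression S t A
    progression S {t} t≢0 n A bound stA hyp = byFuel n bound (⊆? (t · A₁) A₁)
      where
      δ : ℕ
      δ = dim (sub S)
      A₁ : Subspace
      A₁ = A ∩ t · A
      stA₁ : Stable S A₁
      stA₁ = ∩-stable {S} {A} {t · A} stA (·-stable {S} {t} {A} stA)
      dimA₁ : dim A ≡ dim A₁ ℕ.+ δ
      dimA₁ = ℕₚ.+-cancelˡ-≡ (dim A) _ _ (begin
        dim A ℕ.+ dim A  ≡⟨ cong (dim A ℕ.+_) (sym (dim-· A t≢0)) ⟩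
        dim A ℕ.+ dim (t · A)  ≡⟨ sym (dim-mod A (t · A)) ⟩
        dim A₁ ℕ.+ dim (A ⊞ t · A)  ≡⟨ cong (dim A₁ ℕ.+_) hyp ⟩
        dim A₁ ℕ.+ (dim A ℕ.+ δ)  ≡⟨ swap-+ (dim A₁) (dim A) δ ⟩
        dim A ℕ.+ (dim A₁ ℕ.+ δ)  ∎)
        where open ≡-Reasoning
      dimA₁< : dim A₁ < dim A
      dimA₁< = subst (dim A₁ <_) (sym dimA₁) (ℕₚ.m<m+n (dim A₁) (dim-sub>0 S))
      new : (A ⊆ A₁) ⊎ (∃[ a ] (a ∈ A × ¬ a ∈ A₁)) → ∃[ a ] (a ∈ A × ¬ a ∈ A₁)
      new (inj₁ A⊆A₁) = contradiction (dim-mono {A} {A₁} A⊆A₁) (<⇒≱ dimA₁<)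
      new (inj₂ p)    = p
      U : Subspace
      U = A₁ ⊞ t · A₁
      stU : Stable S U
      stU = ⊞-stable {S} {A₁} {t · A₁} stA₁ (·-stable {S} {t} {A₁} stA₁)
      U⊆ : U ⊆ t · A
      U⊆ = ⊞-lub {A₁} {t · A₁} {t · A} proj₂ (·-mono {t} {A₁} {A} proj₁)
      dimU≤ : dim U ≤ dim A₁ ℕ.+ δ
      dimU≤ = ≤-trans (dim-mono {U} {t · A} U⊆) (≤-reflexive (trans (dim-· A t≢0) dimA₁))
      -- `U` is S-stable and larger than `A₁`, so it gains at least δ; inside `t · A` it cannot gain
      -- more.
      dimU : ∃[ x ] (x ∈ t · A₁ × ¬ x ∈ A₁) → dim U ≡ dim A₁ ℕ.+ δ
      dimU (x , x∈ , x∉) = ≤-antisym dimU≤ (gap S {A₁} {U} stA₁ stU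
        (ℕₚ.≰⇒> λ le → x∉ (dim-equal {A₁} {U} (⊞-injˡ A₁ (t · A₁)) le (⊞-injʳ A₁ (t · A₁) x∈))))

      byFuel : ∀ n → dim A ≤ n → (t · A₁ ⊆ A₁) ⊎ (∃[ x ] (x ∈ t · A₁ × ¬ x ∈ A₁)) → Progression S t A
      byFuel zero    bound _ = contradiction (≤-trans dimA₁< bound) λ ()
      byFuel (suc n) bound (inj₁ tA₁⊆A₁) =
        single S {t} {A} {A₁} stA stA₁ proj₁ (λ v v∈ → tA₁⊆A₁ (v , v∈ , refl)) dimA₁ (new (⊆? A A₁))
      byFuel (suc n) bound (inj₂ x) = extend S {t} {A} t≢0 stA₁ dimA₁
        (dim-equal {U} {t · A} U⊆ (≤-reflexive (trans (dim-· A t≢0) (trans dimA₁ (sym (dimU x))))))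
        (progression S t≢0 n A₁ (≤-pred (≤-trans dimA₁< bound)) stA₁ (dimU x))

  -- How dim (A ∩ sA) can vary when A lies between M-stable spaces C ⊆ A″ that differ by one M-dimension.
  module Sandwich (M : Subfield) {C A A″ : Subspace} {κ : ℕ} (stC : Stable M C) (stA″ : Stable M A″)
                  (C⊆A : C ⊆ A) (A⊆A″ : A ⊆ A″) (dimA″ : dim A″ ≡ dim C ℕ.+ dim (sub M))
                  (dimA : dim A ≡ dim C ℕ.+ κ) {s : K} (s≢0 : s ≢ 0#) where
    private
      D k e N r : ℕ
      D = dim (sub M)
      e = dim (C ∩ s · C)
      N = dim (A″ ∩ s · A″)
      r = dim (A ∩ s · A)
      NN : Subspace
      NN = A″ ∩ s · A″
      κ≤D : κ ≤ D
      κ≤D = ℕₚ.+-cancelˡ-≤ (dim C) _ _ (subst₂ _≤_ dimA dimA″ (dim-mono {A} {A″} A⊆A″))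
      k = D ℕ.∸ κ
      k+κ : k ℕ.+ κ ≡ D
      k+κ = ℕₚ.m∸n+n≡m κ≤D
      dim-s : ∀ {V W j} → dim V ≡ dim W ℕ.+ j → dim (s · V) ≡ dim (s · W) ℕ.+ j
      dim-s {V} {W} {j} eq = trans (dim-· V s≢0) (trans eq (cong (ℕ._+ j) (sym (dim-· W s≢0))))
      dimA″A : dim A″ ≡ dim A ℕ.+ k
      dimA″A = trans dimA″ (trans (cong (dim C ℕ.+_) (trans (sym k+κ) (ℕₚ.+-comm k κ))) (trans (sym (ℕₚ.+-assoc (dim C) κ k)) (cong (ℕ._+ k) (sym dimA))))
      sC⊆sA : s · C ⊆ s · A
      sC⊆sA = ·-mono {s} {C} {A} C⊆A
      sA⊆sA″ : s · A ⊆ s · A″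
      sA⊆sA″ = ·-mono {s} {A} {A″} A⊆A″
      e≤r : e ≤ r
      e≤r = dim-mono {C ∩ s · C} {A ∩ s · A} (λ (p , p′) → C⊆A p , sC⊆sA p′)
      r≤N : r ≤ N
      r≤N = dim-mono {A ∩ s · A} {NN} (λ (p , p′) → A⊆A″ p , sA⊆sA″ p′)
      N≤ : N ≤ e ℕ.+ (D ℕ.+ D)
      N≤ = begin
        N  ≤⟨ codim-bound {NN} {A″} C proj₁ (A⊆A″ ∘ C⊆A) dimA″ ⟩
        dim (NN ∩ C) ℕ.+ D  ≤⟨ ℕₚ.+-monoˡ-≤ D (codim-bound {NN ∩ C} {s · A″} (s · C) (λ p → proj₂ (proj₁ p)) (λ p → sA⊆sA″ (sC⊆sA p)) (dim-s {A″} {C} dimA″)) ⟩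
        dim (NN ∩ C ∩ s · C) ℕ.+ D ℕ.+ D  ≤⟨ ℕₚ.+-monoˡ-≤ D (ℕₚ.+-monoˡ-≤ D (dim-mono {NN ∩ C ∩ s · C} {C ∩ s · C} (λ ((_ , p) , p′) → p , p′))) ⟩
        e ℕ.+ D ℕ.+ D  ≡⟨ ℕₚ.+-assoc e D D ⟩
        e ℕ.+ (D ℕ.+ D)  ∎
        where open ℕₚ.≤-Reasoning
      r≤ : r ≤ e ℕ.+ (κ ℕ.+ κ)
      r≤ = begin
        r  ≤⟨ codim-bound {A ∩ s · A} {A} C proj₁ C⊆A dimA ⟩
        dim (A ∩ s · A ∩ C) ℕ.+ κ  ≤⟨ ℕₚ.+-monoˡ-≤ κ (codim-bound {A ∩ s · A ∩ C} {s · A} (s · C) (λ p → proj₂ (proj₁ p)) sC⊆sA (dim-s {A} {C} dimA)) ⟩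
        dim (A ∩ s · A ∩ C ∩ s · C) ℕ.+ κ ℕ.+ κ ≤⟨ ℕₚ.+-monoˡ-≤ κ (ℕₚ.+-monoˡ-≤ κ (dim-mono {A ∩ s · A ∩ C ∩ s · C} {C ∩ s · C} (λ ((_ , p) , p′) → p , p′))) ⟩
        e ℕ.+ κ ℕ.+ κ  ≡⟨ ℕₚ.+-assoc e κ κ ⟩
        e ℕ.+ (κ ℕ.+ κ)  ∎
        where open ℕₚ.≤-Reasoning
      N≤r : N ≤ r ℕ.+ (k ℕ.+ k)
      N≤r = begin
        N  ≤⟨ codim-bound {NN} {A″} A proj₁ A⊆A″ dimA″A ⟩
        dim (NN ∩ A) ℕ.+ k  ≤⟨ ℕₚ.+-monoˡ-≤ k (codim-bound {NN ∩ A} {s · A″} (s · A) (λ p → proj₂ (proj₁ p)) sA⊆sA″ (dim-s {A″} {A} dimA″A)) ⟩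
        dim (NN ∩ A ∩ s · A) ℕ.+ k ℕ.+ k  ≤⟨ ℕₚ.+-monoˡ-≤ k (ℕₚ.+-monoˡ-≤ k (dim-mono {NN ∩ A ∩ s · A} {A ∩ s · A} (λ ((_ , p) , p′) → p , p′))) ⟩
        r ℕ.+ k ℕ.+ k  ≡⟨ ℕₚ.+-assoc r k k ⟩
        r ℕ.+ (k ℕ.+ k)  ∎
        where open ℕₚ.≤-Reasoning
      stsC : Stable M (s · C)
      stsC = ·-stable {M} {s} {C} stC
      stNN : Stable M NN
      stNN = ∩-stable {M} {A″} {s · A″} stA″ (·-stable {M} {s} {A″} stA″)

      stC∩sC : Stable M (C ∩ s · C)
      stC∩sC = ∩-stable {M} {C} {s · C} stC stsC
      squeeze : ∀ V → Stable M V → C ∩ s · C ⊆ V → dim V ≤ e ℕ.+ D → dim V ≡ e ⊎ dim V ≡ e ℕ.+ D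
      squeeze V stV ⊆V le = go (ℕₚ.m≤n⇒m<n∨m≡n (dim-mono {C ∩ s · C} {V} ⊆V))
        where
        go : e < dim V ⊎ e ≡ dim V → dim V ≡ e ⊎ dim V ≡ e ℕ.+ D
        go (inj₁ lt) = inj₂ (≤-antisym le (gap M {C ∩ s · C} {V} stC∩sC stV lt))
        go (inj₂ eq) = inj₁ (sym eq)

      -- If `NN` meets `C` or `s · C` in dimension e only, then cutting `A ∩ s · A` down to that
      -- space costs at most κ. Otherwise `NN` lies in both, hence in `C ∩ s · C`, whose dimension e
      -- is too small.
      middle : N ≡ e ℕ.+ D → r ≤ e ℕ.+ κ
      middle eqN = go (within C stC proj₁) (within (s · C) stsC proj₂)
        where
        open ℕₚ.≤-Reasoning
        within : ∀ W → Stable M W → (C ∩ s · C ⊆ W) → dim (NN ∩ W) ≡ e ⊎ dim (NN ∩ W) ≡ e ℕ.+ D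
        within W stW ⊆W = squeeze (NN ∩ W) (∩-stable {M} {NN} {W} stNN stW)
          (λ p → (A⊆A″ (C⊆A (proj₁ p)) , sA⊆sA″ (sC⊆sA (proj₂ p))) , ⊆W p)
          (≤-trans (dim-mono {NN ∩ W} {NN} proj₁) (≤-reflexive eqN))
        cut : ∀ W → dim (A ∩ s · A) ≤ dim (A ∩ s · A ∩ W) ℕ.+ κ → dim (NN ∩ W) ≡ e → r ≤ e ℕ.+ κ
        cut W le eq = begin
          r  ≤⟨ le ⟩
          dim (A ∩ s · A ∩ W) ℕ.+ κ  ≤⟨ ℕₚ.+-monoˡ-≤ κ (dim-mono {A ∩ s · A ∩ W} {NN ∩ W} (λ ((p , p′) , c) → (A⊆A″ p , sA⊆sA″ p′) , c)) ⟩
          dim (NN ∩ W) ℕ.+ κ  ≡⟨ cong (ℕ._+ κ) eq ⟩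
          e ℕ.+ κ  ∎
        all : ∀ {W} → dim (NN ∩ W) ≡ e ℕ.+ D → NN ⊆ NN ∩ W
        all {W} eq = dim-equal {NN ∩ W} {NN} proj₁ (≤-reflexive (trans eqN (sym eq)))
        go : dim (NN ∩ C) ≡ e ⊎ dim (NN ∩ C) ≡ e ℕ.+ D → dim (NN ∩ s · C) ≡ e ⊎ dim (NN ∩ s · C) ≡ e ℕ.+ D → r ≤ e ℕ.+ κ
        go (inj₁ eq) _ = cut C (codim-bound {A ∩ s · A} {A} C proj₁ C⊆A dimA) eq
        go (inj₂ _) (inj₁ eq) = cut (s · C) (codim-bound {A ∩ s · A} {s · A} (s · C) proj₂ sC⊆sA (dim-s {A} {C} dimA)) eq
        go (inj₂ eq) (inj₂ eq′) = contradiction (dim-mono {NN} {C ∩ s · C} (λ p → proj₂ (all {C} eq p) , proj₂ (all {s · C} eq′ p)))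
          (<⇒≱ (subst (e <_) (sym eqN) (ℕₚ.m<m+n e (dim-sub>0 M))))

    -- Both intersections at the ends are M-stable, and two cuts of codimension D separate them, so
    -- N is e, e + D or e + 2D. Two cuts of codimension D - κ, from A″ to A, bound r from below by N
    -- - 2(D - κ); two cuts of codimension κ, from A to C, bound it by e + 2κ.
    trichotomy : Trichotomy e N r D κ
    trichotomy = go (ℕₚ.≤-<-connex N (e ℕ.+ D))
      where
      open ℕₚ.≤-Reasoning
      low : N ≡ e ⊎ N ≡ e ℕ.+ D → Trichotomy e N r D κ
      low (inj₁ eq) = inj₁ (eq , ≤-antisym (≤-trans r≤N (≤-reflexive eq)) e≤r)
      low (inj₂ eq) = inj₂ (inj₁ (eq , e≤r , middle eq , ℕₚ.+-cancelʳ-≤ k _ _ (begin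
        e ℕ.+ (κ ℕ.+ κ) ℕ.+ k  ≡⟨ regroup₁ e κ k ⟩
        e ℕ.+ (k ℕ.+ κ) ℕ.+ κ  ≡⟨ cong (λ z → e ℕ.+ z ℕ.+ κ) k+κ ⟩
        e ℕ.+ D ℕ.+ κ  ≡⟨ cong (ℕ._+ κ) (sym eq) ⟩
        N ℕ.+ κ  ≤⟨ ℕₚ.+-monoˡ-≤ κ N≤r ⟩
        r ℕ.+ (k ℕ.+ k) ℕ.+ κ  ≡⟨ regroup₂ r k κ ⟩
        r ℕ.+ (k ℕ.+ κ) ℕ.+ k  ≡⟨ cong (λ z → r ℕ.+ z ℕ.+ k) k+κ ⟩
        r ℕ.+ D ℕ.+ k  ∎)))
      go : N ≤ e ℕ.+ D ⊎ e ℕ.+ D < N → Trichotomy e N r D κ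
      go (inj₁ N≤e+D) = low (squeeze NN stNN (λ (p , p′) → A⊆A″ (C⊆A p) , sA⊆sA″ (sC⊆sA p′)) N≤e+D)
      go (inj₂ e+D<N) = inj₂ (inj₂ (eqN , ≤-antisym r≤ (ℕₚ.+-cancelʳ-≤ (k ℕ.+ k) _ _ (begin
          e ℕ.+ (κ ℕ.+ κ) ℕ.+ (k ℕ.+ k)  ≡⟨ regroup₃ e κ k ⟩
          e ℕ.+ (k ℕ.+ κ ℕ.+ (k ℕ.+ κ))  ≡⟨ cong (λ z → e ℕ.+ (z ℕ.+ z)) k+κ ⟩
          e ℕ.+ (D ℕ.+ D)  ≡⟨ sym eqN ⟩
          N  ≤⟨ N≤r ⟩
          r ℕ.+ (k ℕ.+ k)  ∎))))
        where
        eqN : N ≡ e ℕ.+ (D ℕ.+ D)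
        eqN = ≤-antisym N≤ (gap₂ M {C ∩ s · C} {NN} stC∩sC stNN e+D<N)

  -- Consequences of attaining every intersection dimension

  stable-dim≤ : ∀ M {V x} → Stable M V → x ∈ V → x ≢ 0# → dim (sub M) ≤ dim V
  stable-dim≤ M {V} {x} st x∈ x≢0 = subst (_≤ dim V) (dim-· (sub M) x≢0)
    (dim-mono {x · sub M} {V} (λ { (f , f∈ , refl) → ∈-resp V (*-comm f x) (st f∈ x∈) }))

  stab-dim : ∀ {V s} → s ≢ 0# → V ⊆ s · V → s ∈ sub (Stab V)
  stab-dim {V} {s} s≢0 V⊆ v v∈ = dim-equal {V} {s · V} V⊆ (≤-reflexive (dim-· V s≢0)) (v , v∈ , refl)

  stab-⊆ : ∀ {V s} → s ≢ 0# → s ∈ sub (Stab V) → V ⊆ s · V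
  stab-⊆ {V} {s} s≢0 s∈ {v} v∈ = inv s * v , inv∈ (Stab V) s∈ v v∈ , sym (*-inv-* s≢0 v)

  Full : Subspace → Set
  Full A = ∀ r → r ≤ dim A → ∃[ s ] (s ≢ 0# × dim (A ∩ s · A) ≡ r)

  -- A relation c p = s c p′ with p, p′ in M and p′ ≠ 0 would make s the quotient p/p′ and so an
  -- element of M.
  field-disjoint : ∀ M {A c s} → c ≢ 0# → A ⊆ c · sub M → ¬ s ∈ sub M → Disjoint A (s · A)
  field-disjoint M {A} {c} {s} c≢0 A⊆ s∉ x∈ (a , a∈ , eq) = cancel (A⊆ x∈) (A⊆ a∈) eq
    where
    cancel : ∀ {x a} → x ∈ c · sub M → a ∈ c · sub M → x ≡ s * a → x ≡ 0#
    cancel {x} {a} (p , p∈ , refl) (p′ , p′∈ , refl) eq = go (p′ ≟K 0#)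
      where
      p≡ : p ≡ s * p′
      p≡ = *-cancelˡ c≢0 (trans eq (solve 3 (λ s c p → s :* (c :* p) := c :* (s :* p)) refl s c p′))
      go : Dec (p′ ≡ 0#) → c * p ≡ 0#
      go (yes refl) = trans (cong (c *_) (trans p≡ (zeroʳ s))) (zeroʳ c)
      go (no p′≢0) = contradiction (∈-resp (sub M) (trans (cong (inv p′ *_) (trans p≡ (*-comm s p′))) (inv-*-* p′≢0 s)) (mul M (inv∈ M p′∈) p∈)) s∉

  -- A multiplier outside M gives intersection zero, so s lies in M and `c · M` contains both A and
  -- `s · A`. The modular law turns this into 2 dim A - 1 ≤ dim M.
  field-bound : ∀ M {A c s} → c ≢ 0# → A ⊆ c · sub M → s ≢ 0# → dim (A ∩ s · A) ≡ 1 →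
                dim A ℕ.+ dim A ≤ dim (sub M) ℕ.+ 1
  field-bound M {A} {c} {s} c≢0 A⊆ s≢0 eq1 = split (mem? (sub M) s)
    where
    split : Dec (s ∈ sub M) → dim A ℕ.+ dim A ≤ dim (sub M) ℕ.+ 1
    split (yes s∈) = begin
      dim A ℕ.+ dim A  ≡⟨ cong (dim A ℕ.+_) (sym (dim-· A s≢0)) ⟩
      dim A ℕ.+ dim (s · A)  ≡⟨ sym (dim-mod A (s · A)) ⟩
      dim (A ∩ s · A) ℕ.+ dim (A ⊞ s · A)  ≡⟨ cong (ℕ._+ dim (A ⊞ s · A)) eq1 ⟩
      1 ℕ.+ dim (A ⊞ s · A)  ≤⟨ s≤s (dim-mono {A ⊞ s · A} {c · sub M} (⊞-lub {A} {s · A} {c · sub M} A⊆ sA⊆)) ⟩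
      1 ℕ.+ dim (c · sub M)  ≡⟨ trans (cong suc (dim-· (sub M) c≢0)) (ℕₚ.+-comm 1 _) ⟩
      dim (sub M) ℕ.+ 1  ∎
      where
      open ℕₚ.≤-Reasoning
      sA⊆ : s · A ⊆ c · sub M
      sA⊆ (a , a∈ , refl) = ·-stable {M} {c} {sub M} (self-stable M) s∈ (A⊆ a∈)
    split (no s∉) = contradiction (subst₂ _≤_ eq1 dim-zero (dim-mono {A ∩ s · A} {zeroₛ} (λ (p , p′) → field-disjoint M {A} c≢0 A⊆ s∉ p p′))) λ ()

  degree>0 : ∀ S {t d} → DegreeOver E (mem (sub S)) t d → 0 < d
  degree>0 S {t} {suc d} _ = s≤s z≤n
  degree>0 S {t} {zero}  (_ , ¬p) = contradiction
    (indep-∷ S (powers E t 1) (λ _ _ _ ()) (λ (_ , _ , eq) → 0≢1 eq)) ¬p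

  poly⊆Stab : ∀ S {t V} k → Stable S V → t ∈ sub (Stab V) → poly S t k ⊆ sub (Stab V)
  poly⊆Stab S {t} {V} k st t∈ = poly⊆ S t k (sub (Stab V))
    (λ f∈ x∈ → mul (Stab V) (λ v v∈ → st f∈ v∈) x∈) (mul (Stab V) t∈) (has1 (Stab V))

  -- The stabilizer M of `poly S t d` is a field containing S and t, so A lies in `c · M`; and M
  -- lies in `poly S t d` because 1 does. The intersection dimension 1 then supplies the multiplier
  -- for `field-bound`.
  degree-bound : ∀ S {t d A c k} → t ≢ 0# → DegreeOver E (mem (sub S)) t d → c ≢ 0# → A ⊆ c · poly S t k →
                 Full A → 1 ≤ dim A → dim A ℕ.+ dim A ≤ d ℕ.* dim (sub S) ℕ.+ 1
  degree-bound S {t} {d} {A} {c} {k} t≢0 deg c≢0 A⊆ full 1≤ = ≤-trans (bound (full 1 1≤))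
      (ℕₚ.+-monoˡ-≤ 1 (subst (dim (sub M) ≤_) (dim-indep S (powers E t d) (proj₁ deg)) (dim-mono {sub M} {poly S t d} M⊆)))
    where
    M : Subfield
    M = Stab (poly S t d)
    1∈ : ∀ {d} → 0 < d → 1# ∈ poly S t d
    1∈ {suc d} _ = poly-const S t d (has1 S)
    M⊆ : sub M ⊆ poly S t d
    M⊆ {x} p = ∈-resp (poly S t d) (*-identityʳ x) (p 1# (1∈ (degree>0 S deg)))
    bound : ∃[ s ] (s ≢ 0# × dim (A ∩ s · A) ≡ 1) → dim A ℕ.+ dim A ≤ dim (sub M) ℕ.+ 1
    bound (s , s≢0 , eq) = field-bound M {A} {c} c≢0
      (λ x∈ → ·-mono {c} {poly S t k} {sub M} (poly⊆Stab S {t} {poly S t d} k (span-stable S (powers E t d)) (degree-stable S t≢0 deg)) (A⊆ x∈)) s≢0 eq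

  -- For r < D the M-space `C ∩ s · C` has dimension at most r, hence 0, and the trichotomy with e =
  -- 0 yields the hypothesis of the arithmetic lemma. The bound D ≤ dim A makes all these r
  -- attainable.
  no-large-stabilizer : ∀ M {C A A″ κ} → Stable M C → Stable M A″ → C ⊆ A → A ⊆ A″ → dim A″ ≡ dim C ℕ.+ dim (sub M) →
         dim A ≡ dim C ℕ.+ κ → Full A → dim (sub M) ≤ dim A → 4 ≤ dim (sub M) → 1 ≤ κ → κ < dim (sub M) → ⊥
  no-large-stabilizer M {C} {A} {A″} {κ} stC stA″ C⊆A A⊆A″ dimA″ dimA full D≤ 4≤D 1≤κ κ<D =
    no-large-stabilizer-arith (dim (sub M)) κ 4≤D 1≤κ κ<D (λ r r<D → small r r<D (full r (≤-trans (<⇒≤ r<D) D≤)))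
    where
    D : ℕ
    D = dim (sub M)
    small : ∀ r → r < D → ∃[ s ] (s ≢ 0# × dim (A ∩ s · A) ≡ r) → r ≡ 0 ⊎ (r ≤ κ × κ ℕ.+ κ ≤ r ℕ.+ D) ⊎ r ≡ κ ℕ.+ κ
    small r r<D (s , s≢0 , refl) = finish trichotomy
      where
      open Sandwich M {C} {A} {A″} {κ} stC stA″ C⊆A A⊆A″ dimA″ dimA s≢0
      e : ℕ
      e = dim (C ∩ s · C)
      e≤r : e ≤ dim (A ∩ s · A)
      e≤r = dim-mono {C ∩ s · C} {A ∩ s · A} (λ (p , p′) → C⊆A p , ·-mono {s} {C} {A} C⊆A p′)
      e≡0 : e ≡ 0
      e≡0 with e in eq
      ... | zero  = refl
      ... | suc _ = contradiction (≤-trans (subst (_≤ e) (cong (ℕ._+ D) dim-zero)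
              (gap M {zeroₛ} {C ∩ s · C} (zero-stable M) (∩-stable {M} {C} {s · C} stC (·-stable {M} {s} {C} stC)) (subst₂ _<_ (sym dim-zero) (sym eq) (s≤s z≤n)))) e≤r) (<⇒≱ r<D)
      finish : _ → _
      finish (inj₁ (_ , eq)) = inj₁ (trans eq e≡0)
      finish (inj₂ (inj₁ (_ , _ , le , le′))) = inj₂ (inj₁ (subst (λ z → dim (A ∩ s · A) ≤ z ℕ.+ κ) e≡0 le , subst (λ z → z ℕ.+ (κ ℕ.+ κ) ≤ dim (A ∩ s · A) ℕ.+ D) e≡0 le′))
      finish (inj₂ (inj₂ (_ , eq))) = inj₂ (inj₂ (trans eq (cong (ℕ._+ (κ ℕ.+ κ)) e≡0)))

  -- Otherwise the core, being stable under S and t, would absorb the whole progression, against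
  -- `dim-A`.
  start∉core : ∀ S {t A} (P : Progression S t A) → ¬ Progression.start P ∈ Progression.core P
  start∉core S {t} {A} P b∈ = contradiction (dim-mono {A} {core} (λ x∈ → ⊆core (A⊆ x∈)))
      (<⇒≱ (subst (dim core <_) (sym dim-A) (ℕₚ.m<m+n (dim core) (≤-trans (dim-sub>0 S) (ℕₚ.m≤m+n _ _)))))
    where
    open Progression P
    ⊆core : core ⊞ start · poly S t len ⊆ core
    ⊆core = ⊞-lub {core} {start · poly S t len} {core} (λ p → p)
      (λ { (z , z∈ , refl) → ∈-resp core (*-comm z start) (poly⊆Stab S {t} {core} len stable t-stable z∈ start b∈) })

  -- A relation between b and sb modulo B + sB lets us replace s by a Möbius transform λ with b ∈ B + λB.
  align : ∀ {B b s f₁ f₂ b₁ b₂} → s ≢ 0# → ¬ InF E s → InF E f₁ → InF E f₂ → b₁ ∈ B → b₂ ∈ B →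
          b₁ + b * f₁ ≡ s * (b₂ + b * f₂) → ¬ (f₁ ≡ 0# × f₂ ≡ 0#) →
          ∃[ t ] (t ≢ 0# × b ∈ B ⊞ t · B × dim (B ⊞ t · B) ≡ dim (B ⊞ s · B))
  align {B} {b} {s} {f₁} {f₂} {b₁} {b₂} s≢0 s∉F f₁∈ f₂∈ b₁∈ b₂∈ rel ≢0 = go (f₂ ≟K 0#)
    where
    open ≡-Reasoning
    go : Dec (f₂ ≡ 0#) → ∃[ t ] (t ≢ 0# × b ∈ B ⊞ t · B × dim (B ⊞ t · B) ≡ dim (B ⊞ s · B))
    go (yes f₂≡0) = s , s≢0 , (inv f₁ * - b₁ , s * (inv f₁ * b₂) , has* B (inv∈ base f₁∈) (has- B b₁∈) ,
        (inv f₁ * b₂ , has* B (inv∈ base f₁∈) b₂∈ , refl) , *-cancelˡ f₁≢0 eq) , refl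
      where
      f₁≢0 : f₁ ≢ 0#
      f₁≢0 f₁≡0 = ≢0 (f₁≡0 , f₂≡0)
      eq : f₁ * b ≡ f₁ * (inv f₁ * - b₁ + s * (inv f₁ * b₂))
      eq = begin
        f₁ * b  ≡⟨ solve 3 (λ f b c → f :* b := c :+ b :* f :- c) refl f₁ b b₁ ⟩
        b₁ + b * f₁ - b₁  ≡⟨ cong (_- b₁) rel ⟩
        s * (b₂ + b * f₂) - b₁  ≡⟨ cong (λ z → s * (b₂ + z) - b₁) (trans (cong (b *_) f₂≡0) (zeroʳ b)) ⟩
        s * (b₂ + 0#) - b₁  ≡⟨ cong (λ z → s * z - b₁) (+-identityʳ b₂) ⟩
        s * b₂ - b₁  ≡⟨ sym (*-inv-* f₁≢0 _) ⟩
        f₁ * (inv f₁ * (s * b₂ - b₁))  ≡⟨ solve 5 (λ f i s b₂ b₁ → f :* (i :* (s :* b₂ :- b₁)) := f :* (i :* (:- b₁) :+ s :* (i :* b₂))) refl f₁ (inv f₁) s b₂ b₁ ⟩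
        f₁ * (inv f₁ * - b₁ + s * (inv f₁ * b₂))  ∎
    -- The relation reads u b = s b₂ - b₁ with u = f₁ - s f₂. Over F, the pairs 1, s and 1, u span
    -- the same space, so B + sB = u (B + u⁻¹B). This keeps the dimension and, after division by u,
    -- puts b into B + u⁻¹B.
    go (no f₂≢0) = inv u , inv≢0 u≢0 ,
        (- (inv f₂ * b₂) , inv u * (inv f₂ * (f₁ * b₂) - b₁) , has- B (has* B g∈ b₂∈) ,
          (_ , has∸ B (has* B g∈ (has* B f₁∈ b₂∈)) b₁∈ , refl) , *-cancelˡ u≢0 eq) ,
        trans (sym (dim-· (B ⊞ inv u · B) u≢0)) (dim-resp {u · (B ⊞ inv u · B)} {B ⊞ s · B} u⊆ ⊆u)
      where
      g : K
      g = inv f₂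
      g∈ : InF E g
      g∈ = inv∈ base f₂∈
      u : K
      u = f₁ - s * f₂
      s≡ : s ≡ (f₁ - u) * g
      s≡ = begin
        s  ≡⟨ sym (*-inv-* f₂≢0 s) ⟩
        f₂ * (g * s)  ≡⟨ solve 4 (λ f s g f₁ → f :* (g :* s) := (f₁ :- (f₁ :- s :* f)) :* g) refl f₂ s g f₁ ⟩
        (f₁ - u) * g  ∎
      u≢0 : u ≢ 0#
      u≢0 u≡0 = s∉F (subst (InF E) (sym (trans s≡ (cong (λ z → (f₁ - z) * g) u≡0))) (F-* _ _ (F-+ _ _ f₁∈ (F-- _ F-0)) g∈))
      eq : u * b ≡ u * (- (g * b₂) + inv u * (g * (f₁ * b₂) - b₁))
      eq = begin
        u * b  ≡⟨ solve 5 (λ f₁ f₂ s b c → (f₁ :- s :* f₂) :* b := c :+ b :* f₁ :- c :- s :* (b :* f₂)) refl f₁ f₂ s b b₁ ⟩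
        b₁ + b * f₁ - b₁ - s * (b * f₂)  ≡⟨ cong (λ z → z - b₁ - s * (b * f₂)) rel ⟩
        s * (b₂ + b * f₂) - b₁ - s * (b * f₂)  ≡⟨ solve 4 (λ s b₂ x b₁ → s :* (b₂ :+ x) :- b₁ :- s :* x := s :* b₂ :- b₁) refl s b₂ (b * f₂) b₁ ⟩
        s * b₂ - b₁  ≡⟨ cong (λ z → z * b₂ - b₁) s≡ ⟩
        (f₁ - u) * g * b₂ - b₁  ≡⟨ solve 5 (λ f₁ u g b₂ b₁ → (f₁ :- u) :* g :* b₂ :- b₁ := u :* (:- (g :* b₂)) :+ (g :* (f₁ :* b₂) :- b₁)) refl f₁ u g b₂ b₁ ⟩
        u * - (g * b₂) + (g * (f₁ * b₂) - b₁)  ≡⟨ cong (u * - (g * b₂) +_) (sym (*-inv-* u≢0 _)) ⟩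
        u * - (g * b₂) + u * (inv u * (g * (f₁ * b₂) - b₁)) ≡⟨ sym (distribˡ u _ _) ⟩
        u * (- (g * b₂) + inv u * (g * (f₁ * b₂) - b₁))  ∎
      u⊆ : u · (B ⊞ inv u · B) ⊆ B ⊞ s · B
      u⊆ (_ , (v , _ , v∈ , (w , w∈ , refl) , refl) , refl) =
        f₁ * v + w , s * - (f₂ * v) , has+ B (has* B f₁∈ v∈) w∈ , (_ , has- B (has* B f₂∈ v∈) , refl) , (begin
          u * (v + inv u * w)  ≡⟨ distribˡ u v _ ⟩
          u * v + u * (inv u * w)  ≡⟨ cong (u * v +_) (*-inv-* u≢0 w) ⟩
          u * v + w  ≡⟨ solve 5 (λ f₁ s f₂ v w → (f₁ :- s :* f₂) :* v :+ w := f₁ :* v :+ w :+ s :* (:- (f₂ :* v))) refl f₁ s f₂ v w ⟩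
          f₁ * v + w + s * - (f₂ * v)  ∎)
      ⊆u : B ⊞ s · B ⊆ u · (B ⊞ inv u · B)
      ⊆u (v , _ , v∈ , (w , w∈ , refl) , refl) =
        - (g * w) + inv u * (v + f₁ * (g * w)) ,
        (_ , _ , has- B (has* B g∈ w∈) , (_ , has+ B v∈ (has* B f₁∈ (has* B g∈ w∈)) , refl) , refl) , (begin
          v + s * w  ≡⟨ cong (λ z → v + z * w) s≡ ⟩
          v + (f₁ - u) * g * w  ≡⟨ solve 5 (λ v f₁ u g w → v :+ (f₁ :- u) :* g :* w := u :* (:- (g :* w)) :+ (v :+ f₁ :* (g :* w))) refl v f₁ u g w ⟩
          u * - (g * w) + (v + f₁ * (g * w))  ≡⟨ cong (u * - (g * w) +_) (sym (*-inv-* u≢0 _)) ⟩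
          u * - (g * w) + u * (inv u * (v + f₁ * (g * w))) ≡⟨ sym (distribˡ u _ _) ⟩
          u * (- (g * w) + inv u * (v + f₁ * (g * w)))  ∎)

  -- Quadratic extensions of the base field and the vectors rvec

  quad : ∀ {ξ} → IsFq2Basis E ξ → Subfield
  quad {ξ} (_ , mul′ , inv′) = record
    { sub = record
      { mem = Span1ξ E ξ
      ; mem? = λ x → any? λ a → any? λ b → mem? (sub base) a ×-dec mem? (sub base) b ×-dec (x ≟K (a + b * ξ))
      ; has0 = 0# , 0# , F-0 , F-0 , sym (trans (+-identityˡ _) (zeroˡ ξ))
      ; has+ = λ { (a , b , a∈ , b∈ , refl) (a′ , b′ , a′∈ , b′∈ , refl) → a + a′ , b + b′ , F-+ _ _ a∈ a′∈ , F-+ _ _ b∈ b′∈ ,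
          solve 5 (λ a b a′ b′ ξ → a :+ b :* ξ :+ (a′ :+ b′ :* ξ) := a :+ a′ :+ (b :+ b′) :* ξ) refl a b a′ b′ ξ }
      ; has* = λ { {f} f∈ (a , b , a∈ , b∈ , refl) → f * a , f * b , F-* _ _ f∈ a∈ , F-* _ _ f∈ b∈ ,
          solve 4 (λ f a b ξ → f :* (a :+ b :* ξ) := f :* a :+ f :* b :* ξ) refl f a b ξ } }
    ; has1 = 1# , 0# , F-1 , F-0 , sym (trans (cong (1# +_) (zeroˡ ξ)) (+-identityʳ 1#))
    ; mul = mul′ _ _ ; invs = inv′ _ _ }

  ξ∈Span1ξ : ∀ ξ → Span1ξ E ξ ξ
  ξ∈Span1ξ ξ = 0# , 1# , F-0 , F-1 , sym (trans (+-identityˡ _) (*-identityˡ ξ))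

  dim-span1ξ : ∀ {ξ} → ¬ InF E ξ → dim (sub base ⊞ ξ · sub base) ≡ 2
  dim-span1ξ {ξ} ξ∉ = trans (dim-line base {sub base} (self-stable base) ξ∉) (cong₂ ℕ._+_ dim-base dim-base)

  dim-quad : ∀ {ξ} (isB : IsFq2Basis E ξ) → dim (sub (quad isB)) ≡ 2
  dim-quad {ξ} isB = trans (dim-resp {sub (quad isB)} {sub base ⊞ ξ · sub base}
    (λ { (a , b , a∈ , b∈ , refl) → a , b * ξ , a∈ , (b , b∈ , *-comm b ξ) , refl })
    (λ { (a , _ , a∈ , (b , b∈ , refl) , refl) → a , b , a∈ , b∈ , cong (a +_) (*-comm ξ b) })) (dim-span1ξ (proj₁ isB))

  rspan : K → K → ℕ → Subspace
  rspan ξ t N = span base (rvec E ξ t N)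

  -- Shifting the index by two keeps its parity and raises the exponent by one, so `rspan` unfolds
  -- two entries at a time, with one coefficient from ⟨1, ξ⟩ per step.
  rvec-suc-suc : ∀ ξ t N (i : Fin N) → rvec E ξ t (suc (suc N)) (suc (suc i)) ≡ t * rvec E ξ t N i
  rvec-suc-suc ξ t N i = trans (cong (λ h → if (toℕ i % 2) ≡ᵇ 0 then pow E t h else ξ * pow E t h) (half (toℕ i))) (lemma ((toℕ i % 2) ≡ᵇ 0))
    where
    half : ∀ n → suc (suc n) / 2 ≡ suc (n / 2)
    half n = m/n≡1+[m∸n]/n {suc (suc n)} {2} (s≤s (s≤s z≤n))
    lemma : ∀ c {p} → (if c then t * p else ξ * (t * p)) ≡ t * (if c then p else ξ * p)
    lemma true  = refl
    lemma false {p} = solve 3 (λ ξ t p → ξ :* (t :* p) := t :* (ξ :* p)) refl ξ t p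

  rspan-1⁻ : ∀ ξ t {x} → x ∈ rspan ξ t 1 → InF E x
  rspan-1⁻ ξ t (a , a∈ , refl) = subst (InF E) (sym (trans (+-identityʳ _) (*-identityʳ _))) (a∈ zero)

  rspan-1⁺ : ∀ ξ t {x} → InF E x → x ∈ rspan ξ t 1
  rspan-1⁺ ξ t {x} x∈ = (λ _ → x) , (λ _ → x∈) , trans (+-identityʳ _) (*-identityʳ x)

  rspan-suc² : ∀ ξ t N {x} → x ∈ rspan ξ t (suc (suc N)) → ∃[ z ] ∃[ y ] (Span1ξ E ξ z × y ∈ rspan ξ t N × x ≡ z + t * y)
  rspan-suc² ξ t N {x} x∈ = step (Span-∷⁻ base (rvec E ξ t (suc (suc N))) x∈)
    where
    tailspan : Subspace
    tailspan = span base (λ i → rvec E ξ t (suc (suc N)) (suc (suc i)))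
    step′ : ∀ {f y} → InF E f → x ≡ f * 1# + y →
            ∃[ g ] ∃[ w ] (InF E g × w ∈ tailspan × y ≡ g * (ξ * 1#) + w) →
            ∃[ z ] ∃[ y ] (Span1ξ E ξ z × y ∈ rspan ξ t N × x ≡ z + t * y)
    step′ {f} f∈ refl (g , w , g∈ , w∈ , refl) = last (span-· base t (rvec E ξ t N) (span-cong base (rvec-suc-suc ξ t N) w∈))
      where
      last : w ∈ t · rspan ξ t N → _
      last (y , y∈ , refl) = f + g * ξ , y , (f , g , f∈ , g∈ , refl) , y∈ ,
        trans (cong₂ (λ a b → a + (g * b + t * y)) (*-identityʳ f) (*-identityʳ ξ)) (sym (+-assoc f (g * ξ) (t * y)))
    step : _ → _
    step (f , y , f∈ , y∈ , eq) = step′ f∈ eq (Span-∷⁻ base (rvec E ξ t (suc (suc N)) ∘ suc) y∈)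

  rspan-suc²⁺ : ∀ ξ t N {z y} → Span1ξ E ξ z → y ∈ rspan ξ t N → z + t * y ∈ rspan ξ t (suc (suc N))
  rspan-suc²⁺ ξ t N {y = y} (f , g , f∈ , g∈ , refl) y∈ = ∈-resp (rspan ξ t (suc (suc N)))
    (trans (cong₂ (λ a b → a + (g * b + t * y)) (*-identityʳ f) (*-identityʳ ξ)) (sym (+-assoc f (g * ξ) (t * y))))
    (Span-∷⁺ base (rvec E ξ t (suc (suc N))) f∈ (Span-∷⁺ base (rvec E ξ t (suc (suc N)) ∘ suc) g∈
      (span-cong base (λ i → sym (rvec-suc-suc ξ t N i)) (span-·⁻ base t (rvec E ξ t N) (y , y∈ , refl)))))

  module _ {ξ : K} (isB : IsFq2Basis E ξ) (t : K) where
    private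
      Q : Subfield
      Q = quad isB

    -- The entries t^i and ξ t^i with i < l merge into one coefficient from F_{q²}; the last power
    -- t^l has no partner and keeps its coefficient in F.
    rspan-odd⁻ : ∀ l → rspan ξ t (suc (l ℕ.* 2)) ⊆ poly Q t l ⊞ pow E t l · sub base
    rspan-odd⁻ zero    x∈ = 0# , _ , has0 (poly Q t 0) , (_ , rspan-1⁻ ξ t x∈ , sym (*-identityˡ _)) , sym (+-identityˡ _)
    rspan-odd⁻ (suc l) x∈ = step (rspan-suc² ξ t (suc (l ℕ.* 2)) x∈)
      where
      step : ∀ {x} → ∃[ z ] ∃[ y ] (Span1ξ E ξ z × y ∈ rspan ξ t (suc (l ℕ.* 2)) × x ≡ z + t * y) →
             x ∈ poly Q t (suc l) ⊞ pow E t (suc l) · sub base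
      step (z , y , z∈ , y∈ , refl) = last (rspan-odd⁻ l y∈)
        where
        last : y ∈ poly Q t l ⊞ pow E t l · sub base → z + t * y ∈ poly Q t (suc l) ⊞ pow E t (suc l) · sub base
        last (p , _ , p∈ , (f , f∈ , refl) , refl) = z + t * p , t * pow E t l * f , poly-suc⁺ Q t l z∈ p∈ , (f , f∈ , refl) ,
          solve 5 (λ z t p w f → z :+ t :* (p :+ w :* f) := z :+ t :* p :+ t :* w :* f) refl z t p (pow E t l) f

    rspan-odd⁺ : ∀ l → poly Q t l ⊞ pow E t l · sub base ⊆ rspan ξ t (suc (l ℕ.* 2))
    rspan-odd⁺ zero (p , _ , p∈ , (f , f∈ , refl) , refl) = ∈-resp (rspan ξ t 1)
      (sym (trans (cong₂ _+_ (poly-0 Q t p∈) (*-identityˡ f)) (+-identityˡ f))) (rspan-1⁺ ξ t f∈)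
    rspan-odd⁺ (suc l) (p , _ , p∈ , (f , f∈ , refl) , refl) = step (poly-suc⁻ Q t l p∈)
      where
      step : ∃[ z ] ∃[ y ] (Span1ξ E ξ z × y ∈ poly Q t l × p ≡ z + t * y) → p + t * pow E t l * f ∈ rspan ξ t (suc (suc l ℕ.* 2))
      step (z , y , z∈ , y∈ , refl) = ∈-resp (rspan ξ t (suc (suc l ℕ.* 2)))
        (solve 5 (λ z t p w f → z :+ t :* (p :+ w :* f) := z :+ t :* p :+ t :* w :* f) refl z t y (pow E t l) f)
        (rspan-suc²⁺ ξ t (suc (l ℕ.* 2)) z∈ (rspan-odd⁺ l (y , _ , y∈ , (f , f∈ , refl) , refl)))

  -- Classification of the spaces A

  record Geometric (A : Subspace) : Set where
    field
      t c   : K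
      t∉F   : ¬ InF E t
      c≢0   : c ≢ 0#
      A⊆    : A ⊆ c · poly base t (dim A)
      ⊆A    : c · poly base t (dim A) ⊆ A
      bound : ∀ {d} → DegreeOver E (InF E) t d → dim A ℕ.+ dim A ≤ suc d

  record QuadraticGeometric (A : Subspace) : Set where
    field
      half   : ℕ
      m-even : m ≡ 2 ℕ.* half
      l      : ℕ
      dim-A  : dim A ≡ suc (l ℕ.* 2)
      ξ t c  : K
      basis  : IsFq2Basis E ξ
      t∉     : ¬ Span1ξ E ξ t
      c≢0    : c ≢ 0#
      A⊆     : A ⊆ c · rspan ξ t (suc (l ℕ.* 2))
      ⊆A     : c · rspan ξ t (suc (l ℕ.* 2)) ⊆ A
      bound  : ∀ {d} → DegreeOver E (Span1ξ E ξ) t d → l ℕ.* 2 < d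

  ⊞-zeroˡ : ∀ {Z V} → (∀ {x} → x ∈ Z → x ≡ 0#) → Z ⊞ V ⊆ V
  ⊞-zeroˡ {Z} {V} z (u , v , u∈ , v∈ , refl) = ∈-resp V (sym (trans (cong (_+ v) (z u∈)) (+-identityˡ v))) v∈

  -- With B = c · poly and b = c (y + α t^l), where α ∈ F_{q²} is nonzero, the space A = B + F b is
  -- c α (poly + F t^l), which is a multiple of the span of rvec.
  module CorelessQuadratic {A B : Subspace} {b ξ t c : K} {l : ℕ} (full : Full A) (isB : IsFq2Basis E ξ)
      (A⊆ : A ⊆ B ⊞ b · sub base) (⊆A : B ⊞ b · sub base ⊆ A) (dimA : dim A ≡ suc (dim B)) (b∉B : ¬ b ∈ B)
      (t≢0 : t ≢ 0#) (t∉Q : ¬ Span1ξ E ξ t) (b∈ : b ∈ B ⊞ t · B) (c≢0 : c ≢ 0#)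
      (B⊆cP : B ⊆ c · poly (quad isB) t l) (cP⊆B : c · poly (quad isB) t l ⊆ B) (dimB″ : dim B ≡ l ℕ.* 2) where

    private
      Q : Subfield
      Q = quad isB
      shift : ∀ {v} → v ∈ c · poly Q t l → t * v ∈ c · poly Q t (suc l)
      shift (p , p∈ , refl) = t * p , poly-t· Q t l p∈ , solve 3 (λ t c p → t :* (c :* p) := c :* (t :* p)) refl t c p
      b∈cP : b ∈ c · poly Q t (suc l)
      b∈cP = ⊞-lub {B} {t · B} {c · poly Q t (suc l)} (λ p → ·-mono {c} {poly Q t l} {poly Q t (suc l)} (poly-⊆suc Q t l) (B⊆cP p))
        (λ { (v , v∈ , refl) → shift (B⊆cP v∈) }) b∈

      module Leading (y α : K) (y∈ : y ∈ poly Q t l) (α∈ : Span1ξ E ξ α) (b≡ : b ≡ c * (y + α * pow E t l)) where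
        w : K
        w = pow E t l
        α≢0 : α ≢ 0#
        α≢0 refl = b∉B (cP⊆B (y , y∈ , trans b≡ (cong (c *_) (trans (cong (y +_) (zeroˡ w)) (+-identityʳ y)))))
        target : Subspace
        target = poly Q t l ⊞ w · sub base
        to : ∀ {x} → x ∈ B ⊞ b · sub base → x ∈ (c * α) · target
        to (v , _ , v∈ , (f , f∈ , refl) , refl) = step (B⊆cP v∈)
          where
          open ≡-Reasoning
          step : v ∈ c · poly Q t l → v + b * f ∈ (c * α) · target
          step (p , p∈ , refl) = inv α * (p + f * y) + w * f ,
            (_ , _ , span-stable Q (powers E t l) (inv∈ Q α∈) (has+ (poly Q t l) p∈ (has* (poly Q t l) f∈ y∈)) , (f , f∈ , refl) , refl) , (begin
              c * p + b * f  ≡⟨ cong (λ z → c * p + z * f) b≡ ⟩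
              c * p + c * (y + α * w) * f  ≡⟨ solve 6 (λ c p y α w f → c :* p :+ c :* (y :+ α :* w) :* f := c :* (p :+ f :* y) :+ c :* α :* (w :* f)) refl c p y α w f ⟩
              c * (p + f * y) + c * α * (w * f)  ≡⟨ cong (λ z → c * z + c * α * (w * f)) (sym (*-inv-* α≢0 _)) ⟩
              c * (α * (inv α * (p + f * y))) + c * α * (w * f)  ≡⟨ solve 4 (λ c α u v → c :* (α :* u) :+ c :* α :* v := c :* α :* (u :+ v)) refl c α (inv α * (p + f * y)) (w * f) ⟩
              c * α * (inv α * (p + f * y) + w * f)  ∎)
        from : ∀ {x} → x ∈ (c * α) · target → x ∈ B ⊞ b · sub base
        from (_ , (p , _ , p∈ , (f , f∈ , refl) , refl) , refl) = c * (α * p - f * y) , b * f ,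
            cP⊆B (_ , has∸ (poly Q t l) (span-stable Q (powers E t l) α∈ p∈) (has* (poly Q t l) f∈ y∈) , refl) , (f , f∈ , refl) , (begin
              c * α * (p + w * f)  ≡⟨ solve 6 (λ c p y α w f → c :* α :* (p :+ w :* f) := c :* (α :* p :- f :* y) :+ c :* (y :+ α :* w) :* f) refl c p y α w f ⟩
              c * (α * p - f * y) + c * (y + α * w) * f  ≡⟨ cong (λ z → c * (α * p - f * y) + z * f) (sym b≡) ⟩
              c * (α * p - f * y) + b * f  ∎)
          where open ≡-Reasoning
        A⊆target : A ⊆ (c * α) · target
        A⊆target p = to (A⊆ p)
        A⊆poly : A ⊆ (c * α) · poly Q t (suc l)
        A⊆poly p = ·-mono {c * α} {target} {poly Q t (suc l)} (⊞-lub {poly Q t l} {w · sub base} {poly Q t (suc l)} (poly-⊆suc Q t l)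
          (λ { (f , f∈ , refl) → ∈-resp (poly Q t (suc l)) (*-comm f w) (has* (poly Q t (suc l)) f∈ (pow∈poly Q t l)) })) (A⊆target p)
        dimA′ : dim A ≡ suc (l ℕ.* 2)
        dimA′ = trans dimA (cong suc dimB″)
        result : QuadraticGeometric A
        result = record
          { half = proj₁ m-even ; m-even = trans (sym dim-whole) (trans (proj₂ m-even) (cong (ℕ._* proj₁ m-even) (dim-quad isB)))
          ; l = l ; dim-A = dimA′ ; ξ = ξ ; t = t ; c = c * α ; basis = isB ; t∉ = t∉Q ; c≢0 = *≢0 c≢0 α≢0
          ; A⊆ = λ p → ·-mono {c * α} {target} {rspan ξ t (suc (l ℕ.* 2))} (rspan-odd⁺ isB t l) (A⊆target p)
          ; ⊆A = λ p → ⊆A (from (·-mono {c * α} {rspan ξ t (suc (l ℕ.* 2))} {target} (rspan-odd⁻ isB t l) p))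
          -- Over F_{q²} the degree bound reads 2(2l + 1) ≤ 2d + 1, and parity sharpens it to 2l + 1
          -- ≤ d.
          ; bound = λ {d} deg → subst (_≤ d) (ℕₚ.+-comm (l ℕ.* 2) 1) (double-≤⇒< l d (subst₂ _≤_ (cong₂ ℕ._+_ dimA″ dimA″)
              (cong (λ z → d ℕ.* z ℕ.+ 1) (dim-quad isB))
              (degree-bound Q {t} {d} {A} t≢0 deg (*≢0 c≢0 α≢0) A⊆poly full (subst (1 ≤_) (sym dimA) (s≤s z≤n))))) }
          where
          m-even : ∃[ j ] dim whole ≡ dim (sub Q) ℕ.* j
          m-even = dim-stable Q whole (λ {f} {x} → whole-stable Q {f} {x})
          dimA″ : dim A ≡ l ℕ.* 2 ℕ.+ 1
          dimA″ = trans dimA′ (ℕₚ.+-comm 1 (l ℕ.* 2))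

    quadraticGeometric : QuadraticGeometric A
    quadraticGeometric = go b∈cP
      where
      go : b ∈ c · poly Q t (suc l) → QuadraticGeometric A
      go (z , z∈ , b≡) = last (poly-last⁻ Q t l z∈)
        where
        last : ∃[ y ] ∃[ α ] (y ∈ poly Q t l × Span1ξ E ξ α × z ≡ y + α * pow E t l) → QuadraticGeometric A
        last (y , α , y∈ , α∈ , eq) = Leading.result y α y∈ α∈ (trans b≡ (cong (c *_) eq))

  module QuadraticCore {A B : Subspace} {b : K} (full : Full A) (stB : dim (sub (Stab B)) ≡ 2)
      (A⊆ : A ⊆ B ⊞ b · sub base) (⊆A : B ⊞ b · sub base ⊆ A) (dimA : dim A ≡ suc (dim B)) (b∉B : ¬ b ∈ B)
      {t : K} (t≢0 : t ≢ 0#) (b∈ : b ∈ B ⊞ t · B) (dim-t : dim (B ⊞ t · B) ≡ dim B ℕ.+ 2) where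

    private
      L : Subfield
      L = Stab B

      generator : ∃[ ξ ] (ξ ∈ sub L × ¬ InF E ξ)
      generator = go (⊆? (sub L) (sub base))
        where
        go : (sub L ⊆ sub base) ⊎ (∃[ ξ ] (ξ ∈ sub L × ¬ InF E ξ)) → ∃[ ξ ] (ξ ∈ sub L × ¬ InF E ξ)
        go (inj₁ L⊆F) = contradiction (subst₂ _≤_ stB dim-base (dim-mono {sub L} {sub base} L⊆F)) (<⇒≱ ≤-refl)
        go (inj₂ p)   = p

      ξ : K
      ξ = proj₁ generator
      Q⊆L : ∀ {x} → Span1ξ E ξ x → x ∈ sub L
      Q⊆L (a , b′ , a∈ , b′∈ , refl) = has+ (sub L) (F⊆ L a∈) (mul L (F⊆ L b′∈) (proj₁ (proj₂ generator)))
      L⊆Q : ∀ {x} → x ∈ sub L → Span1ξ E ξ x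
      L⊆Q x∈ = convert (dim-equal {sub base ⊞ ξ · sub base} {sub L}
          (λ { (a , _ , a∈ , (g , g∈ , refl) , refl) → Q⊆L (a , g , a∈ , g∈ , cong (a +_) (*-comm ξ g)) })
          (≤-reflexive (trans stB (sym (dim-span1ξ (proj₂ (proj₂ generator)))))) x∈)
        where
        convert : ∀ {x} → x ∈ sub base ⊞ ξ · sub base → Span1ξ E ξ x
        convert (a , _ , a∈ , (g , g∈ , refl) , refl) = a , g , a∈ , g∈ , cong (a +_) (*-comm ξ g)
      isB : IsFq2Basis E ξ
      isB = proj₂ (proj₂ generator) , (λ x y x∈ y∈ → L⊆Q (mul L (Q⊆L x∈) (Q⊆L y∈))) , (λ x y x∈ eq → L⊆Q (invs L (Q⊆L x∈) eq))
      Q : Subfield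
      Q = quad isB
      stQ : Stable Q B
      stQ f∈ x∈ = Q⊆L f∈ _ x∈
      t∉Q : ¬ Span1ξ E ξ t
      t∉Q t∈ = contradiction (dim-mono {B ⊞ t · B} {B} (⊞-lub {B} {t · B} {B} (λ p → p) (λ { (v , v∈ , refl) → Q⊆L t∈ v v∈ })))
        (<⇒≱ (subst (dim B <_) (sym dim-t) (ℕₚ.m<m+n (dim B) (s≤s z≤n))))
      P : Progression Q t B
      P = progression Q {t} t≢0 (dim B) B ≤-refl stQ (trans dim-t (cong (dim B ℕ.+_) (sym (dim-quad isB))))
      open Progression P using () renaming
        (core to C; start to c; len to l; len-1 to l-1; stable to stC; t-stable to tC; A⊆ to B⊆; ⊆A to ⊆B; dim-A to dimB; core⊆A to C⊆B)
      dimB′ : dim B ≡ dim C ℕ.+ l ℕ.* 2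
      dimB′ = trans dimB (cong (λ z → dim C ℕ.+ l ℕ.* z) (dim-quad isB))
      c∉C : ¬ c ∈ C
      c∉C = start∉core Q P
      B⊆A : B ⊆ A
      B⊆A p = ⊆A (⊞-injˡ B (b · sub base) p)

      -- The stabilizer M of a nonzero core C contains Q and t, so it is larger than Q and has
      -- dimension at least 4. As b lies in B + tB, all of A lies between C and C + cM. The
      -- difference dim A - dim C = 2l + 1 is odd and dim M is even, so the inequality between them
      -- is strict, as `no-large-stabilizer` demands.
      coreless : ∀ {x} → x ∈ C → x ≢ 0# → ⊥
      coreless {x} x∈ x≢0 = no-large-stabilizer M {C} {A} {A″} {l ℕ.* 2 ℕ.+ 1} (Stab-stable C) stA″ (B⊆A ∘ C⊆B) A⊆A″
          (dim-line M {C} (Stab-stable C) c∉C) dimAC full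
          (≤-trans (stable-dim≤ M {C} (Stab-stable C) x∈ x≢0) (dim-mono {C} {A} (B⊆A ∘ C⊆B)))
          4≤D (ℕₚ.m≤n+m 1 (l ℕ.* 2)) κ<D
        where
        M : Subfield
        M = Stab C
        A″ : Subspace
        A″ = C ⊞ c · sub M
        stA″ : Stable M A″
        stA″ = ⊞-stable {M} {C} {c · sub M} (Stab-stable C) (·-stable {M} {c} {sub M} (self-stable M))
        B⊆A″ : B ⊆ A″
        B⊆A″ p = widen (B⊆ p)
          where
          widen : ∀ {y} → y ∈ C ⊞ c · poly Q t l → y ∈ A″
          widen (u , w , u∈ , (z , z∈ , eq) , eq′) = u , w , u∈ , (z , poly⊆Stab Q {t} {C} l stC tC z∈ , eq) , eq′
        b∈A″ : b ∈ A″
        b∈A″ = ⊞-lub {B} {t · B} {A″} B⊆A″ (λ { (v , v∈ , refl) → stA″ tC (B⊆A″ v∈) }) b∈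
        A⊆A″ : A ⊆ A″
        A⊆A″ p = ⊞-lub {B} {b · sub base} {A″} B⊆A″ (λ { (f , f∈ , refl) → ∈-resp A″ (*-comm f b) (has* A″ f∈ b∈A″) }) (A⊆ p)
        dimAC : dim A ≡ dim C ℕ.+ (l ℕ.* 2 ℕ.+ 1)
        dimAC = trans dimA (trans (cong suc dimB′) (trans (ℕₚ.+-comm 1 _) (ℕₚ.+-assoc (dim C) (l ℕ.* 2) 1)))
        Q⊆M : sub Q ⊆ sub M
        Q⊆M f∈ v v∈ = stC f∈ v∈
        stM : Stable Q (sub M)
        stM f∈ x∈ = mul M (Q⊆M f∈) x∈
        Q<M : dim (sub Q) < dim (sub M)
        Q<M = ℕₚ.≰⇒> λ le → t∉Q (dim-equal {sub Q} {sub M} Q⊆M le tC)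
        4≤D : 4 ≤ dim (sub M)
        4≤D = subst (_≤ dim (sub M)) (cong₂ ℕ._+_ (dim-quad isB) (dim-quad isB)) (gap Q {sub Q} {sub M} (self-stable Q) stM Q<M)
        κ≤D : l ℕ.* 2 ℕ.+ 1 ≤ dim (sub M)
        κ≤D = ℕₚ.+-cancelˡ-≤ (dim C) _ _ (subst₂ _≤_ dimAC (dim-line M {C} (Stab-stable C) c∉C) (dim-mono {A} {A″} A⊆A″))
        κ≢D : l ℕ.* 2 ℕ.+ 1 ≢ dim (sub M)
        κ≢D eq = odd≢even l (proj₁ even) (trans eq (trans (proj₂ even) (cong (ℕ._* proj₁ even) (dim-quad isB))))
          where
          even : ∃[ j ] dim (sub M) ≡ dim (sub Q) ℕ.* j
          even = dim-stable Q (sub M) stM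
        κ<D : l ℕ.* 2 ℕ.+ 1 < dim (sub M)
        κ<D = ℕₚ.≤∧≢⇒< κ≤D κ≢D

      C≡0 : ∀ {x} → x ∈ C → x ≡ 0#
      C≡0 {x} x∈ = decidable-stable (x ≟K 0#) (coreless x∈)
      B⊆cP : B ⊆ c · poly Q t l
      B⊆cP p = ⊞-zeroˡ {C} {c · poly Q t l} C≡0 (B⊆ p)
      cP⊆B : c · poly Q t l ⊆ B
      cP⊆B p = ⊆B (⊞-injʳ C (c · poly Q t l) p)
      dimB″ : dim B ≡ l ℕ.* 2
      dimB″ = trans dimB′ (cong (ℕ._+ l ℕ.* 2) (trans (dim-resp {C} {zeroₛ} C≡0 (λ { refl → has0 C })) dim-zero))
      c≢0 : c ≢ 0#
      c≢0 eq = c∉C (∈-resp C (sym eq) (has0 C))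

    quadraticGeometric : QuadraticGeometric A
    quadraticGeometric = CorelessQuadratic.quadraticGeometric {A} {B} {b} {ξ} {t} {c} {l} full isB A⊆ ⊆A dimA b∉B
      t≢0 t∉Q b∈ c≢0 B⊆cP cP⊆B dimB″

  module NonzeroCore {A : Subspace} {t : K} (full : Full A) (t≢0 : t ≢ 0#) (t∉ : ¬ t ∈ sub (Stab A))
      (P : Progression base t A) {x₀ : K} (x₀∈ : x₀ ∈ Progression.core P) (x₀≢0 : x₀ ≢ 0#) where
    private
      open Progression P renaming (core to B; start to b; len to k)
      L : Subfield
      L = Stab B
      D : ℕ
      D = dim (sub L)
      stL : Stable L B
      stL = Stab-stable B
      A′ : Subspace
      A′ = B ⊞ b · sub L
      stA′ : Stable L A′
      stA′ = ⊞-stable {L} {B} {b · sub L} stL (·-stable {L} {b} {sub L} (self-stable L))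
      A⊆A′ : A ⊆ A′
      A⊆A′ p = widen (A⊆ p)
        where
        widen : ∀ {y} → y ∈ B ⊞ b · poly base t k → y ∈ A′
        widen (u , w , u∈ , (z , z∈ , eq) , eq′) = u , w , u∈ , (z , poly⊆Stab base {t} {B} k stable t-stable z∈ , eq) , eq′
      dimA : dim A ≡ dim B ℕ.+ k
      dimA = trans dim-A (cong (dim B ℕ.+_) (trans (cong (k ℕ.*_) dim-base) (ℕₚ.*-identityʳ k)))
      b∉B : ¬ b ∈ B
      b∉B = start∉core base P
      dimA′ : dim A′ ≡ dim B ℕ.+ D
      dimA′ = dim-line L {B} stL b∉B
      k≤D : k ≤ D
      k≤D = ℕₚ.+-cancelˡ-≤ (dim B) _ _ (subst₂ _≤_ dimA dimA′ (dim-mono {A} {A′} A⊆A′))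
      -- Equality would give A = A′, which is L-stable and so stable under t.
      k<D : k < D
      k<D = ℕₚ.≤∧≢⇒< k≤D λ eq → t∉ λ v v∈ → dim-equal {A} {A′} A⊆A′
        (≤-reflexive (trans dimA′ (trans (cong (dim B ℕ.+_) (sym eq)) (sym dimA)))) (stA′ t-stable (A⊆A′ v∈))
      2≤D : 2 ≤ D
      2≤D = ≤-trans (s≤s (s≤s z≤n)) k<D
      D≤B : D ≤ dim B
      D≤B = stable-dim≤ L {B} stL x₀∈ x₀≢0
      B≤A : dim B ≤ dim A
      B≤A = dim-mono {B} {A} core⊆A
      D<4 : ¬ 4 ≤ D
      D<4 4≤D = no-large-stabilizer L {B} {A} {A′} {k} stL stA′ core⊆A A⊆A′ dimA′ dimA full (≤-trans D≤B B≤A) 4≤D (s≤s z≤n) k<D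
      tri : ∀ {s} → s ≢ 0# → Trichotomy (dim (B ∩ s · B)) (dim (A′ ∩ s · A′)) (dim (A ∩ s · A)) D k
      tri s≢0 = Sandwich.trichotomy L {B} {A} {A′} {k} stL stA′ core⊆A A⊆A′ dimA′ dimA s≢0
      stBs : ∀ {s} → Stable L (B ∩ s · B)
      stBs {s} = ∩-stable {L} {B} {s · B} stL (·-stable {L} {s} {B} stL)
      gapB : ∀ s → dim (B ∩ s · B) < dim B → dim (B ∩ s · B) ℕ.+ D ≤ dim B
      gapB s = gap L {B ∩ s · B} {B} (stBs {s}) stL
      gapB₂ : ∀ s → dim (B ∩ s · B) ℕ.+ D < dim B → dim (B ∩ s · B) ℕ.+ (D ℕ.+ D) ≤ dim B
      gapB₂ s = gap₂ L {B ∩ s · B} {B} (stBs {s}) stL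

      fixes : ∀ {V s} → s ≢ 0# → dim V ≤ dim (V ∩ s · V) → s ∈ sub (Stab V)
      fixes {V} {s} s≢0 le = stab-dim {V} s≢0 (λ p → proj₂ (dim-equal {V ∩ s · V} {V} proj₁ le p))

      -- A multiplier s for the value dim B would stabilize B and hence A′. Then A′ ∩ sA′ would be
      -- all of A′, although its dimension is forced to be dim B.
      no-3-2 : D ≡ 3 → k ≡ 2 → ⊥
      no-3-2 D≡3 k≡2 = go (full (dim B) B≤A)
        where
        go : ∃[ s ] (s ≢ 0# × dim (A ∩ s · A) ≡ dim B) → ⊥
        go (s , s≢0 , r≡) = contradiction A′≤ (<⇒≱ (subst (dim B <_) (sym dimA′) (ℕₚ.m<m+n (dim B) (dim-sub>0 L))))
          where
          res : dim (A′ ∩ s · A′) ≡ dim (B ∩ s · B) × dim (B ∩ s · B) ≡ dim B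
          res = arith-3-2 D≡3 k≡2 r≡ (gapB s) (gapB₂ s) (tri s≢0)
          s∈L : s ∈ sub L
          s∈L = fixes {B} s≢0 (≤-reflexive (sym (proj₂ res)))
          A′≤ : dim A′ ≤ dim B
          A′≤ = subst (dim A′ ≤_) (trans (proj₁ res) (proj₂ res))
            (dim-mono {A′} {A′ ∩ s · A′} (λ p → p , stab-⊆ {A′} s≢0 (λ v v∈ → stA′ s∈L v∈) p))

      -- The value dim B - 1 forces a multiplier that stabilizes A′ but not B, so the stabilizer M
      -- of A′ is larger than L. The value dim B - 2 then yields an M-subspace of A′ of codimension
      -- D, which is positive and less than dim M.
      no-3-1 : D ≡ 3 → k ≡ 1 → ⊥
      no-3-1 D≡3 k≡1 = go (pred-of {dim B} (≤-trans (dim-sub>0 L) D≤B))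
        where
        go : ∃[ r ] suc r ≡ dim B → ⊥
        go (r , sr≡) = go₁ (pred-of {r} (≤-pred (subst (2 ≤_) (sym sr≡) (≤-trans 2≤D D≤B))))
            (full r (≤-trans (ℕₚ.n≤1+n r) (≤-trans (≤-reflexive sr≡) B≤A)))
          where
          go₁ : ∃[ r′ ] suc r′ ≡ r → ∃[ s ] (s ≢ 0# × dim (A ∩ s · A) ≡ r) → ⊥
          go₁ (r′ , sr′≡) (s , s≢0 , r≡) = go₂ (full r′ (≤-trans (ℕₚ.n≤1+n r′) (≤-trans (≤-reflexive sr′≡) (≤-trans (ℕₚ.n≤1+n r) (≤-trans (≤-reflexive sr≡) B≤A)))))
            where
            res : dim (A′ ∩ s · A′) ≡ dim B ℕ.+ D × dim (B ∩ s · B) < dim B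
            res = arith-3-1 D≡3 k≡1 (trans (cong suc r≡) sr≡) (gapB s) (tri s≢0)
            M : Subfield
            M = Stab A′
            s∈M : s ∈ sub M
            s∈M = fixes {A′} s≢0 (≤-reflexive (trans dimA′ (sym (proj₁ res))))
            s∉L : ¬ s ∈ sub L
            s∉L s∈ = contradiction (dim-mono {B} {B ∩ s · B} (λ p → p , stab-⊆ {B} s≢0 s∈ p)) (<⇒≱ (proj₂ res))
            D<M : D < dim (sub M)
            D<M = ℕₚ.≰⇒> λ le → s∉L (dim-equal {sub L} {sub M} (λ f∈ v v∈ → stA′ f∈ v∈) le s∈M)
            go₂ : ∃[ s′ ] (s′ ≢ 0# × dim (A ∩ s′ · A) ≡ r′) → ⊥
            go₂ (s′ , s′≢0 , r′≡) = <⇒≱ D<M (ℕₚ.+-cancelˡ-≤ (dim B) _ _ (subst₂ _≤_ (cong (ℕ._+ dim (sub M)) N≡) dimA′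
                (gap M {A′ ∩ s′ · A′} {A′} (∩-stable {M} {A′} {s′ · A′} (Stab-stable A′) (·-stable {M} {s′} {A′} (Stab-stable A′))) (Stab-stable A′)
                  (subst₂ _<_ (sym N≡) (sym dimA′) (ℕₚ.m<m+n (dim B) (dim-sub>0 L))))))
              where
              N≡ : dim (A′ ∩ s′ · A′) ≡ dim B
              N≡ = arith-3-1′ D≡3 k≡1 (trans (cong (λ z → suc (suc z)) r′≡) (trans (cong suc sr′≡) sr≡)) (gapB s′) (gapB₂ s′) (tri s′≢0)

      -- The value dim B - 1 forces dim (B ∩ sB) = dim B - 2 and leaves a vector of A ∩ sA outside B
      -- ∩ sB. Expanding it in B + Fb and in s(B + Fb) gives the relation for `align`; the
      -- coefficients of b do not both vanish, as the vector would then lie in B ∩ sB.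
      quadratic : D ≡ 2 → QuadraticGeometric A
      quadratic D≡2 = go (pred-of {dim B} (≤-trans (dim-sub>0 L) D≤B))
        where
        len-1≡0 : len-1 ≡ 0
        len-1≡0 = only-1 D≡2 k<D
        k≡1 : k ≡ 1
        k≡1 = cong suc len-1≡0
        A⊆F : A ⊆ B ⊞ b · sub base
        A⊆F {x} p = widen (subst (λ j → x ∈ B ⊞ b · poly base t j) k≡1 (A⊆ p))
          where
          widen : ∀ {y} → y ∈ B ⊞ b · poly base t 1 → y ∈ B ⊞ b · sub base
          widen (u , w , u∈ , (z , z∈ , eq) , eq′) = u , w , u∈ , (z , poly-1 base t z∈ , eq) , eq′
        F⊆A : B ⊞ b · sub base ⊆ A
        F⊆A (u , w , u∈ , (z , z∈ , eq) , eq′) = ⊆A (u , w , u∈ , (z , poly-const base t len-1 z∈ , eq) , eq′)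
        go : ∃[ r ] suc r ≡ dim B → QuadraticGeometric A
        go (r , sr≡) = go₁ (full r (≤-trans (ℕₚ.n≤1+n r) (≤-trans (≤-reflexive sr≡) B≤A)))
          where
          go₁ : ∃[ s ] (s ≢ 0# × dim (A ∩ s · A) ≡ r) → QuadraticGeometric A
          go₁ (s , s≢0 , r≡) = go₂ (⊆? (A ∩ s · A) (B ∩ s · B))
            where
            e : ℕ
            e = dim (B ∩ s · B)
            res : e ℕ.+ 2 ≡ dim B × dim (A ∩ s · A) ≡ suc e
            res = arith-2-1 D≡2 k≡1 (trans (cong suc r≡) sr≡) (gapB s) (gapB₂ s) (tri s≢0)
            dim-s : dim (B ⊞ s · B) ≡ dim B ℕ.+ 2
            dim-s = ℕₚ.+-cancelˡ-≡ e _ _ (begin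
              e ℕ.+ dim (B ⊞ s · B)  ≡⟨ dim-mod B (s · B) ⟩
              dim B ℕ.+ dim (s · B)  ≡⟨ cong (dim B ℕ.+_) (trans (dim-· B s≢0) (sym (proj₁ res))) ⟩
              dim B ℕ.+ (e ℕ.+ 2)  ≡⟨ swap-+ (dim B) e 2 ⟩
              e ℕ.+ (dim B ℕ.+ 2)  ∎)
              where open ≡-Reasoning
            s∉F : ¬ InF E s
            s∉F s∈ = contradiction (dim-mono {B} {B ∩ s · B} (λ p → p , stab-⊆ {B} s≢0 (λ v → has* B s∈) p))
              (<⇒≱ (subst (e <_) (proj₁ res) (ℕₚ.m<m+n e (s≤s z≤n))))
            go₂ : (A ∩ s · A ⊆ B ∩ s · B) ⊎ (∃[ x ] (x ∈ A ∩ s · A × ¬ x ∈ B ∩ s · B)) → QuadraticGeometric A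
            go₂ (inj₁ ⊆B) = contradiction (subst (_≤ e) (proj₂ res) (dim-mono {A ∩ s · A} {B ∩ s · B} ⊆B)) (<⇒≱ ≤-refl)
            go₂ (inj₂ (x , (x∈A , y , y∈A , x≡sy) , x∉)) = go₃ (A⊆F x∈A) (A⊆F y∈A)
              where
              go₃ : x ∈ B ⊞ b · sub base → y ∈ B ⊞ b · sub base → QuadraticGeometric A
              go₃ (b₁ , _ , b₁∈ , (f₁ , f₁∈ , refl) , x≡) (b₂ , _ , b₂∈ , (f₂ , f₂∈ , refl) , y≡) =
                  finish (align {B} {b} {s} s≢0 s∉F f₁∈ f₂∈ b₁∈ b₂∈ (trans (sym x≡) (trans x≡sy (cong (s *_) y≡))) notBoth)
                where
                drop : ∀ {u f} → f ≡ 0# → u + b * f ≡ u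
                drop {u} f≡0 = trans (cong (u +_) (trans (cong (b *_) f≡0) (zeroʳ b))) (+-identityʳ u)
                notBoth : ¬ (f₁ ≡ 0# × f₂ ≡ 0#)
                notBoth (f₁≡0 , f₂≡0) = x∉ (∈-resp B (sym (trans x≡ (drop f₁≡0))) b₁∈ ,
                  b₂ , b₂∈ , trans x≡sy (cong (s *_) (trans y≡ (drop f₂≡0))))
                finish : ∃[ t ] (t ≢ 0# × b ∈ B ⊞ t · B × dim (B ⊞ t · B) ≡ dim (B ⊞ s · B)) → QuadraticGeometric A
                finish (u , u≢0 , b∈ , eq) = QuadraticCore.quadraticGeometric {A} {B} {b} full D≡2 A⊆F F⊆A
                  (trans dimA (trans (cong (dim B ℕ.+_) k≡1) (ℕₚ.+-comm (dim B) 1))) b∉B u≢0 b∈ (trans eq dim-s)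

    nonzeroCore : QuadraticGeometric A
    nonzeroCore = go (between-2-3 2≤D D<4)
      where
      go₃ : D ≡ 3 → k ≡ 2 ⊎ k ≡ 1 → ⊥
      go₃ D≡3 (inj₁ eq) = no-3-2 D≡3 eq
      go₃ D≡3 (inj₂ eq) = no-3-1 D≡3 eq
      go : D ≡ 2 ⊎ D ≡ 3 → QuadraticGeometric A
      go (inj₁ D≡2) = quadratic D≡2
      go (inj₂ D≡3) = ⊥-elim (go₃ D≡3 (between-1-2 D≡3 k<D))

  -- A multiplier t for the value dim A - 1 satisfies dim (A + tA) = dim A + 1, which is the
  -- hypothesis of `progression` over F, and it does not stabilize A. The two outcomes correspond to
  -- a zero and a nonzero core.
  classify : ∀ {A} → Full A → 1 ≤ dim A → Geometric A ⊎ QuadraticGeometric A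
  classify {A} full 1≤ = go (pred-of 1≤)
    where
    go : ∃[ a ] suc a ≡ dim A → Geometric A ⊎ QuadraticGeometric A
    go (a , sa≡) = go₁ (full a (≤-trans (ℕₚ.n≤1+n a) (≤-reflexive sa≡)))
      where
      go₁ : ∃[ t ] (t ≢ 0# × dim (A ∩ t · A) ≡ a) → Geometric A ⊎ QuadraticGeometric A
      go₁ (t , t≢0 , a≡) = go₂ (nonzero-member? core)
        where
        dim+ : dim (A ⊞ t · A) ≡ dim A ℕ.+ dim (sub base)
        dim+ = ℕₚ.+-cancelˡ-≡ a _ _ (begin
          a ℕ.+ dim (A ⊞ t · A)  ≡⟨ cong (ℕ._+ dim (A ⊞ t · A)) (sym a≡) ⟩
          dim (A ∩ t · A) ℕ.+ dim (A ⊞ t · A)  ≡⟨ dim-mod A (t · A) ⟩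
          dim A ℕ.+ dim (t · A)  ≡⟨ cong (dim A ℕ.+_) (trans (dim-· A t≢0) (trans (sym sa≡) (ℕₚ.+-comm 1 a))) ⟩
          dim A ℕ.+ (a ℕ.+ 1)  ≡⟨ swap-+ (dim A) a 1 ⟩
          a ℕ.+ (dim A ℕ.+ 1)  ≡⟨ cong (λ z → a ℕ.+ (dim A ℕ.+ z)) (sym dim-base) ⟩
          a ℕ.+ (dim A ℕ.+ dim (sub base))  ∎)
          where open ≡-Reasoning
        t∉ : ¬ t ∈ sub (Stab A)
        t∉ t∈ = contradiction (dim-mono {A} {A ∩ t · A} (λ p → p , stab-⊆ {A} t≢0 t∈ p))
          (<⇒≱ (subst₂ _<_ (sym a≡) sa≡ ≤-refl))
        P : Progression base t A
        P = progression base {t} t≢0 (dim A) A ≤-refl (base-stable A) dim+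
        open Progression P
        go₂ : Dec (∃[ x ] (x ∈ core × x ≢ 0#)) → Geometric A ⊎ QuadraticGeometric A
        go₂ (yes (x , x∈ , x≢0)) = inj₂ (NonzeroCore.nonzeroCore {A} full t≢0 t∉ P x∈ x≢0)
        go₂ (no none) = inj₁ record
          { t = t ; c = start ; t∉F = λ t∈ → t∉ (λ v → has* A t∈) ; c≢0 = c≢0
          ; A⊆ = λ {x} p → subst (λ j → x ∈ start · poly base t j) len≡ (A⊆P p)
          ; ⊆A = λ {x} p → ⊆A (⊞-injʳ core (start · poly base t len) (subst (λ j → x ∈ start · poly base t j) (sym len≡) p))
          ; bound = λ {d} deg → subst (dim A ℕ.+ dim A ≤_) (trans (cong (λ z → d ℕ.* z ℕ.+ 1) dim-base)
              (trans (cong (ℕ._+ 1) (ℕₚ.*-identityʳ d)) (ℕₚ.+-comm d 1))) (degree-bound base {t} {d} {A} t≢0 deg c≢0 A⊆P full 1≤) }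
          where
          core≡0 : ∀ {x} → x ∈ core → x ≡ 0#
          core≡0 {x} x∈ = decidable-stable (x ≟K 0#) (λ x≢0 → none (x , x∈ , x≢0))
          A⊆P : A ⊆ start · poly base t len
          A⊆P p = ⊞-zeroˡ {core} {start · poly base t len} core≡0 (A⊆ p)
          c≢0 : start ≢ 0#
          c≢0 eq = start∉core base P (∈-resp core (sym eq) (has0 core))
          len≡ : len ≡ dim A
          len≡ = sym (trans dim-A (trans (cong₂ ℕ._+_ (trans (dim-resp {core} {zeroₛ} core≡0 (λ { refl → has0 core })) dim-zero) (cong (len ℕ.*_) dim-base)) (ℕₚ.*-identityʳ len)))

  -- Monic polynomials of degree n, given by their n lower coefficients

  eval : ∀ {n} → Vec K n → K → K
  eval []      x = 1#
  eval (c ∷ p) x = c + x * eval p x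

  addMul : ∀ {n} → Vec K (suc n) → K → Vec K n → Vec K (suc n)
  addMul (c ∷ [])      a []      = (c + a) ∷ []
  addMul (c ∷ c′ ∷ p)  a (d ∷ r) = (c + a * d) ∷ addMul (c′ ∷ p) a r

  eval-addMul : ∀ {n} (p : Vec K (suc n)) a r x → eval (addMul p a r) x ≡ eval p x + a * eval r x
  eval-addMul (c ∷ [])     a []      x = trans (solve 3 (λ c a y → c :+ a :+ y := c :+ y :+ a) refl c a (x * 1#))
    (cong (c + x * 1# +_) (sym (*-identityʳ a)))
  eval-addMul (c ∷ c′ ∷ p) a (d ∷ r) x = trans (cong (λ z → c + a * d + x * z) (eval-addMul (c′ ∷ p) a r x))
    (solve 6 (λ c a d x y z → c :+ a :* d :+ x :* (y :+ a :* z) := c :+ x :* y :+ a :* (d :+ x :* z)) refl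
      c a d x (eval (c′ ∷ p) x) (eval r x))

  -- Synthetic division by x - a. The quotient is again monic, so its leading coefficient can remain
  -- implicit.
  quotientBy : ∀ {n} → K → Vec K (suc n) → Vec K n
  quotientBy {zero}  a (c ∷ p) = []
  quotientBy {suc n} a (c ∷ p) = addMul p a (quotientBy a p)

  eval-quotientBy : ∀ {n} a (p : Vec K (suc n)) x → eval p x ≡ (x - a) * eval (quotientBy a p) x + eval p a
  eval-quotientBy {zero} a (c ∷ []) x = solve 4 (λ c x a o → c :+ x :* o := (x :- a) :* o :+ (c :+ a :* o)) refl c x a 1#
  eval-quotientBy {suc n} a (c ∷ p) x = begin
    c + x * eval p x  ≡⟨ solve 4 (λ c x a y → c :+ x :* y := (x :- a) :* y :+ (c :+ a :* y)) refl c x a (eval p x) ⟩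
    (x - a) * eval p x + (c + a * eval p x)  ≡⟨ cong (λ z → (x - a) * eval p x + (c + a * z)) (eval-quotientBy a p x) ⟩
    (x - a) * eval p x + (c + a * ((x - a) * r + eval p a)) ≡⟨ solve 6 (λ c x a y r z → (x :- a) :* y :+ (c :+ a :* ((x :- a) :* r :+ z)) := (x :- a) :* (y :+ a :* r) :+ (c :+ a :* z)) refl c x a (eval p x) r (eval p a) ⟩
    (x - a) * (eval p x + a * r) + (c + a * eval p a)  ≡⟨ cong (λ z → (x - a) * z + (c + a * eval p a)) (sym (eval-addMul p a (quotientBy a p) x)) ⟩
    (x - a) * eval (addMul p a (quotientBy a p)) x + (c + a * eval p a) ∎
    where
    open ≡-Reasoning
    r : K
    r = eval (quotientBy a p) x

  -- Bounding duplicate-free lists lets such bounds add up over unions and apply to the list of all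
  -- elements of K.
  AtMost : (K → Set) → ℕ → Set
  AtMost P n = ∀ xs → Unique xs → All P xs → length xs ≤ n

  roots-bound : ∀ {n} (p : Vec K n) → AtMost (λ x → eval p x ≡ 0#) n
  roots-bound []      []       _ _       = z≤n
  roots-bound []      (x ∷ xs) _ (r ∷ _) = contradiction (sym r) 0≢1
  roots-bound (c ∷ p) []       _ _       = z≤n
  roots-bound (c ∷ p) (a ∷ xs) (a∉ ∷ uniq) (r ∷ rs) = s≤s (roots-bound (quotientBy a (c ∷ p)) xs uniq (others a∉ rs))
    where
    other : ∀ {x} → a ≢ x → eval (c ∷ p) x ≡ 0# → eval (quotientBy a (c ∷ p)) x ≡ 0#
    other {x} a≢x rx = integral (begin
      (x - a) * eval (quotientBy a (c ∷ p)) x  ≡⟨ sym (+-identityʳ _) ⟩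
      (x - a) * eval (quotientBy a (c ∷ p)) x + 0#  ≡⟨ cong (_+_ _) (sym r) ⟩
      (x - a) * eval (quotientBy a (c ∷ p)) x + eval (c ∷ p) a  ≡⟨ sym (eval-quotientBy a (c ∷ p) x) ⟩
      eval (c ∷ p) x  ≡⟨ rx ⟩
      0#  ∎) (λ eq → a≢x (sym (x-y≡0⇒x≡y eq)))
      where open ≡-Reasoning
    others : ∀ {xs} → All (a ≢_) xs → All (λ x → eval (c ∷ p) x ≡ 0#) xs → All (λ x → eval (quotientBy a (c ∷ p)) x ≡ 0#) xs
    others []         []       = []
    others (a≢ ∷ a≢s) (r ∷ rs) = other a≢ r ∷ others a≢s rs

  eval-replicate-0 : ∀ n x → eval (replicate n 0#) x ≡ pow E x n
  eval-replicate-0 zero    x = refl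
  eval-replicate-0 (suc n) x = trans (+-identityˡ _) (cong (x *_) (eval-replicate-0 n x))

  fixed-bound : ∀ n → AtMost (λ x → pow E x (suc (suc n)) ≡ x) (suc (suc n))
  -- With the implicit leading 1, the coefficients 0, -1, 0, ..., 0 describe the polynomial x^(n+2)
  -- - x.
  fixed-bound n xs uniq all = roots-bound (0# ∷ (- 1#) ∷ replicate n 0#) xs uniq (All.map root all)
    where
    root : ∀ {x} → pow E x (suc (suc n)) ≡ x → eval (0# ∷ (- 1#) ∷ replicate n 0#) x ≡ 0#
    root {x} fx = begin
      0# + x * (- 1# + x * eval (replicate n 0#) x)  ≡⟨ +-identityˡ _ ⟩
      x * (- 1# + x * eval (replicate n 0#) x)  ≡⟨ cong (λ z → x * (- 1# + x * z)) (eval-replicate-0 n x) ⟩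
      x * (- 1# + x * pow E x n)  ≡⟨ solve 3 (λ x o y → x :* (:- o :+ x :* y) := x :* (x :* y) :- x :* o) refl x 1# (pow E x n) ⟩
      pow E x (suc (suc n)) - x * 1#  ≡⟨ cong₂ _-_ fx (*-identityʳ x) ⟩
      x - x  ≡⟨ -‿inverseʳ x ⟩
      0#  ∎
      where open ≡-Reasoning

  AtMost-∪ : ∀ {P Q R : K → Set} {a b} → (∀ x → Dec (P x)) → (∀ x → R x → P x ⊎ Q x) →
             AtMost P a → AtMost Q b → AtMost R (a ℕ.+ b)
  AtMost-∪ {P} {Q} {R} {a} {b} P? split pa qb xs uniq all = subst (_≤ a ℕ.+ b) (sym (lengths xs))
    (ℕₚ.+-mono-≤ (pa _ (Uniqueₚ.filter⁺ P? uniq) (Allₚ.all-filter P? xs))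
                 (qb _ (Uniqueₚ.filter⁺ (¬? ∘ P?) uniq) (rest xs all)))
    where
    lengths : ∀ xs → length xs ≡ length (filter P? xs) ℕ.+ length (filter (¬? ∘ P?) xs)
    lengths []       = refl
    lengths (x ∷ xs) with P? x
    ... | yes _ = cong suc (lengths xs)
    ... | no  _ = trans (cong suc (lengths xs)) (sym (ℕₚ.+-suc _ _))
    rest : ∀ xs → All R xs → All Q (filter (¬? ∘ P?) xs)
    rest []       []       = []
    rest (x ∷ xs) (r ∷ rs) with P? x
    ... | yes _ = rest xs rs
    ... | no ¬p = [ (λ p → contradiction p ¬p) , (λ qx → qx) ]′ (split x r) ∷ rest xs rs

  -- Lagrange's theorem for the multiplicative group of a subfield

  private
    module Π = Algebra.Properties.CommutativeMonoid.Sum *-commutativeMonoid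

    Π≢0 : ∀ {n} (f : Fin n → K) → (∀ i → f i ≢ 0#) → Π.sum f ≢ 0#
    Π≢0 {zero}  f p eq = 0≢1 (sym eq)
    Π≢0 {suc n} f p = *≢0 (p zero) (Π≢0 (f ∘ suc) (p ∘ suc))

    Π-const : ∀ {n} x (h : Fin n → K) → (∀ i → h i ≡ x) → Π.sum h ≡ pow E x n
    Π-const {zero}  x h eq = refl
    Π-const {suc n} x h eq = cong₂ _*_ (eq zero) (Π-const x (h ∘ suc) (eq ∘ suc))

    Π-special : ∀ {n} x (h : Fin n → K) i₀ → h i₀ ≡ 1# → (∀ i → i ≢ i₀ → h i ≡ x) → x * Π.sum h ≡ pow E x n
    Π-special x h zero h₀ eq = cong (x *_) (trans (cong₂ _*_ h₀ (Π-const x (h ∘ suc) (λ i → eq (suc i) λ ()))) (*-identityˡ _))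
    Π-special x h (suc i₀) h₀ eq = trans (cong (λ z → x * (z * Π.sum (h ∘ suc))) (eq zero λ ()))
      (cong (x *_) (Π-special x (h ∘ suc) i₀ h₀ (λ i i≢ → eq (suc i) (i≢ ∘ Finₚ.suc-injective))))

  -- Multiplication by x permutes M. Comparing the product of the nonzero elements before and after
  -- gives x^(N-1) = 1.
  frobenius-fixes : ∀ M {N x} → Card (sub M) N → x ∈ sub M → x ≢ 0# → pow E x N ≡ x
  frobenius-fixes M {N} {x} card x∈ x≢0 = begin
    pow E x N  ≡⟨ sym (Π-special x h i₀ (trans (cong h′ i₀≡) h′-0) h-≢) ⟩
    x * Π.sum h  ≡⟨ cong (x *_) (*-cancelˡ (Π≢0 g g≢0) (trans (*-comm _ _) (trans (sym eqΠ) (sym (*-identityʳ _))))) ⟩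
    x * 1#  ≡⟨ *-identityʳ x ⟩
    x  ∎
    where
    open ≡-Reasoning
    module C = Card card
    i₀ : Fin N
    i₀ = proj₁ (C.index (has0 (sub M)))
    i₀≡ : C.elem i₀ ≡ 0#
    i₀≡ = proj₂ (C.index (has0 (sub M)))
    -- Zero stays in the index set but is made harmless: `g′` replaces it by 1, and `h′` is the
    -- factor by which `g′` changes under y ↦ x y, namely 1 at zero and x elsewhere.
    g′ h′ : K → K
    g′ y with y ≟K 0#
    ... | yes _ = 1#
    ... | no  _ = y
    h′ y with y ≟K 0#
    ... | yes _ = 1#
    ... | no  _ = x
    g′≢0 : ∀ y → g′ y ≢ 0#
    g′≢0 y with y ≟K 0#
    ... | yes _   = λ eq → 0≢1 (sym eq)
    ... | no  y≢0 = y≢0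
    h′-0 : h′ 0# ≡ 1#
    h′-0 with 0# ≟K 0#
    ... | yes _ = refl
    ... | no ¬p = contradiction refl ¬p
    h′-≢0 : ∀ {y} → y ≢ 0# → h′ y ≡ x
    h′-≢0 {y} y≢0 with y ≟K 0#
    ... | yes p = contradiction p y≢0
    ... | no  _ = refl
    g′-x* : ∀ y → g′ (x * y) ≡ h′ y * g′ y
    g′-x* y with y ≟K 0# | (x * y) ≟K 0#
    ... | yes _    | yes _   = sym (*-identityˡ 1#)
    ... | yes refl | no ¬p   = contradiction (zeroʳ x) ¬p
    ... | no ¬p    | yes xy≡ = contradiction (integral xy≡ x≢0) ¬p
    ... | no _     | no _    = refl
    g h : Fin N → K
    g i = g′ (C.elem i)
    h i = h′ (C.elem i)
    g≢0 : ∀ i → g i ≢ 0#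
    g≢0 i = g′≢0 (C.elem i)
    h-≢ : ∀ i → i ≢ i₀ → h i ≡ x
    h-≢ i i≢ = h′-≢0 (λ eq → i≢ (C.elem-inj (trans eq (sym i₀≡))))
    act : ∀ {y} → y ∈ sub M → Fin N → Fin N
    act y∈ i = proj₁ (C.index (mul M y∈ (C.elem∈ i)))
    elem-act : ∀ {y} (y∈ : y ∈ sub M) i → C.elem (act y∈ i) ≡ y * C.elem i
    elem-act y∈ i = proj₂ (C.index (mul M y∈ (C.elem∈ i)))
    x⁻¹∈ : inv x ∈ sub M
    x⁻¹∈ = inv∈ M x∈
    eqΠ : Π.sum g ≡ Π.sum h * Π.sum g
    eqΠ = begin
      Π.sum g  ≡⟨ Π.sum-permute g (permutation (act x∈) (act x⁻¹∈)
        (λ i → C.elem-inj (trans (elem-act x∈ _) (trans (cong (x *_) (elem-act x⁻¹∈ i)) (*-inv-* x≢0 _))))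
        (λ i → C.elem-inj (trans (elem-act x⁻¹∈ _) (trans (cong (inv x *_) (elem-act x∈ i)) (inv-*-* x≢0 _))))) ⟩
      Π.sum (λ i → g (act x∈ i))  ≡⟨ Π.sum-cong-≗ (λ i → trans (cong g′ (elem-act x∈ i)) (g′-x* (C.elem i))) ⟩
      Π.sum (λ i → h i * g i)  ≡⟨ Π.∑-distrib-+ h g ⟩
      Π.sum h * Π.sum g  ∎

  -- Elements of degree below m are fixed by some proper power of the Frobenius, and there are
  -- at most q + q² + … + q^(m−1) < q^m of them.

  FixedBelow : ℕ → K → Set
  FixedBelow n x = ∃[ j ] (1 ≤ j × j ≤ n × pow E x (q ^ j) ≡ x)

  geomSum : ℕ → ℕ
  geomSum zero    = 0
  geomSum (suc n) = q ^ suc n ℕ.+ geomSum n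

  geomSum< : ∀ n → geomSum n < q ^ suc n
  geomSum< zero    = ≤-trans (s≤s z≤n) (≤-trans 1<q (≤-reflexive (sym (ℕₚ.*-identityʳ q))))
  geomSum< (suc n) = begin-strict
    q ^ suc n ℕ.+ geomSum n  <⟨ ℕₚ.+-monoʳ-< (q ^ suc n) (geomSum< n) ⟩
    q ^ suc n ℕ.+ q ^ suc n  ≡⟨ cong (q ^ suc n ℕ.+_) (sym (ℕₚ.+-identityʳ _)) ⟩
    2 ℕ.* q ^ suc n  ≤⟨ ℕₚ.*-monoˡ-≤ (q ^ suc n) 1<q ⟩
    q ^ suc (suc n)  ∎
    where open ℕₚ.≤-Reasoning

  fixedBelow-bound : ∀ n → AtMost (FixedBelow n) (geomSum n)
  fixedBelow-bound zero    [] _ _ = z≤n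
  fixedBelow-bound zero    (x ∷ xs) _ ((j , 1≤j , j≤0 , _) ∷ _) = contradiction (≤-trans 1≤j j≤0) λ ()
  fixedBelow-bound (suc n) = AtMost-∪ {λ x → pow E x (q ^ suc n) ≡ x} {FixedBelow n} (λ x → pow E x (q ^ suc n) ≟K x) split
      (bound (≤-trans 1<q (ℕₚ.m≤m*n q (q ^ n) {{ℕₚ.m^n≢0 q n}}))) (fixedBelow-bound n)
    where
    bound : ∀ {N} → 2 ≤ N → AtMost (λ x → pow E x N ≡ x) N
    bound {suc (suc N)} (s≤s (s≤s z≤n)) = fixed-bound N
    split : ∀ x → FixedBelow (suc n) x → pow E x (q ^ suc n) ≡ x ⊎ FixedBelow n x
    split x (j , 1≤j , j≤ , fx) with ℕₚ.m≤n⇒m<n∨m≡n j≤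
    ... | inj₁ (s≤s j≤n) = inj₂ (j , 1≤j , j≤n , fx)
    ... | inj₂ refl      = inj₁ fx

  pow-0 : ∀ {N} → 1 ≤ N → pow E 0# N ≡ 0#
  pow-0 {suc N} _ = zeroˡ _

  primitive-element : 2 ≤ m → ∃[ t ] LinIndepOver E (InF E) (powers E t m)
  primitive-element 2≤m = go (any? (λ t → indep? base (powers E t m)))
    where
    fixed : ∀ n → m ≡ suc n → ∀ x → ¬ LinIndepOver E (InF E) (powers E x m) → FixedBelow n x
    fixed n m≡ x ¬indep = split (x ≟K 0#)
      where
      split : Dec (x ≡ 0#) → FixedBelow n x
      -- `frobenius-fixes` needs x ≠ 0, but zero is fixed by x ↦ x^q; the exponent j = 1 is
      -- admissible because m ≥ 2.
      split (yes refl) = 1 , ≤-refl , ≤-pred (subst (2 ≤_) m≡ 2≤m) , pow-0 (ℕₚ.m^n>0 q 1)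
      split (no x≢0) = byDegree (degree base x)
        where
        byDegree : ∃[ d ] DegreeOver E (InF E) x d → FixedBelow n x
        -- The stabilizer of the span of 1, x, ..., x^(d-1) is a field that contains x and has
        -- dimension at most d < m; its Frobenius power fixes x.
        byDegree (d , deg) = dim (sub M) , dim-sub>0 M , ≤-trans M≤d (≤-pred (subst (d <_) m≡ d<m)) ,
            frobenius-fixes M (card-dim (sub M)) (degree-stable base x≢0 deg) x≢0
          where
          M : Subfield
          M = Stab (poly base x d)
          d<m : d < m
          d<m = ℕₚ.≰⇒> λ m≤d → ¬indep (indep-powers-≤ base x m≤d (proj₁ deg))
          M≤d : dim (sub M) ≤ d
          M≤d = subst (dim (sub M) ≤_) (trans (dim-indep base (powers E x d) (proj₁ deg)) (trans (cong (d ℕ.*_) dim-base) (ℕₚ.*-identityʳ d)))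
            (dim-stab≤ deg)
            where
            dim-stab≤ : ∀ {d} → DegreeOver E (InF E) x d → dim (sub (Stab (poly base x d))) ≤ dim (poly base x d)
            dim-stab≤ {zero}  deg = contradiction (degree>0 base {x} deg) λ ()
            dim-stab≤ {suc d} deg = dim-mono {sub (Stab (poly base x (suc d)))} {poly base x (suc d)}
              (λ {y} p → ∈-resp (poly base x (suc d)) (*-identityʳ y) (p 1# (poly-const base x d F-1)))
    go : Dec (∃[ t ] LinIndepOver E (InF E) (powers E t m)) → ∃[ t ] LinIndepOver E (InF E) (powers E t m)
    go (yes p) = p
    go (no none) = overflow (pred-of (<⇒≤ 2≤m))
      where
      overflow : ∃[ n ] suc n ≡ m → _
      overflow (n , sn≡) = contradiction
        (fixedBelow-bound n allK (Uniqueₚ.tabulate⁺ (Card.elem-inj card-whole)) (All.universal (λ x → fixed n (sym sn≡) x (λ p → none (x , p))) allK))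
        (<⇒≱ (subst (geomSum n <_) (trans (cong (q ^_) sn≡) (sym (length-tabulate (Inverse.to enumK)))) (geomSum< n)))

  -- Rank weight as a dimension

  wspan : ∀ {n} → (Fin n → K) → Subspace
  wspan = span base

  rank-dim : ∀ {n d} {v : Fin n → K} → RankWeight E v d → dim (wspan v) ≡ d
  rank-dim {d = d} {v} (b , indep , v∈ , b∈) = begin
    dim (wspan v)  ≡⟨ dim-resp {wspan v} {wspan b} (span-least base v (wspan b) (span-stable base b) v∈) (span-least base b (wspan v) (span-stable base v) b∈) ⟩
    dim (wspan b)  ≡⟨ dim-indep base b indep ⟩
    d ℕ.* dim (sub base)  ≡⟨ trans (cong (d ℕ.*_) dim-base) (ℕₚ.*-identityʳ d) ⟩
    d  ∎
    where open ≡-Reasoning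

  basis : ∀ {n} (v : Fin n → K) → ∃[ d ] RankWeight E v d
  basis {zero}  v = 0 , (λ ()) , (λ _ _ _ ()) , (λ ()) , (λ ())
  basis {suc n} v = go (basis (v ∘ suc)) (mem? (wspan (v ∘ suc)) (v zero))
    where
    go : ∃[ d ] RankWeight E (v ∘ suc) d → Dec (v zero ∈ wspan (v ∘ suc)) → ∃[ d ] RankWeight E v d
    go (d , b , indep , v∈ , b∈) (yes v₀∈) = d , b , indep ,
      (λ { zero → span-least base (v ∘ suc) (wspan b) (span-stable base b) v∈ v₀∈ ; (suc i) → v∈ i }) , (λ j → span-tail⊆ base v (b∈ j))
    go (d , b , indep , v∈ , b∈) (no v₀∉) = suc d , b′ ,
      indep-∷ base b′ indep (λ p → v₀∉ (span-least base b (wspan (v ∘ suc)) (span-stable base (v ∘ suc)) b∈ p)) ,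
      (λ { zero → span-gen base b′ zero ; (suc i) → span-tail⊆ base b′ (v∈ i) }) ,
      (λ { zero → span-gen base v zero ; (suc j) → span-tail⊆ base v (b∈ j) })
      where
      b′ : Fin (suc d) → K
      b′ = v zero ∷ᶠ b

  dim-rank : ∀ {n d} (v : Fin n → K) → dim (wspan v) ≡ d → RankWeight E v d
  dim-rank v refl = subst (RankWeight E v) (sym (rank-dim {v = v} (proj₂ (basis v)))) (proj₂ (basis v))

  -- Pairs of vectors whose columns are F-independent

  IndepPair : ∀ {n} → (Fin n → K) → (Fin n → K) → Set
  IndepPair v w = ∀ a → (∀ j → InF E (a j)) → linComb E a v ≡ 0# → linComb E a w ≡ 0# → ∀ j → a j ≡ 0#

  linComb-- : ∀ {d} (a b v : Fin d → K) → linComb E a v ≡ linComb E b v → linComb E (λ i → a i - b i) v ≡ 0#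
  linComb-- a b v eq = begin
    linComb E (λ i → a i - b i) v  ≡⟨ linComb-+ a (λ i → - b i) v ⟩
    linComb E a v + linComb E (λ i → - b i) v  ≡⟨ cong (linComb E a v +_) neg ⟩
    linComb E a v - linComb E b v  ≡⟨ cong (_- linComb E b v) eq ⟩
    linComb E b v - linComb E b v  ≡⟨ -‿inverseʳ _ ⟩
    0#  ∎
    where
    open ≡-Reasoning
    neg : linComb E (λ i → - b i) v ≡ - linComb E b v
    neg = trans (trans (sumK-cong (λ i → trans (cong (λ z → - z * v i) (sym (*-identityˡ (b i)))) (solve 3 (λ o b v → (:- (o :* b)) :* v := (:- o) :* (b :* v)) refl 1# (b i) (v i)))) (sumK-* (- 1#) (λ i → b i * v i)))
      (trans (solve 2 (λ o x → (:- o) :* x := :- (o :* x)) refl 1# (linComb E b v)) (cong -_ (*-identityˡ _)))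

  module _ {n} (v w : Fin n → K) (indep : IndepPair v w) where
    private
      module V = Card (card-dim (wspan v))
      module W = Card (card-dim (wspan w))
      module F = Card card-base

      coeff : Fin (q ^ n) → Fin n → K
      coeff k i = F.elem (finToFun {q} {n} k i)
      coeff∈ : ∀ k i → InF E (coeff k i)
      coeff∈ k i = F.elem∈ (finToFun {q} {n} k i)
      ixv : ∀ k → ∃[ i ] V.elem i ≡ linComb E (coeff k) v
      ixv k = V.index (coeff k , coeff∈ k , refl)
      ixw : ∀ k → ∃[ i ] W.elem i ≡ linComb E (coeff k) w
      ixw k = W.index (coeff k , coeff∈ k , refl)
      f : Fin (q ^ n) → Fin (q ^ dim (wspan v) ℕ.* q ^ dim (wspan w))
      f k = combine (proj₁ (ixv k)) (proj₁ (ixw k))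
      f-inj : ∀ {k k′} → f k ≡ f k′ → k ≡ k′
      f-inj {k} {k′} eq = finToFun-injective {n} {q} λ i → F.elem-inj (x-y≡0⇒x≡y
        (indep (λ i → coeff k i - coeff k′ i) (λ i → has∸ (sub base) (coeff∈ k i) (coeff∈ k′ i))
          (linComb-- (coeff k) (coeff k′) v (trans (sym (proj₂ (ixv k))) (trans (cong V.elem (proj₁ both)) (proj₂ (ixv k′)))))
          (linComb-- (coeff k) (coeff k′) w (trans (sym (proj₂ (ixw k))) (trans (cong W.elem (proj₂ both)) (proj₂ (ixw k′))))) i))
        where
        both : proj₁ (ixv k) ≡ proj₁ (ixv k′) × proj₁ (ixw k) ≡ proj₁ (ixw k′)
        both = Finₚ.combine-injective (proj₁ (ixv k)) (proj₁ (ixw k)) (proj₁ (ixv k′)) (proj₁ (ixw k′)) eq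

    -- Sending a coefficient vector in F^n to its combinations of v and of w is injective, so q^n is
    -- at most the product of the sizes of the two spans.
    indepPair-dim : n ≤ dim (wspan v) ℕ.+ dim (wspan w)
    indepPair-dim = ^-cancel-≤ (subst (q ^ n ≤_) (sym (ℕₚ.^-distribˡ-+-* q (dim (wspan v)) (dim (wspan w)))) (Finₚ.injective⇒≤ f-inj))

    -- When the sizes agree, the injection behind `indepPair-dim` is a bijection, so both
    -- combinations can be prescribed at once.
    indepPair-surjective : n ≡ dim (wspan v) ℕ.+ dim (wspan w) → ∀ {x y} → x ∈ wspan v → y ∈ wspan w →
                           ∃[ a ] ((∀ j → InF E (a j)) × linComb E a v ≡ x × linComb E a w ≡ y)
    indepPair-surjective n≡ {x} {y} x∈ y∈ = hit (surjective sizes f f-inj (combine (proj₁ ix) (proj₁ iy)))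
      where
      sizes : q ^ n ≡ q ^ dim (wspan v) ℕ.* q ^ dim (wspan w)
      sizes = trans (cong (q ^_) n≡) (ℕₚ.^-distribˡ-+-* q (dim (wspan v)) (dim (wspan w)))
      surjective : ∀ {M N} → M ≡ N → (f : Fin M → Fin N) → (∀ {i j} → f i ≡ f j → i ≡ j) → ∀ y → ∃[ x ] f x ≡ y
      surjective refl = injective⇒surjective
      ix : ∃[ i ] V.elem i ≡ x
      ix = V.index x∈
      iy : ∃[ i ] W.elem i ≡ y
      iy = W.index y∈
      hit : ∃[ k ] f k ≡ combine (proj₁ ix) (proj₁ iy) → ∃[ a ] ((∀ j → InF E (a j)) × linComb E a v ≡ x × linComb E a w ≡ y)
      hit (k , eq) = coeff k , coeff∈ k ,
          trans (sym (proj₂ (ixv k))) (trans (cong V.elem (proj₁ both)) (proj₂ ix)) ,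
          trans (sym (proj₂ (ixw k))) (trans (cong W.elem (proj₂ both)) (proj₂ iy))
        where
        both : proj₁ (ixv k) ≡ proj₁ ix × proj₁ (ixw k) ≡ proj₁ iy
        both = Finₚ.combine-injective (proj₁ (ixv k)) (proj₁ (ixw k)) (proj₁ ix) (proj₁ iy) eq

  -- Two-dimensional codes

  row₀ row₁ : ∀ {n} → Matrix E 2 n → Fin n → K
  row₀ G = G zero
  row₁ G = G (suc zero)

  rowComb₂ : ∀ {n} (u : Fin 2 → K) (G : Matrix E 2 n) j → rowComb E u G j ≡ u zero * row₀ G j + u (suc zero) * row₁ G j
  rowComb₂ u G j = cong (_+_ _) (+-identityʳ _)

  inCode : ∀ {n} (G : Matrix E 2 n) x y {c : Fin n → K} → (∀ j → c j ≡ x * row₀ G j + y * row₁ G j) → InCode E G c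
  inCode G x y eq = x ∷ᶠ y ∷ᶠ (λ ()) , λ j → trans (eq j) (sym (rowComb₂ (x ∷ᶠ y ∷ᶠ (λ ())) G j))

  coords : ∀ {n} (G : Matrix E 2 n) {c : Fin n → K} → InCode E G c → ∃[ x ] ∃[ y ] (∀ j → c j ≡ x * row₀ G j + y * row₁ G j)
  coords G (u , eq) = u zero , u (suc zero) , λ j → trans (eq j) (rowComb₂ u G j)

  module Cramer {n} {G : Matrix E 2 n} {v w : Fin n → K} {a b c d : K}
      (v≡ : ∀ j → v j ≡ a * row₀ G j + b * row₁ G j) (w≡ : ∀ j → w j ≡ c * row₀ G j + d * row₁ G j) where

    Δ : K
    Δ = a * d - b * c

    -- The second alternative serves only w = 0, where v need not be a multiple of w.
    parallel : Δ ≡ 0# → (∃[ s ] (∀ j → v j ≡ s * w j)) ⊎ (∃[ s ] (∀ j → w j ≡ s * v j))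
    parallel Δ≡0 = go (c ≟K 0#) (d ≟K 0#)
      where
      ad≡bc : a * d ≡ b * c
      ad≡bc = x-y≡0⇒x≡y Δ≡0
      open ≡-Reasoning
      go : Dec (c ≡ 0#) → Dec (d ≡ 0#) → (∃[ s ] (∀ j → v j ≡ s * w j)) ⊎ (∃[ s ] (∀ j → w j ≡ s * v j))
      go (yes c≡0) (yes d≡0) = inj₂ (0# , λ j → trans (w≡ j) (trans (cong₂ _+_ (trans (cong (_* row₀ G j) c≡0) (zeroˡ _)) (trans (cong (_* row₁ G j) d≡0) (zeroˡ _))) (trans (+-identityˡ _) (sym (zeroˡ _)))))
      go (no c≢0) _ = inj₁ (inv c * a , λ j → *-cancelˡ c≢0 (begin
        c * v j  ≡⟨ cong (c *_) (v≡ j) ⟩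
        c * (a * row₀ G j + b * row₁ G j)  ≡⟨ solve 5 (λ a b c x y → c :* (a :* x :+ b :* y) := a :* (c :* x) :+ b :* c :* y) refl a b c (row₀ G j) (row₁ G j) ⟩
        a * (c * row₀ G j) + b * c * row₁ G j  ≡⟨ cong (λ z → a * (c * row₀ G j) + z * row₁ G j) (sym ad≡bc) ⟩
        a * (c * row₀ G j) + a * d * row₁ G j  ≡⟨ solve 5 (λ a c d x y → a :* (c :* x) :+ a :* d :* y := a :* (c :* x :+ d :* y)) refl a c d (row₀ G j) (row₁ G j) ⟩
        a * (c * row₀ G j + d * row₁ G j)  ≡⟨ cong (a *_) (sym (w≡ j)) ⟩
        a * w j  ≡⟨ sym (*-inv-* c≢0 _) ⟩
        c * (inv c * (a * w j))  ≡⟨ cong (c *_) (sym (*-assoc (inv c) a (w j))) ⟩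
        c * (inv c * a * w j)  ∎))
      go (yes c≡0) (no d≢0) = inj₁ (inv d * b , λ j → *-cancelˡ d≢0 (begin
        d * v j  ≡⟨ cong (d *_) (v≡ j) ⟩
        d * (a * row₀ G j + b * row₁ G j)  ≡⟨ solve 5 (λ a b d x y → d :* (a :* x :+ b :* y) := a :* d :* x :+ b :* (d :* y)) refl a b d (row₀ G j) (row₁ G j) ⟩
        a * d * row₀ G j + b * (d * row₁ G j)  ≡⟨ cong (λ z → z * row₀ G j + b * (d * row₁ G j)) ad≡bc ⟩
        b * c * row₀ G j + b * (d * row₁ G j)  ≡⟨ solve 5 (λ b c d x y → b :* c :* x :+ b :* (d :* y) := b :* (c :* x :+ d :* y)) refl b c d (row₀ G j) (row₁ G j) ⟩
        b * (c * row₀ G j + d * row₁ G j)  ≡⟨ cong (b *_) (sym (w≡ j)) ⟩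
        b * w j  ≡⟨ sym (*-inv-* d≢0 _) ⟩
        d * (inv d * (b * w j))  ≡⟨ cong (d *_) (sym (*-assoc (inv d) b (w j))) ⟩
        d * (inv d * b * w j)  ∎))

    Δ*row₀ : ∀ j → Δ * row₀ G j ≡ d * v j + - b * w j
    Δ*row₀ j = trans (solve 6 (λ a b c d x y → (a :* d :- b :* c) :* x := d :* (a :* x :+ b :* y) :+ (:- b) :* (c :* x :+ d :* y)) refl a b c d (row₀ G j) (row₁ G j))
      (cong₂ (λ x y → d * x + - b * y) (sym (v≡ j)) (sym (w≡ j)))

    Δ*row₁ : ∀ j → Δ * row₁ G j ≡ - c * v j + a * w j
    Δ*row₁ j = trans (solve 6 (λ a b c d x y → (a :* d :- b :* c) :* y := (:- c) :* (a :* x :+ b :* y) :+ a :* (c :* x :+ d :* y)) refl a b c d (row₀ G j) (row₁ G j))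
      (cong₂ (λ x y → - c * x + a * y) (sym (v≡ j)) (sym (w≡ j)))

    -- By Cramer's rule the rows of G are combinations of v and w, so an F-relation that kills v and
    -- w kills both rows.
    indepPair : Δ ≢ 0# → Nondegenerate E G → IndepPair v w
    indepPair Δ≢0 nondeg α α∈ zv zw = nondeg α α∈ (λ { zero → rowZero (row₀ G) d (- b) Δ*row₀ ; (suc zero) → rowZero (row₁ G) (- c) a Δ*row₁ })
      where
      open ≡-Reasoning
      rowZero : ∀ (r : Fin n → K) x y → (∀ j → Δ * r j ≡ x * v j + y * w j) → linComb E α r ≡ 0#
      rowZero r x y eq = integral (begin
        Δ * linComb E α r  ≡⟨ sym (linComb-*ʳ Δ α r) ⟩
        linComb E α (λ j → Δ * r j)  ≡⟨ sumK-cong (λ j → cong (α j *_) (eq j)) ⟩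
        linComb E α (λ j → x * v j + y * w j)  ≡⟨ linComb-+ʳ α (λ j → x * v j) (λ j → y * w j) ⟩
        linComb E α (λ j → x * v j) + linComb E α (λ j → y * w j)  ≡⟨ cong₂ _+_ (trans (linComb-*ʳ x α v) (trans (cong (x *_) zv) (zeroʳ x))) (trans (linComb-*ʳ y α w) (trans (cong (y *_) zw) (zeroʳ y))) ⟩
        0# + 0#  ≡⟨ +-identityˡ 0# ⟩
        0#  ∎) Δ≢0

    solveFor : Δ ≢ 0# → ∀ {c′ : Fin n → K} → InCode E G c′ → ∃[ x ] ∃[ y ] (∀ j → c′ j ≡ x * v j + y * w j)
    solveFor Δ≢0 {c′} c′∈ = go (coords G c′∈)
      where
      open ≡-Reasoning
      go : ∃[ e ] ∃[ f ] (∀ j → c′ j ≡ e * row₀ G j + f * row₁ G j) → ∃[ x ] ∃[ y ] (∀ j → c′ j ≡ x * v j + y * w j)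
      go (e , f , eq) = inv Δ * (e * d + f * - c) , inv Δ * (e * - b + f * a) , λ j → *-cancelˡ Δ≢0 (begin
        Δ * c′ j  ≡⟨ cong (Δ *_) (eq j) ⟩
        Δ * (e * row₀ G j + f * row₁ G j)  ≡⟨ solve 5 (λ Δ e f x y → Δ :* (e :* x :+ f :* y) := e :* (Δ :* x) :+ f :* (Δ :* y)) refl Δ e f (row₀ G j) (row₁ G j) ⟩
        e * (Δ * row₀ G j) + f * (Δ * row₁ G j)  ≡⟨ cong₂ (λ x y → e * x + f * y) (Δ*row₀ j) (Δ*row₁ j) ⟩
        e * (d * v j + - b * w j) + f * (- c * v j + a * w j)  ≡⟨ regroup e f d (- b) (- c) a (v j) (w j) ⟩
        (e * d + f * - c) * v j + (e * - b + f * a) * w j  ≡⟨ cong₂ (λ x y → x * v j + y * w j) (sym (*-inv-* Δ≢0 _)) (sym (*-inv-* Δ≢0 _)) ⟩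
        Δ * (inv Δ * (e * d + f * - c)) * v j + Δ * (inv Δ * (e * - b + f * a)) * w j
          ≡⟨ solve 5 (λ Δ p s v w → Δ :* p :* v :+ Δ :* s :* w := Δ :* (p :* v :+ s :* w)) refl Δ (inv Δ * (e * d + f * - c)) (inv Δ * (e * - b + f * a)) (v j) (w j) ⟩
        Δ * (inv Δ * (e * d + f * - c) * v j + inv Δ * (e * - b + f * a) * w j) ∎)
        where
        regroup : ∀ e f d b c a v w → e * (d * v + b * w) + f * (c * v + a * w) ≡ (e * d + f * c) * v + (e * b + f * a) * w
        regroup = solve 8 (λ e f d b c a v w → e :* (d :* v :+ b :* w) :+ f :* (c :* v :+ a :* w) := (e :* d :+ f :* c) :* v :+ (e :* b :+ f :* a) :* w) refl

  -- Upper bound on the number of weights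

  weight-upper : ∀ {n d} {G : Matrix E 2 n} → HasWeight E G d → d ≤ n
  weight-upper {n} (c , _ , _ , rw) = subst₂ _≤_ (rank-dim {v = c} rw) (trans (cong (n ℕ.*_) dim-base) (ℕₚ.*-identityʳ n)) (dim-span≤ base c)

  scaled-dim : ∀ {n} s {v w : Fin n → K} → s ≢ 0# → (∀ j → v j ≡ s * w j) → dim (wspan v) ≡ dim (wspan w)
  scaled-dim s {v} {w} s≢0 eq = trans (dim-resp {wspan v} {s · wspan w} (λ p → span-· base s w (span-cong base eq p)) (λ p → span-cong base (λ j → sym (eq j)) (span-·⁻ base s w p))) (dim-· (wspan w) s≢0)

  private
    scalar≢0 : ∀ {n s} {v w : Fin n → K} → (∀ j → v j ≡ s * w j) → ¬ (∀ j → v j ≡ 0#) → s ≢ 0#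
    scalar≢0 {w = w} eq v≢0 refl = v≢0 λ j → trans (eq j) (zeroˡ (w j))

  -- Proportional nonzero codewords have equal weight. Different weights therefore come from
  -- independent codewords, to which `indepPair-dim` applies.
  weights-sum : ∀ {n d d′} {G : Matrix E 2 n} → Nondegenerate E G → HasWeight E G d → HasWeight E G d′ → d ≢ d′ → n ≤ d ℕ.+ d′
  weights-sum {n} {d} {d′} {G} nondeg (v , v∈ , v≢0 , rv) (w , w∈ , w≢0 , rw) d≢d′ = go (coords G v∈) (coords G w∈)
    where
    go : ∃[ x ] ∃[ y ] (∀ j → v j ≡ x * row₀ G j + y * row₁ G j) → ∃[ x ] ∃[ y ] (∀ j → w j ≡ x * row₀ G j + y * row₁ G j) → n ≤ d ℕ.+ d′
    go (a , b , v≡) (c , e , w≡) = split (Δ ≟K 0#)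
      where
      open Cramer {G = G} {v} {w} v≡ w≡
      prop : (∃[ s ] (∀ j → v j ≡ s * w j)) ⊎ (∃[ s ] (∀ j → w j ≡ s * v j)) → dim (wspan v) ≡ dim (wspan w)
      prop (inj₁ (s , eq)) = scaled-dim s (scalar≢0 {w = w} eq v≢0) eq
      prop (inj₂ (s , eq)) = sym (scaled-dim s (scalar≢0 {w = v} eq w≢0) eq)
      split : Dec (Δ ≡ 0#) → n ≤ d ℕ.+ d′
      split (yes Δ≡0) = contradiction (trans (sym (rank-dim {v = v} rv)) (trans (prop (parallel Δ≡0)) (rank-dim {v = w} rw))) d≢d′
      split (no Δ≢0) = subst (n ≤_) (cong₂ ℕ._+_ (rank-dim {v = v} rv) (rank-dim {v = w} rw)) (indepPair-dim v w (indepPair Δ≢0 nondeg))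

  -- Truncated subtraction of ℓ sends the weights into {0, ..., ℓ}. Weights below ℓ are possible for
  -- an arbitrary code, but `weights-sum` and `collapse` keep this map injective.
  weights-bound : ∀ {ℓ s} {G : Matrix E 2 (ℓ ℕ.+ ℓ)} → Nondegenerate E G → AtLeastWeights E G s → s ≤ suc ℓ
  weights-bound {ℓ} {s} {G} nondeg (w , w-inj , hasW) = Finₚ.injective⇒≤ {f = f} λ {i} {j} eq → w-inj i j (same i j (values eq))
    where
    small : ∀ i → w i ℕ.∸ ℓ < suc ℓ
    small i = s≤s (subst (w i ℕ.∸ ℓ ≤_) (ℕₚ.m+n∸n≡m ℓ ℓ) (ℕₚ.∸-monoˡ-≤ ℓ (weight-upper {G = G} (hasW i))))
    f : Fin s → Fin (suc ℓ)
    f i = Fin.fromℕ< (small i)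
    values : ∀ {i j} → f i ≡ f j → w i ℕ.∸ ℓ ≡ w j ℕ.∸ ℓ
    values {i} {j} eq = trans (sym (Finₚ.toℕ-fromℕ< (small i))) (trans (cong toℕ eq) (Finₚ.toℕ-fromℕ< (small j)))
    same : ∀ i j → w i ℕ.∸ ℓ ≡ w j ℕ.∸ ℓ → w i ≡ w j
    same i j eq = decidable-stable (w i ℕ.≟ w j) λ w≢ → w≢ (collapse ℓ eq (weights-sum {G = G} nondeg (hasW i) (hasW j) w≢))

  -- Matrices over F and equivalence of codes

  mulVM-comm : ∀ {a b} (v : Fin a → K) (A : Matrix E a b) j → mulVM E v A j ≡ linComb E (λ t → A t j) v
  mulVM-comm v A j = sumK-cong (λ t → *-comm (v t) (A t j))

  mulVM-assoc : ∀ {a b c} (v : Fin a → K) (A : Matrix E a b) (B : Matrix E b c) j →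
                mulVM E (mulVM E v A) B j ≡ mulVM E v (mulMM E A B) j
  mulVM-assoc {a} {b} v A B j = begin
    sumK E (λ k → sumK E (λ t → v t * A t k) * B k j)  ≡⟨ sumK-cong (λ k → trans (*-comm _ (B k j)) (sym (sumK-* (B k j) (λ t → v t * A t k)))) ⟩
    sumK E (λ k → sumK E (λ t → B k j * (v t * A t k)))  ≡⟨ sumK-swap (λ k t → B k j * (v t * A t k)) ⟩
    sumK E (λ t → sumK E (λ k → B k j * (v t * A t k)))  ≡⟨ sumK-cong (λ t → trans (sumK-cong (λ k → solve 3 (λ b v a → b :* (v :* a) := v :* (a :* b)) refl (B k j) (v t) (A t k))) (sumK-* (v t) (λ k → A t k * B k j))) ⟩
    sumK E (λ t → v t * sumK E (λ k → A t k * B k j))  ∎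
    where open ≡-Reasoning

  mulVM-id : ∀ {n} (v : Fin n → K) j → mulVM E v (idMat E) j ≡ v j
  mulVM-id {suc n} v zero    = trans (cong₂ _+_ (*-identityʳ (v zero)) (sumK-0 (λ t → zeroʳ (v (suc t))))) (+-identityʳ _)
  mulVM-id {suc n} v (suc j) = trans (cong₂ _+_ (zeroʳ (v zero)) (mulVM-id (v ∘ suc) j)) (+-identityˡ _)

  mulVM-linear : ∀ {a b} x y (v w : Fin a → K) (A : Matrix E a b) j →
                 mulVM E (λ t → x * v t + y * w t) A j ≡ x * mulVM E v A j + y * mulVM E w A j
  mulVM-linear x y v w A j = begin
    sumK E (λ t → (x * v t + y * w t) * A t j)  ≡⟨ sumK-cong (λ t → solve 5 (λ x y v w a → (x :* v :+ y :* w) :* a := x :* (v :* a) :+ y :* (w :* a)) refl x y (v t) (w t) (A t j)) ⟩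
    sumK E (λ t → x * (v t * A t j) + y * (w t * A t j))  ≡⟨ sumK-+ (λ t → x * (v t * A t j)) (λ t → y * (w t * A t j)) ⟩
    sumK E (λ t → x * (v t * A t j)) + sumK E (λ t → y * (w t * A t j)) ≡⟨ cong₂ _+_ (sumK-* x (λ t → v t * A t j)) (sumK-* y (λ t → w t * A t j)) ⟩
    x * mulVM E v A j + y * mulVM E w A j  ∎
    where open ≡-Reasoning

  mulVM-cong : ∀ {a b} {v w : Fin a → K} (A : Matrix E a b) → (∀ t → v t ≡ w t) → ∀ j → mulVM E v A j ≡ mulVM E w A j
  mulVM-cong A eq j = sumK-cong (λ t → cong (_* A t j) (eq t))

  mulVM-· : ∀ {a b} x (v : Fin a → K) (A : Matrix E a b) j → mulVM E (λ t → x * v t) A j ≡ x * mulVM E v A j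
  mulVM-· x v A j = trans (sumK-cong (λ t → *-assoc x (v t) (A t j))) (sumK-* x (λ t → v t * A t j))

  InFMat : ∀ {a b} → Matrix E a b → Set
  InFMat A = ∀ i j → InF E (A i j)

  mulMM-InF : ∀ {a b c} {A : Matrix E a b} {B : Matrix E b c} → InFMat A → InFMat B → InFMat (mulMM E A B)
  mulMM-InF A∈ B∈ i j = sumK∈ (sub base) (λ t → F-* _ _ (A∈ i t) (B∈ t j))

  idMat-InF : ∀ {n} → InFMat (idMat E {n})
  idMat-InF zero    zero    = F-1
  idMat-InF zero    (suc j) = F-0
  idMat-InF (suc i) zero    = F-0
  idMat-InF (suc i) (suc j) = idMat-InF i j

  -- The difference of corresponding columns is an F-relation on the entries of v and of w
  -- simultaneously, hence zero.
  indepPair-matrix : ∀ {n b} {v w : Fin n → K} → IndepPair v w → {A B : Matrix E n b} → InFMat A → InFMat B →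
    (∀ j → mulVM E v A j ≡ mulVM E v B j) → (∀ j → mulVM E w A j ≡ mulVM E w B j) → ∀ i j → A i j ≡ B i j
  indepPair-matrix {v = v} {w} indep {A} {B} A∈ B∈ eqv eqw i j = x-y≡0⇒x≡y
    (indep (λ t → A t j - B t j) (λ t → has∸ (sub base) (A∈ t j) (B∈ t j))
      (linComb-- (λ t → A t j) (λ t → B t j) v (trans (sym (mulVM-comm v A j)) (trans (eqv j) (mulVM-comm v B j))))
      (linComb-- (λ t → A t j) (λ t → B t j) w (trans (sym (mulVM-comm w A j)) (trans (eqw j) (mulVM-comm w B j)))) i)

  -- The columns of the matrix with rows p and r form an F-basis of A × A.
  record Joint {n} (p r : Fin n → K) (A : Subspace) : Set where
    field
      p∈    : ∀ j → p j ∈ A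
      r∈    : ∀ j → r j ∈ A
      indep : IndepPair p r
      onto  : ∀ {x y} → x ∈ A → y ∈ A → ∃[ a ] ((∀ j → InF E (a j)) × linComb E a p ≡ x × linComb E a r ≡ y)

  record RowBasis {n} (G : Matrix E 2 n) (p r : Fin n → K) : Set where
    field
      from : ∀ x y → InCode E G (λ j → x * p j + y * r j)
      to   : ∀ {c} → InCode E G c → ∃[ x ] ∃[ y ] (∀ j → c j ≡ x * p j + y * r j)

  module _ {n} {p r : Fin n → K} {A : Subspace} (J : Joint p r A) where
    open Joint J

    -- The F-combinations of the columns reach every pair in A × A, so the two summands of xA + yA
    -- can be chosen independently.
    joint-span : ∀ x y {c : Fin n → K} → (∀ j → c j ≡ x * p j + y * r j) → dim (wspan c) ≡ dim (x · A ⊞ y · A)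
    joint-span x y {c} eq = dim-resp {wspan c} {x · A ⊞ y · A}
        (span-least base c (x · A ⊞ y · A) (base-stable (x · A ⊞ y · A)) (λ j → _ , _ , (p j , p∈ j , refl) , (r j , r∈ j , refl) , eq j))
        back
      where
      back : x · A ⊞ y · A ⊆ wspan c
      back (_ , _ , (v , v∈ , refl) , (w , w∈ , refl) , refl) = hit (onto v∈ w∈)
        where
        hit : ∃[ a ] ((∀ j → InF E (a j)) × linComb E a p ≡ v × linComb E a r ≡ w) → x * v + y * w ∈ wspan c
        hit (a , a∈ , refl , refl) = a , a∈ , (begin
          linComb E a c  ≡⟨ sumK-cong (λ j → cong (a j *_) (eq j)) ⟩
          linComb E a (λ j → x * p j + y * r j)  ≡⟨ linComb-+ʳ a (λ j → x * p j) (λ j → y * r j) ⟩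
          linComb E a (λ j → x * p j) + linComb E a (λ j → y * r j)  ≡⟨ cong₂ _+_ (linComb-*ʳ x a p) (linComb-*ʳ y a r) ⟩
          x * linComb E a p + y * linComb E a r  ∎)
          where open ≡-Reasoning

  -- The columns of the matrix with rows p, r and those of c Y are two F-bases of A × A. `N` and `M`
  -- are the base changes, and they are mutually inverse because a matrix over F is determined by
  -- its action on such a pair of rows.
  equivalent : ∀ {n} {G Y : Matrix E 2 n} {p r : Fin n → K} {A A′ c} → RowBasis G p r → Joint p r A →
               Joint (row₀ Y) (row₁ Y) A′ → c ≢ 0# → A ⊆ c · A′ → c · A′ ⊆ A → EquivalentTo E G Y
  equivalent {n} {G} {Y} {p} {r} {A} {A′} {c} basisG JG JY c≢0 A⊆ ⊆A =
      N , (N∈ , M , M∈ , NM , MN) , forth , back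
    where
    open ≡-Reasoning
    module JG = Joint JG
    module JY = Joint JY
    Y₀ Y₁ : Fin n → K
    Y₀ = row₀ Y
    Y₁ = row₁ Y
    colN : ∀ k → ∃[ a ] ((∀ j → InF E (a j)) × linComb E a p ≡ c * Y₀ k × linComb E a r ≡ c * Y₁ k)
    colN k = JG.onto (⊆A (Y₀ k , JY.p∈ k , refl)) (⊆A (Y₁ k , JY.r∈ k , refl))
    divide : ∀ {x} → x ∈ A → inv c * x ∈ A′
    divide x∈ = go (A⊆ x∈)
      where
      go : ∀ {x} → x ∈ c · A′ → inv c * x ∈ A′
      go (y , y∈ , refl) = ∈-resp A′ (sym (inv-*-* c≢0 y)) y∈
    colM : ∀ k → ∃[ a ] ((∀ j → InF E (a j)) × linComb E a Y₀ ≡ inv c * p k × linComb E a Y₁ ≡ inv c * r k)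
    colM k = JY.onto (divide (JG.p∈ k)) (divide (JG.r∈ k))
    N M : Matrix E n n
    N t k = proj₁ (colN k) t
    M t k = proj₁ (colM k) t
    N∈ : InFMat N
    N∈ t k = proj₁ (proj₂ (colN k)) t
    M∈ : InFMat M
    M∈ t k = proj₁ (proj₂ (colM k)) t
    pN : ∀ k → mulVM E p N k ≡ c * Y₀ k
    pN k = trans (mulVM-comm p N k) (proj₁ (proj₂ (proj₂ (colN k))))
    rN : ∀ k → mulVM E r N k ≡ c * Y₁ k
    rN k = trans (mulVM-comm r N k) (proj₂ (proj₂ (proj₂ (colN k))))
    Y₀M : ∀ k → mulVM E Y₀ M k ≡ inv c * p k
    Y₀M k = trans (mulVM-comm Y₀ M k) (proj₁ (proj₂ (proj₂ (colM k))))
    Y₁M : ∀ k → mulVM E Y₁ M k ≡ inv c * r k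
    Y₁M k = trans (mulVM-comm Y₁ M k) (proj₂ (proj₂ (proj₂ (colM k))))
    round₁ : ∀ (v w : Fin n → K) → (∀ k → mulVM E v N k ≡ c * w k) → (∀ k → mulVM E w M k ≡ inv c * v k) →
             ∀ j → mulVM E v (mulMM E N M) j ≡ mulVM E v (idMat E) j
    round₁ v w vN wM j = begin
      mulVM E v (mulMM E N M) j  ≡⟨ sym (mulVM-assoc v N M j) ⟩
      mulVM E (mulVM E v N) M j  ≡⟨ mulVM-cong M vN j ⟩
      mulVM E (λ k → c * w k) M j  ≡⟨ mulVM-· c w M j ⟩
      c * mulVM E w M j  ≡⟨ cong (c *_) (wM j) ⟩
      c * (inv c * v j)  ≡⟨ *-inv-* c≢0 (v j) ⟩
      v j  ≡⟨ sym (mulVM-id v j) ⟩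
      mulVM E v (idMat E) j  ∎
    round₂ : ∀ (v w : Fin n → K) → (∀ k → mulVM E v N k ≡ c * w k) → (∀ k → mulVM E w M k ≡ inv c * v k) →
             ∀ j → mulVM E w (mulMM E M N) j ≡ mulVM E w (idMat E) j
    round₂ v w vN wM j = begin
      mulVM E w (mulMM E M N) j  ≡⟨ sym (mulVM-assoc w M N j) ⟩
      mulVM E (mulVM E w M) N j  ≡⟨ mulVM-cong N wM j ⟩
      mulVM E (λ k → inv c * v k) N j  ≡⟨ mulVM-· (inv c) v N j ⟩
      inv c * mulVM E v N j  ≡⟨ cong (inv c *_) (vN j) ⟩
      inv c * (c * w j)  ≡⟨ inv-*-* c≢0 (w j) ⟩
      w j  ≡⟨ sym (mulVM-id w j) ⟩
      mulVM E w (idMat E) j  ∎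
    NM : ∀ i j → mulMM E N M i j ≡ idMat E i j
    NM = indepPair-matrix JG.indep (mulMM-InF N∈ M∈) idMat-InF (round₁ p Y₀ pN Y₀M) (round₁ r Y₁ rN Y₁M)
    MN : ∀ i j → mulMM E M N i j ≡ idMat E i j
    MN = indepPair-matrix JY.indep (mulMM-InF M∈ N∈) idMat-InF (round₂ p Y₀ pN Y₀M) (round₂ r Y₁ rN Y₁M)
    image : ∀ x y j → mulVM E (λ t → x * p t + y * r t) N j ≡ x * c * Y₀ j + y * c * Y₁ j
    image x y j = begin
      mulVM E (λ t → x * p t + y * r t) N j  ≡⟨ mulVM-linear x y p r N j ⟩
      x * mulVM E p N j + y * mulVM E r N j  ≡⟨ cong₂ (λ u w → x * u + y * w) (pN j) (rN j) ⟩
      x * (c * Y₀ j) + y * (c * Y₁ j)  ≡⟨ cong₂ _+_ (sym (*-assoc x c (Y₀ j))) (sym (*-assoc y c (Y₁ j))) ⟩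
      x * c * Y₀ j + y * c * Y₁ j  ∎
    forth : ∀ w → InCode E Y w → ∃[ w₀ ] (InCode E G w₀ × (∀ j → w j ≡ mulVM E w₀ N j))
    forth w w∈ = go (coords Y w∈)
      where
      go : ∃[ x ] ∃[ y ] (∀ j → w j ≡ x * Y₀ j + y * Y₁ j) → ∃[ w₀ ] (InCode E G w₀ × (∀ j → w j ≡ mulVM E w₀ N j))
      go (x , y , eq) = _ , RowBasis.from basisG (x * inv c) (y * inv c) , λ j → trans (eq j) (sym (trans (image (x * inv c) (y * inv c) j)
        (cong₂ (λ u v → u * Y₀ j + v * Y₁ j) (cancel x) (cancel y))))
        where
        cancel : ∀ x → x * inv c * c ≡ x
        cancel x = trans (*-assoc x (inv c) c) (trans (cong (x *_) (inv-* c≢0)) (*-identityʳ x))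
    back : ∀ w₀ → InCode E G w₀ → InCode E Y (mulVM E w₀ N)
    back w₀ w₀∈ = go (RowBasis.to basisG w₀∈)
      where
      go : ∃[ x ] ∃[ y ] (∀ j → w₀ j ≡ x * p j + y * r j) → InCode E Y (mulVM E w₀ N)
      go (x , y , eq) = inCode Y (x * c) (y * c) (λ j → trans (mulVM-cong N eq j) (image x y j))

  -- A matrix over F sends the entries of a vector into their F-span, and its inverse does the same
  -- in the other direction.
  weight-transfer : ∀ {n d} {G Y : Matrix E 2 n} → EquivalentTo E G Y → HasWeight E Y d → HasWeight E G d
  weight-transfer {n} {d} {G} {Y} (A , (A∈ , B , B∈ , AB , BA) , forth , back) (c , c∈ , c≢0 , rw) = go (forth c c∈)
    where
    go : ∃[ c₀ ] (InCode E G c₀ × (∀ j → c j ≡ mulVM E c₀ A j)) → HasWeight E G d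
    go (c₀ , c₀∈ , eq) = c₀ , c₀∈ , (λ z → c≢0 (λ j → trans (eq j) (sumK-0 (λ t → trans (cong (_* A t j) (z t)) (zeroˡ _))))) ,
        dim-rank c₀ (trans (dim-resp {wspan c₀} {wspan c}
          (span-least base c₀ (wspan c) (span-stable base c) (λ j → ∈-resp (wspan c) (sym (eq₀ j)) (image∈ c B B∈ j)))
          (span-least base c (wspan c₀) (span-stable base c₀) (λ j → ∈-resp (wspan c₀) (sym (eq j)) (image∈ c₀ A A∈ j)))) (rank-dim {v = c} rw))
      where
      open ≡-Reasoning
      image∈ : ∀ (v : Fin n → K) (A : Matrix E n n) → InFMat A → ∀ j → mulVM E v A j ∈ wspan v
      image∈ v A A∈ j = (λ t → A t j) , (λ t → A∈ t j) , sym (mulVM-comm v A j)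
      eq₀ : ∀ j → c₀ j ≡ mulVM E c B j
      eq₀ j = begin
        c₀ j  ≡⟨ sym (mulVM-id c₀ j) ⟩
        mulVM E c₀ (idMat E) j  ≡⟨ sumK-cong (λ t → cong (c₀ t *_) (sym (AB t j))) ⟩
        mulVM E c₀ (mulMM E A B) j  ≡⟨ sym (mulVM-assoc c₀ A B j) ⟩
        mulVM E (mulVM E c₀ A) B j  ≡⟨ mulVM-cong B (λ t → sym (eq t)) j ⟩
        mulVM E c B j  ∎

  AllWeights : ∀ {ℓ} → Matrix E 2 (ℓ ℕ.+ ℓ) → Set
  AllWeights {ℓ} G = ∀ j → j ≤ ℓ → HasWeight E G (ℓ ℕ.+ j)

  allWeights⇒atLeast : ∀ {ℓ s} {G : Matrix E 2 (ℓ ℕ.+ ℓ)} → AllWeights {ℓ} G → s ≤ suc ℓ → AtLeastWeights E G s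
  allWeights⇒atLeast {ℓ} {s} all s≤ = (λ i → ℓ ℕ.+ toℕ i) , (λ i j eq → Finₚ.toℕ-injective (ℕₚ.+-cancelˡ-≡ ℓ _ _ eq)) ,
    λ i → all (toℕ i) (≤-pred (≤-trans (Finₚ.toℕ<n i) s≤))

  -- Block-diagonal generator matrices

  sumK-++ : ∀ a {b} (f : Fin (a ℕ.+ b) → K) → sumK E f ≡ sumK E (λ i → f (i ↑ˡ b)) + sumK E (λ i → f (a ↑ʳ i))
  sumK-++ zero    f = sym (+-identityˡ _)
  sumK-++ (suc a) f = trans (cong (_+_ _) (sumK-++ a (f ∘ suc))) (sym (+-assoc _ _ _))

  module _ {ℓ} (v : Fin ℓ → K) where
    private
      Y : Matrix E 2 (ℓ ℕ.+ ℓ)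
      Y = blockDiag E v

    block₀ˡ : ∀ i → row₀ Y (i ↑ˡ ℓ) ≡ v i
    block₀ˡ i rewrite Finₚ.splitAt-↑ˡ ℓ i ℓ = refl

    block₀ʳ : ∀ i → row₀ Y (ℓ ↑ʳ i) ≡ 0#
    block₀ʳ i rewrite Finₚ.splitAt-↑ʳ ℓ ℓ i = refl

    block₁ˡ : ∀ i → row₁ Y (i ↑ˡ ℓ) ≡ 0#
    block₁ˡ i rewrite Finₚ.splitAt-↑ˡ ℓ i ℓ = refl

    block₁ʳ : ∀ i → row₁ Y (ℓ ↑ʳ i) ≡ v i
    block₁ʳ i rewrite Finₚ.splitAt-↑ʳ ℓ ℓ i = refl

    ↑-elim : ∀ {P : Fin (ℓ ℕ.+ ℓ) → Set} → (∀ i → P (i ↑ˡ ℓ)) → (∀ i → P (ℓ ↑ʳ i)) → ∀ j → P j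
    ↑-elim {P} l r j = subst P (Finₚ.join-splitAt ℓ ℓ j) (go (splitAt ℓ j))
      where
      go : ∀ s → P (Fin.join ℓ ℓ s)
      go (inj₁ i) = l i
      go (inj₂ i) = r i

    linComb-block₀ : ∀ a → linComb E a (row₀ Y) ≡ linComb E (λ i → a (i ↑ˡ ℓ)) v
    linComb-block₀ a = trans (sumK-++ ℓ (λ j → a j * row₀ Y j)) (trans (cong₂ _+_ (sumK-cong (λ i → cong (a (i ↑ˡ ℓ) *_) (block₀ˡ i)))
      (sumK-0 (λ i → trans (cong (a (ℓ ↑ʳ i) *_) (block₀ʳ i)) (zeroʳ _)))) (+-identityʳ _))

    linComb-block₁ : ∀ a → linComb E a (row₁ Y) ≡ linComb E (λ i → a (ℓ ↑ʳ i)) v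
    linComb-block₁ a = trans (sumK-++ ℓ (λ j → a j * row₁ Y j)) (trans (cong₂ _+_
      (sumK-0 (λ i → trans (cong (a (i ↑ˡ ℓ) *_) (block₁ˡ i)) (zeroʳ _))) (sumK-cong (λ i → cong (a (ℓ ↑ʳ i) *_) (block₁ʳ i)))) (+-identityˡ _))

    block-joint : Indep base v → Joint (row₀ Y) (row₁ Y) (wspan v)
    block-joint indep = record
      { p∈ = ↑-elim (λ i → ∈-resp (wspan v) (sym (block₀ˡ i)) (span-gen base v i)) (λ i → ∈-resp (wspan v) (sym (block₀ʳ i)) (has0 (wspan v)))
      ; r∈ = ↑-elim (λ i → ∈-resp (wspan v) (sym (block₁ˡ i)) (has0 (wspan v))) (λ i → ∈-resp (wspan v) (sym (block₁ʳ i)) (span-gen base v i))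
      ; indep = λ a a∈ z₀ z₁ → ↑-elim (indep (λ i → a (i ↑ˡ ℓ)) (λ i → a∈ _) (trans (sym (linComb-block₀ a)) z₀))
                                      (indep (λ i → a (ℓ ↑ʳ i)) (λ i → a∈ _) (trans (sym (linComb-block₁ a)) z₁))
      ; onto = λ { (a , a∈ , refl) (b , b∈ , refl) → glue a b , ↑-elim (λ i → subst (InF E) (sym (glueˡ a b i)) (a∈ i)) (λ i → subst (InF E) (sym (glueʳ a b i)) (b∈ i)) ,
          trans (linComb-block₀ (glue a b)) (sumK-cong (λ i → cong (_* v i) (glueˡ a b i))) ,
          trans (linComb-block₁ (glue a b)) (sumK-cong (λ i → cong (_* v i) (glueʳ a b i))) } }
      where
      glue : (Fin ℓ → K) → (Fin ℓ → K) → Fin (ℓ ℕ.+ ℓ) → K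
      glue a b j = [ a , b ]′ (splitAt ℓ j)
      glueˡ : ∀ a b i → glue a b (i ↑ˡ ℓ) ≡ a i
      glueˡ a b i = cong [ a , b ]′ (Finₚ.splitAt-↑ˡ ℓ i ℓ)
      glueʳ : ∀ a b i → glue a b (ℓ ↑ʳ i) ≡ b i
      glueʳ a b i = cong [ a , b ]′ (Finₚ.splitAt-↑ʳ ℓ ℓ i)

    block-nondegenerate : Indep base v → Nondegenerate E Y
    block-nondegenerate indep a a∈ z = Joint.indep (block-joint indep) a a∈ (z zero) (z (suc zero))

    block-fullRank : ∀ i → v i ≢ 0# → FullRank E Y
    block-fullRank i vi≢0 u z = λ { zero → first ; (suc zero) → second }
      where
      open ≡-Reasoning
      first : u zero ≡ 0#
      first = integral (begin
        v i * u zero  ≡⟨ *-comm _ _ ⟩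
        u zero * v i  ≡⟨ sym (+-identityʳ _) ⟩
        u zero * v i + 0#  ≡⟨ cong₂ _+_ (cong (u zero *_) (sym (block₀ˡ i))) (sym (trans (cong (u (suc zero) *_) (block₁ˡ i)) (zeroʳ _))) ⟩
        u zero * row₀ Y (i ↑ˡ ℓ) + u (suc zero) * row₁ Y (i ↑ˡ ℓ)  ≡⟨ sym (rowComb₂ u Y (i ↑ˡ ℓ)) ⟩
        rowComb E u Y (i ↑ˡ ℓ)  ≡⟨ z (i ↑ˡ ℓ) ⟩
        0#  ∎) vi≢0
      second : u (suc zero) ≡ 0#
      second = integral (begin
        v i * u (suc zero)  ≡⟨ *-comm _ _ ⟩
        u (suc zero) * v i  ≡⟨ sym (+-identityˡ _) ⟩
        0# + u (suc zero) * v i  ≡⟨ cong₂ _+_ (sym (trans (cong (u zero *_) (block₀ʳ i)) (zeroʳ _))) (cong (u (suc zero) *_) (sym (block₁ʳ i))) ⟩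
        u zero * row₀ Y (ℓ ↑ʳ i) + u (suc zero) * row₁ Y (ℓ ↑ʳ i)  ≡⟨ sym (rowComb₂ u Y (ℓ ↑ʳ i)) ⟩
        rowComb E u Y (ℓ ↑ʳ i)  ≡⟨ z (ℓ ↑ʳ i) ⟩
        0#  ∎) vi≢0

    block-weight : Indep base v → ∀ i → v i ≢ 0# → ∀ V → V ⊆ wspan v → wspan v ⊆ V →
                   ∀ {x y d} → x ≢ 0# → dim (x · V ⊞ y · V) ≡ d → HasWeight E Y d
    block-weight indep i vi≢0 V V⊆ ⊆V {x} {y} {d} x≢0 eq = c , inCode Y x y (λ _ → refl) , c≢0 ,
        dim-rank c (trans (joint-span (block-joint indep) x y (λ _ → refl)) (trans (dim-resp {x · wspan v ⊞ y · wspan v} {x · V ⊞ y · V} down up) eq))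
      where
      c : Fin (ℓ ℕ.+ ℓ) → K
      c j = x * row₀ Y j + y * row₁ Y j
      down : x · wspan v ⊞ y · wspan v ⊆ x · V ⊞ y · V
      down (_ , _ , (a , a∈ , eq) , (b , b∈ , eq′) , eq″) = _ , _ , (a , ⊆V a∈ , eq) , (b , ⊆V b∈ , eq′) , eq″
      up : x · V ⊞ y · V ⊆ x · wspan v ⊞ y · wspan v
      up (_ , _ , (a , a∈ , eq) , (b , b∈ , eq′) , eq″) = _ , _ , (a , V⊆ a∈ , eq) , (b , V⊆ b∈ , eq′) , eq″
      c≢0 : ¬ (∀ j → c j ≡ 0#)
      c≢0 z = *≢0 x≢0 vi≢0 (trans (sym (trans (cong₂ _+_ (cong (x *_) (block₀ˡ i)) (trans (cong (y *_) (block₁ˡ i)) (zeroʳ y))) (+-identityʳ _))) (z (i ↑ˡ ℓ)))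

  -- Sums of polynomial spaces

  pow-+ : ∀ t a b → pow E t (a ℕ.+ b) ≡ pow E t a * pow E t b
  pow-+ t zero    b = sym (*-identityˡ _)
  pow-+ t (suc a) b = trans (cong (t *_) (pow-+ t a b)) (sym (*-assoc t _ _))

  pow≢0 : ∀ {t} → t ≢ 0# → ∀ k → pow E t k ≢ 0#
  pow≢0 t≢0 zero    eq = 0≢1 (sym eq)
  pow≢0 t≢0 (suc k) = *≢0 t≢0 (pow≢0 t≢0 k)

  module _ (S : Subfield) (t : K) where

    pow∈ : ∀ {k n} → k < n → pow E t k ∈ poly S t n
    pow∈ k<n = poly-≤ S t k<n (pow∈poly S t _)

    pow·poly : ∀ i k {x} → x ∈ poly S t k → pow E t i * x ∈ poly S t (i ℕ.+ k)
    pow·poly zero    k {x} x∈ = ∈-resp (poly S t k) (sym (*-identityˡ x)) x∈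
    pow·poly (suc i) k {x} x∈ = ∈-resp (poly S t (suc (i ℕ.+ k))) (sym (*-assoc t _ x)) (poly-t· S t (i ℕ.+ k) (pow·poly i k x∈))

    -- The condition i ≤ k lets the exponents 0, ..., k - 1 and i, ..., i + k - 1 cover an interval
    -- without a gap.
    poly-sum : ∀ {k i} W → Stable S W → i ≤ k → poly S t k ⊆ W → (∀ {x} → x ∈ poly S t k → pow E t i * x ∈ W) → poly S t (k ℕ.+ i) ⊆ W
    poly-sum {k} {i} W stW i≤k ⊆W shifted = span-least S (powers E t (k ℕ.+ i)) W stW (λ j → go (toℕ j) (Finₚ.toℕ<n j) (ℕₚ.≤-<-connex k (toℕ j)))
      where
      go : ∀ j → j < k ℕ.+ i → k ≤ j ⊎ j < k → pow E t j ∈ W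
      go j _  (inj₂ j<k) = ⊆W (pow∈ j<k)
      go j j< (inj₁ k≤j) = ∈-resp W (trans (sym (pow-+ t i (j ℕ.∸ i))) (cong (pow E t) (ℕₚ.m+[n∸m]≡n i≤j)))
          (shifted (pow∈ (ℕₚ.+-cancelˡ-< i _ _ (subst₂ _<_ (sym (ℕₚ.m+[n∸m]≡n i≤j)) (ℕₚ.+-comm k i) j<))))
        where
        i≤j : i ≤ j
        i≤j = ≤-trans i≤k k≤j

    dim-poly : ∀ {k d} → k ≤ d → Indep S (powers E t d) → dim (poly S t k) ≡ k ℕ.* dim (sub S)
    dim-poly k≤d indep = dim-indep S (powers E t _) (indep-powers-≤ S t k≤d indep)

  -- Weights of the two families of codes

  base-dim : ∀ {t k d} → k ≤ d → Indep base (powers E t d) → dim (poly base t k) ≡ k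
  base-dim {t} {k} k≤d indep = trans (dim-poly base t k≤d indep) (trans (cong (k ℕ.*_) dim-base) (ℕₚ.*-identityʳ k))

  1≢0 : 1# ≢ 0#
  1≢0 eq = 0≢1 (sym eq)

  -- The codeword with coefficients 1 and t^j has the required weight, since A + t^j A = ⟨1, ...,
  -- t^(ℓ+j-1)⟩.
  powers-weight : ∀ {t ℓ j} → 1 ≤ ℓ → j ≤ ℓ → Indep base (powers E t (ℓ ℕ.+ j)) → HasWeight E (blockDiag E (powers E t ℓ)) (ℓ ℕ.+ j)
  powers-weight {t} {suc ℓ} {j} _ j≤ indep = block-weight (powers E t (suc ℓ)) (indep-powers-≤ base t (ℕₚ.m≤m+n (suc ℓ) j) indep)
      zero 1≢0 P (λ p → p) (λ p → p) {1#} {pow E t j} 1≢0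
      (trans (dim-resp {1# · P ⊞ pow E t j · P} {poly base t (suc ℓ ℕ.+ j)} sum⊆ ⊆sum) (base-dim ≤-refl indep))
    where
    P : Subspace
    P = poly base t (suc ℓ)
    sum⊆ : 1# · P ⊞ pow E t j · P ⊆ poly base t (suc ℓ ℕ.+ j)
    sum⊆ = ⊞-lub {1# · P} {pow E t j · P} {poly base t (suc ℓ ℕ.+ j)}
      (λ { (x , x∈ , refl) → ∈-resp (poly base t (suc ℓ ℕ.+ j)) (sym (*-identityˡ x)) (poly-≤ base t (ℕₚ.m≤m+n (suc ℓ) j) x∈) })
      (λ { (x , x∈ , refl) → poly-≤ base t (≤-reflexive (ℕₚ.+-comm j (suc ℓ))) (pow·poly base t j (suc ℓ) x∈) })
    ⊆sum : poly base t (suc ℓ ℕ.+ j) ⊆ 1# · P ⊞ pow E t j · P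
    ⊆sum = poly-sum base t {suc ℓ} {j} (1# · P ⊞ pow E t j · P) (base-stable (1# · P ⊞ pow E t j · P)) j≤
      (λ {x} x∈ → ⊞-injˡ (1# · P) (pow E t j · P) (x , x∈ , sym (*-identityˡ x)))
      (λ {x} x∈ → ⊞-injʳ (1# · P) (pow E t j · P) (x , x∈ , refl))

  ∉F⇒≢0 : ∀ {t} → ¬ InF E t → t ≢ 0#
  ∉F⇒≢0 t∉ refl = t∉ F-0

  outside-weight : ∀ {t ℓ s} → 1 ≤ ℓ → Indep base (powers E t ℓ) → dim (1# · poly base t ℓ ⊞ s · poly base t ℓ) ≡ ℓ ℕ.+ ℓ →
                   HasWeight E (blockDiag E (powers E t ℓ)) (ℓ ℕ.+ ℓ)
  outside-weight {t} {suc ℓ} {s} _ indep eq = block-weight (powers E t (suc ℓ)) indep zero 1≢0 (poly base t (suc ℓ)) (λ p → p) (λ p → p) {1#} {s} 1≢0 eq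

  -- Powers of t give the weight ℓ + j as long as ℓ + j ≤ d. If F(t) ≠ K, the bound 2ℓ ≤ d + 1
  -- leaves open at most the weight 2ℓ, and a multiplier s outside F(t) attains it because A ∩ sA =
  -- 0.
  geometric-weights : ∀ {t ℓ d} → 1 ≤ ℓ → ¬ InF E t → DegreeOver E (InF E) t d →
    (¬ GeneratesWhole E t → ℓ ℕ.+ ℓ ≤ suc d) → (GeneratesWhole E t → ℓ ℕ.+ ℓ ≤ m) → AllWeights {ℓ} (blockDiag E (powers E t ℓ))
  geometric-weights {t} {ℓ} {d} 1≤ℓ t∉ deg small large = go (⊆? whole (poly base t d))
    where
    t-stable : t ∈ sub (Stab (poly base t d))
    t-stable = degree-stable base (∉F⇒≢0 t∉) deg
    1∈ : 1# ∈ poly base t d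
    1∈ = poly-≤ base t (degree>0 base {t} deg) (poly-const base t 0 F-1)
    by-powers : ∀ j → j ≤ ℓ → ℓ ℕ.+ j ≤ d → HasWeight E (blockDiag E (powers E t ℓ)) (ℓ ℕ.+ j)
    by-powers j j≤ le = powers-weight {t} {ℓ} {j} 1≤ℓ j≤ (indep-powers-≤ base t le (proj₁ deg))
    go : (whole ⊆ poly base t d) ⊎ (∃[ s ] (s ∈ whole × ¬ s ∈ poly base t d)) → AllWeights {ℓ} (blockDiag E (powers E t ℓ))
    go (inj₁ all) j j≤ = by-powers j j≤ (≤-trans (ℕₚ.+-monoʳ-≤ ℓ j≤) (≤-trans (large λ x → d , all {x} tt)
      (subst₂ _≤_ dim-whole (base-dim {t} {d} {d} ≤-refl (proj₁ deg)) (dim-mono {whole} {poly base t d} all))))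
    go (inj₂ (s , _ , s∉)) j j≤ = choose (ℕₚ.≤-<-connex (ℓ ℕ.+ j) d)
      where
      2ℓ≤ : ℓ ℕ.+ ℓ ≤ suc d
      2ℓ≤ = small λ gen → s∉ (poly⊆ base t (proj₁ (gen s)) (poly base t d) (base-stable (poly base t d)) (λ {x} → t-stable x) 1∈ (proj₂ (gen s)))
      ℓ≤d : ℓ ≤ d
      ℓ≤d = ≤-pred (≤-trans (≤-trans (≤-reflexive (ℕₚ.+-comm 1 ℓ)) (ℕₚ.+-monoʳ-≤ ℓ 1≤ℓ)) 2ℓ≤)
      M : Subfield
      M = Stab (poly base t d)
      P : Subspace
      P = poly base t ℓ
      s∉M : ¬ s ∈ sub M
      s∉M s∈ = s∉ (∈-resp (poly base t d) (*-identityʳ s) (s∈ 1# 1∈))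
      disj : Disjoint (1# · P) (s · P)
      disj (x , x∈ , refl) y∈ = field-disjoint M {P} {1#} 1≢0
        (λ {z} z∈ → z , poly⊆Stab base {t} {poly base t d} ℓ (base-stable (poly base t d)) t-stable z∈ , sym (*-identityˡ z)) s∉M
        (∈-resp P (sym (*-identityˡ x)) x∈) y∈
      s≢0 : s ≢ 0#
      s≢0 refl = s∉ (has0 (poly base t d))
      indep : Indep base (powers E t ℓ)
      indep = indep-powers-≤ base t ℓ≤d (proj₁ deg)
      dim-sum : dim (1# · P ⊞ s · P) ≡ ℓ ℕ.+ ℓ
      dim-sum = trans (dim-direct disj) (cong₂ ℕ._+_ (trans (dim-· P 1≢0) (base-dim {t} {ℓ} {d} ℓ≤d (proj₁ deg))) (trans (dim-· P s≢0) (base-dim {t} {ℓ} {d} ℓ≤d (proj₁ deg))))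
      choose : ℓ ℕ.+ j ≤ d ⊎ d < ℓ ℕ.+ j → HasWeight E (blockDiag E (powers E t ℓ)) (ℓ ℕ.+ j)
      choose (inj₁ le) = by-powers j j≤ le
      choose (inj₂ lt) = subst (λ i → HasWeight E (blockDiag E (powers E t ℓ)) (ℓ ℕ.+ i))
        (sym (≤-antisym j≤ (ℕₚ.+-cancelˡ-≤ ℓ _ _ (≤-trans 2ℓ≤ lt)))) (outside-weight 1≤ℓ indep dim-sum)

  -- The span of `rvec` is T_l = P_l + F t^l, where P_k denotes the polynomials in t of degree below
  -- k over F_{q²}. Weights ℓ + 2i come from T_l + t^i T_l = T_(l+i). Weights ℓ + 2i + 1 come from
  -- sums in which the top coefficient fills all of F_{q²}, so that the result is P_(l+i+1). The
  -- largest case needs t^(2l), whence 2l < d.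
  module QuadraticWeights {ξ t : K} {d l : ℕ} (isB : IsFq2Basis E ξ) (t∉ : ¬ Span1ξ E ξ t)
      (deg : DegreeOver E (Span1ξ E ξ) t d) (2l<d : l ℕ.* 2 < d) where
    private
      Q : Subfield
      Q = quad isB
      P : ℕ → Subspace
      P = poly Q t
      w : ℕ → K
      w = pow E t
      T : ℕ → Subspace
      T k = P k ⊞ w k · sub base
      ℓ : ℕ
      ℓ = suc (l ℕ.* 2)
      R : Subspace
      R = rspan ξ t ℓ
      R⊆T : R ⊆ T l
      R⊆T = rspan-odd⁻ isB t l
      T⊆R : T l ⊆ R
      T⊆R = rspan-odd⁺ isB t l
      stP : ∀ k → Stable Q (P k)
      stP k = span-stable Q (powers E t k)
      ξ∈ : Span1ξ E ξ ξ
      ξ∈ = ξ∈Span1ξ ξ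
      t≢0 : t ≢ 0#
      t≢0 refl = t∉ (has0 (sub Q))

      dimP : ∀ {k} → k ≤ d → dim (P k) ≡ k ℕ.* 2
      dimP {k} k≤d = trans (dim-poly Q t k≤d (proj₁ deg)) (cong (k ℕ.*_) (dim-quad isB))
      dimT : ∀ {k} → k < d → dim (T k) ≡ suc (k ℕ.* 2)
      dimT {k} k<d = begin
        dim (T k)  ≡⟨ dim-line base {P k} {w k} (base-stable (P k)) fresh ⟩
        dim (P k) ℕ.+ dim (sub base)  ≡⟨ cong₂ ℕ._+_ (dimP (<⇒≤ k<d)) dim-base ⟩
        k ℕ.* 2 ℕ.+ 1  ≡⟨ ℕₚ.+-comm (k ℕ.* 2) 1 ⟩
        suc (k ℕ.* 2)  ∎
        where
        open ≡-Reasoning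
        fresh : ¬ w k ∈ P k
        fresh w∈ = <⇒≱ {k ℕ.* 2} {suc k ℕ.* 2} (s≤s (ℕₚ.n≤1+n _)) (subst₂ _≤_ (dimP k<d) (dimP (<⇒≤ k<d))
            (dim-mono {P (suc k)} {P k} (λ p → shrink (poly-last⁻ Q t k p))))
          where
          shrink : ∀ {x} → ∃[ y ] ∃[ f ] (y ∈ P k × Span1ξ E ξ f × x ≡ y + f * w k) → x ∈ P k
          shrink (y , f , y∈ , f∈ , refl) = has+ (P k) y∈ (stP k f∈ w∈)

      l<d : l < d
      l<d = ≤-trans (s≤s (ℕₚ.m≤m*n l 2)) 2l<d
      indep : Indep base (rvec E ξ t ℓ)
      indep = indep-dim base (rvec E ξ t ℓ) (≤-reflexive (trans (trans (cong (ℓ ℕ.*_) dim-base) (ℕₚ.*-identityʳ ℓ))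
        (sym (trans (dim-resp {R} {T l} R⊆T T⊆R) (dimT l<d)))))

      weight : ∀ {x y n} V → x ≢ 0# → x · T l ⊞ y · T l ⊆ V → V ⊆ x · T l ⊞ y · T l → dim V ≡ n →
               HasWeight E (blockDiag E (rvec E ξ t ℓ)) n
      weight {x} {y} V x≢0 ⊆V V⊆ eq = block-weight (rvec E ξ t ℓ) indep zero 1≢0 (T l) T⊆R R⊆T {x} {y} x≢0
        (trans (dim-resp {x · T l ⊞ y · T l} {V} ⊆V V⊆) eq)

      T⊆P : ∀ k → T k ⊆ P (suc k)
      T⊆P k = ⊞-lub {P k} {w k · sub base} {P (suc k)} (poly-⊆suc Q t k)
        (λ { (f , f∈ , refl) → ∈-resp (P (suc k)) (*-comm f (w k)) (has* (P (suc k)) f∈ (pow∈poly Q t k)) })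
      P⊆T : ∀ k → P k ⊆ T k
      P⊆T k = ⊞-injˡ (P k) (w k · sub base)
      top∈T : ∀ {f} → InF E f → w l * f ∈ T l
      top∈T f∈ = ⊞-injʳ (P l) (w l · sub base) (_ , f∈ , refl)

      P-sum : ∀ {i} V → i ≤ l → (∀ {x} → x ∈ P l → x ∈ V) → (∀ {x} → x ∈ P l → w i * x ∈ V) → P (l ℕ.+ i) ⊆ V
      P-sum {i} V i≤l a b p = ⊞-lub {P l} {w i · P l} {V} a (λ { (x , x∈ , refl) → b x∈ })
        (poly-sum Q t {l} {i} (P l ⊞ w i · P l) (⊞-stable {Q} {P l} {w i · P l} (stP l) (·-stable {Q} {w i} {P l} (stP l))) i≤l
          (⊞-injˡ (P l) (w i · P l)) (λ {x} x∈ → ⊞-injʳ (P l) (w i · P l) (x , x∈ , refl)) p)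

      even-weight : ∀ i → i ≤ l → HasWeight E (blockDiag E (rvec E ξ t ℓ)) (ℓ ℕ.+ i ℕ.* 2)
      even-weight i i≤l = weight {1#} {w i} (T (l ℕ.+ i)) 1≢0 sum⊆ ⊆sum
          (trans (dimT (≤-trans (s≤s (≤-trans (ℕₚ.+-monoʳ-≤ l i≤l) (≤-reflexive (double l)))) 2l<d)) (cong suc (ℕₚ.*-distribʳ-+ 2 l i)))
        where
        T-mono : ∀ i → T l ⊆ T (l ℕ.+ i)
        T-mono zero    = subst (λ k → T l ⊆ T k) (sym (ℕₚ.+-identityʳ l)) (λ p → p)
        T-mono (suc i) p = P⊆T (l ℕ.+ suc i) (poly-≤ Q t (subst (suc l ≤_) (sym (ℕₚ.+-suc l i)) (s≤s (ℕₚ.m≤m+n l i))) (T⊆P l p))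
        wT : ∀ {x} → x ∈ T l → w i * x ∈ T (l ℕ.+ i)
        wT (p , _ , p∈ , (f , f∈ , refl) , refl) = w i * p , w (l ℕ.+ i) * f ,
          poly-≤ Q t (≤-reflexive (ℕₚ.+-comm i l)) (pow·poly Q t i l p∈) , (f , f∈ , refl) ,
          trans (solve 4 (λ a p b f → a :* (p :+ b :* f) := a :* p :+ b :* a :* f) refl (w i) p (w l) f)
            (cong (λ z → w i * p + z * f) (sym (pow-+ t l i)))
        sum⊆ : 1# · T l ⊞ w i · T l ⊆ T (l ℕ.+ i)
        sum⊆ = ⊞-lub {1# · T l} {w i · T l} {T (l ℕ.+ i)} (λ { (x , x∈ , refl) → ∈-resp (T (l ℕ.+ i)) (sym (*-identityˡ x)) (T-mono i x∈) })
          (λ { (x , x∈ , refl) → wT x∈ })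
        ⊆sum : T (l ℕ.+ i) ⊆ 1# · T l ⊞ w i · T l
        ⊆sum = ⊞-lub {P (l ℕ.+ i)} {w (l ℕ.+ i) · sub base} {1# · T l ⊞ w i · T l}
          (P-sum (1# · T l ⊞ w i · T l) i≤l (λ {x} x∈ → ⊞-injˡ (1# · T l) (w i · T l) (x , P⊆T l x∈ , sym (*-identityˡ x)))
            (λ {x} x∈ → ⊞-injʳ (1# · T l) (w i · T l) (x , P⊆T l x∈ , refl)))
          (λ { (f , f∈ , refl) → ⊞-injʳ (1# · T l) (w i · T l) (w l * f , top∈T f∈ ,
            trans (cong (_* f) (pow-+ t l i)) (solve 3 (λ a b f → a :* b :* f := b :* (a :* f)) refl (w l) (w i) f)) })

      odd-dim : ∀ i → i ≤ l → dim (P (suc (l ℕ.+ i))) ≡ ℓ ℕ.+ suc (i ℕ.* 2)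
      odd-dim i i≤l = trans (dimP (≤-trans (s≤s (≤-trans (ℕₚ.+-monoʳ-≤ l i≤l) (≤-reflexive (double l)))) 2l<d)) (odd-sum l i)

      odd-weight : ∀ i → i ≤ l → HasWeight E (blockDiag E (rvec E ξ t ℓ)) (ℓ ℕ.+ suc (i ℕ.* 2))
      odd-weight zero i≤l = weight {1#} {ξ} (P (suc l)) 1≢0 sum⊆ (λ p → ⊆sum (poly-last⁻ Q t l p))
          (trans (cong (λ k → dim (P (suc k))) (sym (ℕₚ.+-identityʳ l))) (odd-dim 0 z≤n))
        where
        V : Subspace
        V = 1# · T l ⊞ ξ · T l
        sum⊆ : V ⊆ P (suc l)
        sum⊆ = ⊞-lub {1# · T l} {ξ · T l} {P (suc l)} (λ { (x , x∈ , refl) → ∈-resp (P (suc l)) (sym (*-identityˡ x)) (T⊆P l x∈) })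
          (λ { (x , x∈ , refl) → stP (suc l) ξ∈ (T⊆P l x∈) })
        one : ∀ {x} → x ∈ T l → x ∈ V
        one {x} x∈ = ⊞-injˡ (1# · T l) (ξ · T l) (x , x∈ , sym (*-identityˡ x))
        ⊆sum : ∀ {x} → ∃[ y ] ∃[ f ] (y ∈ P l × Span1ξ E ξ f × x ≡ y + f * w l) → x ∈ V
        ⊆sum (y , _ , y∈ , (a , b , a∈ , b∈ , refl) , refl) = ∈-resp V
          (solve 5 (λ y a b ξ w → y :+ (w :* a :+ ξ :* (w :* b)) := y :+ (a :+ b :* ξ) :* w) refl y a b ξ (w l))
          (has+ V (one (P⊆T l y∈)) (has+ V (one (top∈T a∈)) (⊞-injʳ (1# · T l) (ξ · T l) (_ , top∈T b∈ , refl))))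
      odd-weight (suc i) i≤l = weight {wi} {y} (P (suc (l ℕ.+ suc i))) (pow≢0 t≢0 (suc i)) sum⊆ (λ p → ⊆sum (poly-last⁻ Q t (l ℕ.+ suc i) p)) (odd-dim (suc i) i≤l)
        where
        wi y : K
        wi = w (suc i)
        -- For x in P_l the difference y x - t^i (ξ x) returns x itself, which recovers the low
        -- powers; at x = b t^l the same y supplies the missing ξ-part of the top coefficient.
        y = 1# + ξ * wi
        V Pn : Subspace
        V = wi · T l ⊞ y · T l
        Pn = P (suc (l ℕ.+ suc i))
        shifted : ∀ {x} → x ∈ T l → wi * x ∈ Pn
        shifted x∈ = poly-≤ Q t (≤-reflexive (trans (ℕₚ.+-suc (suc i) l) (cong suc (ℕₚ.+-comm (suc i) l)))) (pow·poly Q t (suc i) (suc l) (T⊆P l x∈))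
        y* : ∀ x → y * x ≡ x + ξ * (wi * x)
        y* x = trans (distribʳ x 1# (ξ * wi)) (cong₂ _+_ (*-identityˡ x) (*-assoc ξ wi x))
        sum⊆ : V ⊆ Pn
        sum⊆ = ⊞-lub {wi · T l} {y · T l} {Pn} (λ { (x , x∈ , refl) → shifted x∈ })
          (λ { (x , x∈ , refl) → ∈-resp Pn (sym (y* x)) (has+ Pn (poly-≤ Q t (s≤s (ℕₚ.m≤m+n l (suc i))) (T⊆P l x∈)) (stP (suc (l ℕ.+ suc i)) ξ∈ (shifted x∈))) })
        wi∈ : ∀ {x} → x ∈ T l → wi * x ∈ V
        wi∈ {x} x∈ = ⊞-injˡ (wi · T l) (y · T l) (x , x∈ , refl)
        y∈ : ∀ {x} → x ∈ T l → y * x ∈ V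
        y∈ {x} x∈ = ⊞-injʳ (wi · T l) (y · T l) (x , x∈ , refl)
        low : ∀ {x} → x ∈ P l → x ∈ V
        low {x} x∈ = ∈-resp V (trans (cong (_+ wi * - (ξ * x)) (y* x)) (solve 3 (λ x ξ w → x :+ ξ :* (w :* x) :+ w :* (:- (ξ :* x)) := x) refl x ξ wi))
          (has+ V (y∈ (P⊆T l x∈)) (wi∈ (P⊆T l (has- (P l) (stP l ξ∈ x∈)))))
        P⊆V : P (l ℕ.+ suc i) ⊆ V
        P⊆V = P-sum V i≤l low (λ x∈ → wi∈ (P⊆T l x∈))
        ⊆sum : ∀ {x} → ∃[ z ] ∃[ f ] (z ∈ P (l ℕ.+ suc i) × Span1ξ E ξ f × x ≡ z + f * w (l ℕ.+ suc i)) → x ∈ V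
        -- The term b t^l that y adds is removed again inside P, which requires l to be below the
        -- top exponent. For the shift 0 this fails, so that case uses the coefficients 1 and ξ
        -- instead.
        ⊆sum (z , _ , z∈ , (a , b , a∈ , b∈ , refl) , refl) = ∈-resp V eq
            (has+ V (P⊆V z∈) (has+ V (wi∈ (top∈T a∈)) (has∸ V (y∈ (top∈T b∈))
              (P⊆V (∈-resp (P (l ℕ.+ suc i)) (*-comm b (w l)) (has* (P (l ℕ.+ suc i)) b∈ (pow∈ Q t (subst (l <_) (sym (ℕₚ.+-suc l i)) (s≤s (ℕₚ.m≤m+n l i))))))))))
          where
          eq : z + (wi * (w l * a) + (y * (w l * b) - w l * b)) ≡ z + (a + b * ξ) * w (l ℕ.+ suc i)
          eq = trans (cong (λ u → z + (wi * (w l * a) + (u - w l * b))) (y* (w l * b)))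
            (trans (solve 6 (λ z wi w a b ξ → z :+ (wi :* (w :* a) :+ (w :* b :+ ξ :* (wi :* (w :* b)) :- w :* b)) := z :+ (a :+ b :* ξ) :* (w :* wi)) refl z wi (w l) a b ξ)
              (cong (λ u → z + (a + b * ξ) * u) (sym (pow-+ t l (suc i)))))

    quadratic-weights : AllWeights {ℓ} (blockDiag E (rvec E ξ t ℓ))
    quadratic-weights j j≤ = go (halve j l j≤)
      where
      go : ∃[ i ] (i ≤ l × (j ≡ i ℕ.* 2 ⊎ j ≡ suc (i ℕ.* 2))) → HasWeight E (blockDiag E (rvec E ξ t ℓ)) (ℓ ℕ.+ j)
      go (i , i≤ , inj₁ refl) = even-weight i i≤
      go (i , i≤ , inj₂ refl) = odd-weight i i≤

  -- Normalising three pairwise non-proportional codewords of weight ℓ to p, r and p + r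
  -- forces the spans of their entries to coincide.

  record Frame {ℓ} (G : Matrix E 2 (ℓ ℕ.+ ℓ)) : Set where
    field
      p r   : Fin (ℓ ℕ.+ ℓ) → K
      rows  : RowBasis G p r
      joint : Joint p r (wspan p)
      dim-p : dim (wspan p) ≡ ℓ

  module _ {ℓ} {G : Matrix E 2 (ℓ ℕ.+ ℓ)} (nondeg : Nondegenerate E G) where
    private
      n : ℕ
      n = ℓ ℕ.+ ℓ

      normalise : ∀ {c₀ c₁ c₂ : Fin n → K} {x y} → x ≢ 0# → y ≢ 0# → IndepPair c₀ c₁ →
        (∀ {c} → InCode E G c → ∃[ s ] ∃[ u ] (∀ j → c j ≡ s * c₀ j + u * c₁ j)) →
        (∀ s u → InCode E G (λ j → s * c₀ j + u * c₁ j)) →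
        dim (wspan c₀) ≡ ℓ → dim (wspan c₁) ≡ ℓ → dim (wspan c₂) ≡ ℓ → (∀ j → c₂ j ≡ x * c₀ j + y * c₁ j) → Frame {ℓ} G
      normalise {c₀} {c₁} {c₂} {x} {y} x≢0 y≢0 indep solveFor mix dim₀ dim₁ dim₂ eq = record
        { p = p ; r = r ; dim-p = dimp
        ; rows = record
          { from = λ s u → let v , veq = mix (s * x) (u * y) in v , λ j → trans (cong₂ _+_ (sym (*-assoc s x (c₀ j))) (sym (*-assoc u y (c₁ j)))) (veq j)
          ; to = λ c∈ → let s , u , ceq = solveFor c∈ in s * inv x , u * inv y , λ j → trans (ceq j)
              (cong₂ _+_ (rescale s x≢0 (c₀ j)) (rescale u y≢0 (c₁ j))) }
        ; joint = record { p∈ = span-gen base p ; r∈ = λ j → r⊆p (span-gen base r j) ; indep = indep′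
                         ; onto = λ u∈ v∈ → onto u∈ (p⊆r v∈) } }
        where
        p r : Fin n → K
        p j = x * c₀ j
        r j = y * c₁ j
        rescale : ∀ s {x} → x ≢ 0# → ∀ z → s * z ≡ s * inv x * (x * z)
        rescale s {x} x≢0 z = trans (cong (s *_) (sym (inv-*-* x≢0 z))) (sym (*-assoc s (inv x) (x * z)))
        dimp : dim (wspan p) ≡ ℓ
        dimp = trans (scaled-dim x x≢0 (λ _ → refl)) dim₀
        dimr : dim (wspan r) ≡ ℓ
        dimr = trans (scaled-dim y y≢0 (λ _ → refl)) dim₁
        indep′ : IndepPair p r
        indep′ a a∈ zp zr = indep a a∈ (integral (trans (sym (linComb-*ʳ x a c₀)) zp) x≢0) (integral (trans (sym (linComb-*ʳ y a c₁)) zr) y≢0)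
        onto : ∀ {u v} → u ∈ wspan p → v ∈ wspan r → ∃[ a ] ((∀ j → InF E (a j)) × linComb E a p ≡ u × linComb E a r ≡ v)
        onto = indepPair-surjective p r indep′ (cong₂ ℕ._+_ (sym dimp) (sym dimr))
        sumEq : ∀ a → linComb E a c₂ ≡ linComb E a p + linComb E a r
        sumEq a = trans (sumK-cong (λ j → cong (a j *_) (eq j))) (linComb-+ʳ a p r)
        -- The third codeword is p + r, and every pair (u, 0) is a combination of columns, so u is a
        -- combination of entries of p + r. Likewise for r; equal dimensions then identify all three
        -- spans.
        p⊆c₂ : wspan p ⊆ wspan c₂
        p⊆c₂ u∈ = hit (onto u∈ (has0 (wspan r)))
          where
          hit : ∀ {u} → ∃[ a ] ((∀ j → InF E (a j)) × linComb E a p ≡ u × linComb E a r ≡ 0#) → u ∈ wspan c₂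
          hit (a , a∈ , refl , z) = a , a∈ , trans (sumEq a) (trans (cong (_+_ _) z) (+-identityʳ _))
        r⊆c₂ : wspan r ⊆ wspan c₂
        r⊆c₂ u∈ = hit (onto (has0 (wspan p)) u∈)
          where
          hit : ∀ {u} → ∃[ a ] ((∀ j → InF E (a j)) × linComb E a p ≡ 0# × linComb E a r ≡ u) → u ∈ wspan c₂
          hit (a , a∈ , z , refl) = a , a∈ , trans (sumEq a) (trans (cong (_+ linComb E a r) z) (+-identityˡ _))
        r⊆p : wspan r ⊆ wspan p
        r⊆p u∈ = dim-equal {wspan p} {wspan c₂} p⊆c₂ (≤-reflexive (trans dim₂ (sym dimp))) (r⊆c₂ u∈)
        p⊆r : wspan p ⊆ wspan r
        p⊆r u∈ = dim-equal {wspan r} {wspan c₂} r⊆c₂ (≤-reflexive (trans dim₂ (sym dimr))) (p⊆c₂ u∈)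

    frame : ThreeNonProportional E G ℓ → Frame {ℓ} G
    frame (c , info , nonprop) = go (coords G (proj₁ (info i₀))) (coords G (proj₁ (info i₁)))
      where
      i₀ i₁ i₂ : Fin 3
      i₀ = zero
      i₁ = suc zero
      i₂ = suc (suc zero)
      weight : ∀ i → dim (wspan (c i)) ≡ ℓ
      weight i = rank-dim {v = c i} (proj₂ (info i))
      go : ∃[ x ] ∃[ y ] (∀ j → c i₀ j ≡ x * row₀ G j + y * row₁ G j) → ∃[ x ] ∃[ y ] (∀ j → c i₁ j ≡ x * row₀ G j + y * row₁ G j) → Frame {ℓ} G
      go (a , b , eq₀) (d , e , eq₁) = finish (solveFor Δ≢0 (proj₁ (info i₂)))
        where
        open Cramer {G = G} {c i₀} {c i₁} eq₀ eq₁
        Δ≢0 : Δ ≢ 0#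
        Δ≢0 Δ≡0 = clash (parallel Δ≡0)
          where
          clash : (∃[ s ] (∀ j → c i₀ j ≡ s * c i₁ j)) ⊎ (∃[ s ] (∀ j → c i₁ j ≡ s * c i₀ j)) → ⊥
          clash (inj₁ prop) = nonprop i₀ i₁ (λ ()) prop
          clash (inj₂ prop) = nonprop i₁ i₀ (λ ()) prop
        mix : ∀ s u → InCode E G (λ j → s * c i₀ j + u * c i₁ j)
        mix s u = inCode G (s * a + u * d) (s * b + u * e) λ j → trans (cong₂ (λ v w → s * v + u * w) (eq₀ j) (eq₁ j))
          (regroup s u a b d e (row₀ G j) (row₁ G j))
          where
          regroup : ∀ s u a b d e x y → s * (a * x + b * y) + u * (d * x + e * y) ≡ (s * a + u * d) * x + (s * b + u * e) * y
          regroup = solve 8 (λ s u a b d e x y → s :* (a :* x :+ b :* y) :+ u :* (d :* x :+ e :* y) := (s :* a :+ u :* d) :* x :+ (s :* b :+ u :* e) :* y) refl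
        finish : ∃[ x ] ∃[ y ] (∀ j → c i₂ j ≡ x * c i₀ j + y * c i₁ j) → Frame {ℓ} G
        finish (x , y , eq₂) = normalise {c i₀} {c i₁} {c i₂} x≢0 y≢0 (indepPair Δ≢0 nondeg) (solveFor Δ≢0) mix
            (weight i₀) (weight i₁) (weight i₂) eq₂
          where
          x≢0 : x ≢ 0#
          x≢0 refl = nonprop i₂ i₁ (λ ()) (y , λ j → trans (eq₂ j) (trans (cong (_+ y * c i₁ j) (zeroˡ _)) (+-identityˡ _)))
          y≢0 : y ≢ 0#
          y≢0 refl = nonprop i₂ i₀ (λ ()) (x , λ j → trans (eq₂ j) (trans (cong (_+_ _) (zeroˡ _)) (+-identityʳ _)))

  -- From the weights of the code to the space A

  module FrameWeights {ℓ} {G : Matrix E 2 (ℓ ℕ.+ ℓ)} (F : Frame {ℓ} G) where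
    open Frame F
    A : Subspace
    A = wspan p

    weight-space : ∀ {d} → HasWeight E G d → ∃[ x ] ∃[ y ] ((x ≢ 0# ⊎ y ≢ 0#) × dim (x · A ⊞ y · A) ≡ d)
    weight-space (c , c∈ , c≢0 , rw) = go (RowBasis.to rows c∈)
      where
      go : ∃[ x ] ∃[ y ] (∀ j → c j ≡ x * p j + y * r j) → _
      go (x , y , eq) = x , y , nonzero (x ≟K 0#) (y ≟K 0#) , trans (sym (joint-span joint x y eq)) (rank-dim {v = c} rw)
        where
        nonzero : Dec (x ≡ 0#) → Dec (y ≡ 0#) → x ≢ 0# ⊎ y ≢ 0#
        nonzero (no x≢0) _        = inj₁ x≢0
        nonzero (yes _) (no y≢0)  = inj₂ y≢0
        nonzero (yes x≡0) (yes y≡0) = contradiction (λ j → trans (eq j) (trans (cong₂ _+_ (trans (cong (_* p j) x≡0) (zeroˡ _)) (trans (cong (_* r j) y≡0) (zeroˡ _))) (+-identityˡ 0#))) c≢0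

    weight-lower : ∀ {d} → HasWeight E G d → ℓ ≤ d
    weight-lower hw = go (weight-space hw)
      where
      go : ∀ {d} → ∃[ x ] ∃[ y ] ((x ≢ 0# ⊎ y ≢ 0#) × dim (x · A ⊞ y · A) ≡ d) → ℓ ≤ d
      go (x , y , inj₁ x≢0 , refl) = subst (_≤ dim (x · A ⊞ y · A)) (trans (dim-· A x≢0) dim-p) (dim-mono {x · A} {x · A ⊞ y · A} (⊞-injˡ (x · A) (y · A)))
      go (x , y , inj₂ y≢0 , refl) = subst (_≤ dim (x · A ⊞ y · A)) (trans (dim-· A y≢0) dim-p) (dim-mono {y · A} {x · A ⊞ y · A} (⊞-injʳ (x · A) (y · A)))

    -- All weights lie in {ℓ, ..., 2ℓ}, so ℓ + 1 different ones exhaust this set.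
    atLeast⇒allWeights : AtLeastWeights E G (suc ℓ) → AllWeights {ℓ} G
    atLeast⇒allWeights (w , w-inj , hasW) j j≤ = hit (injective⇒surjective f f-inj (fromℕ< (s≤s j≤)))
      where
      small : ∀ i → w i ℕ.∸ ℓ < suc ℓ
      small i = s≤s (subst (w i ℕ.∸ ℓ ≤_) (ℕₚ.m+n∸n≡m ℓ ℓ) (ℕₚ.∸-monoˡ-≤ ℓ (weight-upper {G = G} (hasW i))))
      f : Fin (suc ℓ) → Fin (suc ℓ)
      f i = fromℕ< (small i)
      f-inj : ∀ {i j} → f i ≡ f j → i ≡ j
      f-inj {i} {j} eq = w-inj i j (ℕₚ.∸-cancelʳ-≡ (weight-lower (hasW i)) (weight-lower (hasW j))
        (trans (sym (Finₚ.toℕ-fromℕ< (small i))) (trans (cong toℕ eq) (Finₚ.toℕ-fromℕ< (small j)))))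
      hit : ∃[ i ] f i ≡ fromℕ< (s≤s j≤) → HasWeight E G (ℓ ℕ.+ j)
      hit (i , eq) = subst (HasWeight E G) (trans (sym (ℕₚ.m+[n∸m]≡n (weight-lower (hasW i)))) (cong (ℓ ℕ.+_)
        (trans (sym (Finₚ.toℕ-fromℕ< (small i))) (trans (cong toℕ eq) (Finₚ.toℕ-fromℕ< (s≤s j≤)))))) (hasW i)

    -- The intersection dimension s corresponds to the weight 2ℓ - s. For s < ℓ this exceeds ℓ, so
    -- both coefficients of the codeword are nonzero and their quotient is the multiplier.
    allWeights⇒full : AllWeights {ℓ} G → Full A
    allWeights⇒full all s s≤ = go (ℕₚ.m≤n⇒m<n∨m≡n (subst (s ≤_) dim-p s≤))
      where
      go : s < ℓ ⊎ s ≡ ℓ → ∃[ u ] (u ≢ 0# × dim (A ∩ u · A) ≡ s)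
      go (inj₂ s≡ℓ) = 1# , 1≢0 , trans (dim-resp {A ∩ 1# · A} {A} proj₁ (λ {x} p → p , x , p , sym (*-identityˡ x))) (trans dim-p (sym s≡ℓ))
      go (inj₁ s<ℓ) = step (weight-space (all j (ℕₚ.m∸n≤m ℓ s)))
        where
        j : ℕ
        j = ℓ ℕ.∸ s
        s+j : s ℕ.+ j ≡ ℓ
        s+j = ℕₚ.m+[n∸m]≡n (<⇒≤ s<ℓ)
        big : ℓ < ℓ ℕ.+ j
        big = ℕₚ.m<m+n ℓ (ℕₚ.m<n⇒0<n∸m s<ℓ)
        kill : ∀ {x V} → x ≡ 0# → x · A ⊆ V
        kill {x} {V} x≡0 (v , v∈ , refl) = ∈-resp V (sym (trans (cong (_* v) x≡0) (zeroˡ v))) (has0 V)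
        dim≤ : ∀ y → dim (y · A) ≤ ℓ
        dim≤ y = split (y ≟K 0#)
          where
          split : Dec (y ≡ 0#) → dim (y · A) ≤ ℓ
          split (yes y≡0) = ≤-trans (dim-mono {y · A} {A} (kill {y} {A} y≡0)) (≤-reflexive dim-p)
          split (no y≢0)  = ≤-reflexive (trans (dim-· A y≢0) dim-p)
        step : ∃[ x ] ∃[ y ] ((x ≢ 0# ⊎ y ≢ 0#) × dim (x · A ⊞ y · A) ≡ ℓ ℕ.+ j) → ∃[ u ] (u ≢ 0# × dim (A ∩ u · A) ≡ s)
        step (x , y , _ , eq) = u , *≢0 (inv≢0 x≢0) y≢0 , ℕₚ.+-cancelʳ-≡ (ℓ ℕ.+ j) _ _ (begin
            dim (A ∩ u · A) ℕ.+ (ℓ ℕ.+ j)  ≡⟨ cong (dim (A ∩ u · A) ℕ.+_) (sym dim-u) ⟩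
            dim (A ∩ u · A) ℕ.+ dim (A ⊞ u · A)  ≡⟨ dim-mod A (u · A) ⟩
            dim A ℕ.+ dim (u · A)  ≡⟨ cong₂ ℕ._+_ dim-p (trans (dim-· A (*≢0 (inv≢0 x≢0) y≢0)) dim-p) ⟩
            ℓ ℕ.+ ℓ  ≡⟨ cong (ℓ ℕ.+_) (sym s+j) ⟩
            ℓ ℕ.+ (s ℕ.+ j)  ≡⟨ swap-+ ℓ s j ⟩
            s ℕ.+ (ℓ ℕ.+ j)  ∎)
          where
          open ≡-Reasoning
          x≢0 : x ≢ 0#
          x≢0 x≡0 = <⇒≱ big (subst (_≤ ℓ) eq (≤-trans (dim-mono {x · A ⊞ y · A} {y · A} (⊞-lub {x · A} {y · A} {y · A} (kill {x} {y · A} x≡0) (λ p → p))) (dim≤ y)))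
          y≢0 : y ≢ 0#
          y≢0 y≡0 = <⇒≱ big (subst (_≤ ℓ) eq (≤-trans (dim-mono {x · A ⊞ y · A} {x · A} (⊞-lub {x · A} {y · A} {x · A} (λ p → p) (kill {y} {x · A} y≡0))) (dim≤ x)))
          u : K
          u = inv x * y
          forth : x · (A ⊞ u · A) ⊆ x · A ⊞ y · A
          forth (_ , (v , _ , v∈ , (v′ , v′∈ , refl) , refl) , refl) = x * v , y * v′ , (v , v∈ , refl) , (v′ , v′∈ , refl) ,
            trans (distribˡ x v _) (cong (x * v +_) (trans (cong (x *_) (*-assoc (inv x) y v′)) (*-inv-* x≢0 _)))
          back : x · A ⊞ y · A ⊆ x · (A ⊞ u · A)
          back (_ , _ , (v , v∈ , refl) , (v′ , v′∈ , refl) , refl) = v + u * v′ , (v , u * v′ , v∈ , (v′ , v′∈ , refl) , refl) ,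
            sym (trans (distribˡ x v _) (cong (x * v +_) (trans (cong (x *_) (*-assoc (inv x) y v′)) (*-inv-* x≢0 _))))
          dim-u : dim (A ⊞ u · A) ≡ ℓ ℕ.+ j
          dim-u = trans (sym (dim-· (A ⊞ u · A) x≢0)) (trans (dim-resp {x · (A ⊞ u · A)} {x · A ⊞ y · A} forth back) eq)

    -- The independence of v over F comes for free: its span is a multiple of A and so has dimension
    -- ℓ.
    block-equivalent : ∀ {c} (v : Fin ℓ → K) → c ≢ 0# → A ⊆ c · wspan v → c · wspan v ⊆ A → EquivalentTo E G (blockDiag E v)
    block-equivalent {c} v c≢0 A⊆ ⊆A = equivalent {G = G} {blockDiag E v} {p} {r} {A} {wspan v} rows joint (block-joint v indep) c≢0 A⊆ ⊆A
      where
      indep : Indep base v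
      indep = indep-dim base v (≤-reflexive (trans (trans (cong (ℓ ℕ.*_) dim-base) (ℕₚ.*-identityʳ ℓ))
        (sym (trans (sym (dim-· (wspan v) c≢0)) (trans (dim-resp {c · wspan v} {A} ⊆A A⊆) dim-p)))))

    classified : ℓ ℕ.+ ℓ ≤ m → Geometric A ⊎ QuadraticGeometric A → Case1 E ℓ G ⊎ Case2 E ℓ G
    classified 2ℓ≤m (inj₁ geo) = inj₁ (go (degree base t))
      where
      open Geometric geo
      go : ∃[ d ] DegreeOver E (InF E) t d → Case1 E ℓ G
      go (d , deg) = t , t∉F , d , deg , (λ _ → subst (λ k → k ℕ.+ k ≤ suc d) dim-p (bound deg)) , (λ _ → 2ℓ≤m) ,
        block-equivalent (powers E t ℓ) c≢0 (λ {x} p → subst (λ k → x ∈ c · poly base t k) dim-p (A⊆ p))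
          (λ {x} p → ⊆A (subst (λ k → x ∈ c · poly base t k) (sym dim-p) p))
    classified 2ℓ≤m (inj₂ geo) = inj₂ (go (degree (quad isB) t))
      where
      open QuadraticGeometric geo renaming (half to h; basis to isB)
      ℓ≡ : suc (l ℕ.* 2) ≡ ℓ
      ℓ≡ = trans (sym dim-A) dim-p
      go : ∃[ d ] DegreeOver E (Span1ξ E ξ) t d → Case2 E ℓ G
      go (d , deg) = h , m-even , l , trans (sym ℓ≡) (cong suc (ℕₚ.*-comm l 2)) , ξ , isB , t , t∉ , d , deg ,
        subst (_< d) (ℕₚ.*-comm l 2) (bound deg) ,
        block-equivalent (rvec E ξ t ℓ) c≢0 (λ {x} p → subst (λ k → x ∈ c · rspan ξ t k) ℓ≡ (A⊆ p))
          (λ {x} p → ⊆A (subst (λ k → x ∈ c · rspan ξ t k) (sym ℓ≡) p))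

  -- Optimality and the two generator matrices

  module _ {ℓ} (1≤ℓ : 1 ≤ ℓ) (2ℓ≤m : ℓ ℕ.+ ℓ ≤ m) {G : Matrix E 2 (ℓ ℕ.+ ℓ)} (nondeg : Nondegenerate E G) where

    optimal⇒cases : ThreeNonProportional E G ℓ → LrkOptimal E G → Case1 E ℓ G ⊎ Case2 E ℓ G
    optimal⇒cases three (_ , best) = go (primitive-element (≤-trans (ℕₚ.+-mono-≤ 1≤ℓ 1≤ℓ) 2ℓ≤m))
      where
      open FrameWeights {ℓ} {G} (frame {ℓ} {G} nondeg three)
      go : ∃[ t ] LinIndepOver E (InF E) (powers E t m) → Case1 E ℓ G ⊎ Case2 E ℓ G
      go (t , indep) = classified 2ℓ≤m (classify {A} (allWeights⇒full (atLeast⇒allWeights weights)) (subst (1 ≤_) (sym (Frame.dim-p (frame {ℓ} {G} nondeg three))) 1≤ℓ))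
        where
        indepℓ : Indep base (powers E t ℓ)
        indepℓ = indep-powers-≤ base t (≤-trans (ℕₚ.m≤m+n ℓ ℓ) 2ℓ≤m) indep
        full-rank : ∀ {ℓ} → 1 ≤ ℓ → FullRank E (blockDiag E (powers E t ℓ))
        full-rank {suc ℓ} _ = block-fullRank (powers E t (suc ℓ)) zero 1≢0
        weights : AtLeastWeights E G (suc ℓ)
        -- The competitor is built from a primitive element; 2ℓ ≤ m keeps all the powers it needs
        -- independent, so it has ℓ + 1 weights, and optimality passes this number on to G.
        weights = best (blockDiag E (powers E t ℓ)) (full-rank 1≤ℓ) (block-nondegenerate (powers E t ℓ) indepℓ) (suc ℓ)
          (allWeights⇒atLeast {ℓ} {G = blockDiag E (powers E t ℓ)} (λ j j≤ → powers-weight 1≤ℓ j≤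
            (indep-powers-≤ base t (≤-trans (ℕₚ.+-monoʳ-≤ ℓ j≤) 2ℓ≤m) indep)) ≤-refl)

    allWeights⇒optimal : ∀ {Y} → EquivalentTo E G Y → AllWeights {ℓ} Y → LrkOptimal E G
    allWeights⇒optimal {Y} equiv all = nondeg , λ G′ _ nondeg′ s weights →
      allWeights⇒atLeast {ℓ} {G = G} (λ j j≤ → weight-transfer {G = G} {Y} equiv (all j j≤)) (weights-bound {ℓ} {s} {G′} nondeg′ weights)

    cases⇒optimal : Case1 E ℓ G ⊎ Case2 E ℓ G → LrkOptimal E G
    cases⇒optimal (inj₁ (t , t∉ , d , deg , small , large , equiv)) = allWeights⇒optimal {blockDiag E (powers E t ℓ)} equiv (geometric-weights 1≤ℓ t∉ deg small large)
    cases⇒optimal (inj₂ (_ , _ , l , ℓ≡ , ξ , isB , t , t∉ , d , deg , 2l<d , equiv)) = allWeights⇒optimal {blockDiag E (rvec E ξ t ℓ)} equiv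
        (weights (trans ℓ≡ (cong suc (ℕₚ.*-comm 2 l))))
      where
      weights : ∀ {ℓ} → ℓ ≡ suc (l ℕ.* 2) → AllWeights {ℓ} (blockDiag E (rvec E ξ t ℓ))
      weights refl = QuadraticWeights.quadratic-weights {l = l} isB t∉ deg (subst (_< d) (ℕₚ.*-comm 2 l) 2l<d)

open import Data.Nat using (_+_)

theorem5p3 : (q m ℓ : ℕ) → IsPrimePower q → (E : FieldExt q m) →
    2 ≤ ℓ + ℓ → ℓ + ℓ ≤ m →
    (G : Matrix E 2 (ℓ + ℓ)) → FullRank E G → Nondegenerate E G →
    ThreeNonProportional E G ℓ →
    (LrkOptimal E G ⇔ (Case1 E ℓ G ⊎ Case2 E ℓ G))
theorem5p3 q m ℓ _ E 2≤ 2ℓ≤m G _ nondeg three = mk⇔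
  (optimal⇒cases E (1≤half ℓ 2≤) 2ℓ≤m {G} nondeg three) (cases⇒optimal E (1≤half ℓ 2≤) 2ℓ≤m {G} nondeg)
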